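{- A nonempty polytope is a fertilitope if and only if it is an integral binary nestohedron.
   Context: A permutation of size $n\ge 1$ is an ordering $\pi=\pi_1\cdots\pi_n$ of a set of $n$ distinct positive integers. A descent of $\pi$ is an index $i\in[n-1]$ with $\pi_i>\pi_{i+1}$. The plot of $\pi$ is the set of points $(i,\pi_i)$, $i\in[n]$. A hook of $\pi$ with southwest endpoint $(i,\pi_i)$ and northeast endpoint $(j,\pi_j)$, where $i<j$ and $\pi_i<\pi_j$, is the union of the vertical segment from $(i,\pi_i)$ to $(i,\pi_j)$ and the horizontal segment from $(i,\pi_j)$ to $(j,\pi_j)$. A point $(m,\pi_m)$ lies directly above (respectively, below) this hook if $i<m<j$ and $\pi_m>\pi_j$ (respectively, $\pi_m<\pi_j$). Let $d_1<\cdots<d_k$ be the descents of $\pi$. A valid hook configuration of $\pi$ is a tuple $\mathcal H=(H_1,\ldots,H_k)$ of hooks of $\pi$ such that: (1) $H_i$ has southwest endpoint $(d_i,\pi_{d_i})$ for each $i$; (2) no point of the plot lies directly above a hook of $\mathcal H$; (3) no two hooks of $\mathcal H$ intersect or overlap, except that the northeast endpoint of one may be the southwest endpoint of another. (If $k=0$, there is exactly one, the empty configuration.) Let $\mathrm{VHC}(\pi)$ be the set of valid hook configurations of $\pi$. Each $\mathcal H\in\mathrm{VHC}(\pi)$ induces a coloring of the $n-k$ points of the plot that are not northeast endpoints of hooks of $\mathcal H$: such a point $(m,\pi_m)$ gets the color of the lowest hook of $\mathcal H$ lying above it (i.e. among the hooks of $\mathcal H$ below which it lies, the one whose northeast endpoint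 has smallest height; a hook is not considered to lie above its own southwest endpoint), and the color of the "sky" if there is no such hook. Let $q_i$ be the number of points with the color of $H_i$ ($1\le i\le k$) and $q_0$ the number with the color of the sky. Then $\mathbf q^{\mathcal H}=(q_0,\ldots,q_k)$ is a composition of $n-k$ into $k+1$ (positive) parts. Set $\mathcal V(\pi)=\{\mathbf q^{\mathcal H}:\mathcal H\in\mathrm{VHC}(\pi)\}$, the set of valid compositions of $\pi$. The fertilitope of $\pi$ is $\mathrm{Fer}_\pi=\mathrm{conv}(\mathcal V(\pi))\subseteq\mathbb R^{k+1}$. A fertilitope is a polytope of the form $\mathrm{Fer}_\pi$ for some permutation $\pi$. A binary building set on $[k+1]=\{1,\ldots,k+1\}$ ($k\ge 0$) is a collection $\mathcal B$ of nonempty subsets of $[k+1]$ such that every set in $\mathcal B$ is an interval $\{i,i+1,\ldots,j\}$, every singleton subset of $[k+1]$ is in $\mathcal B$, and any two non-disjoint $I,J\in\mathcal B$ satisfy $I\subseteq J$ or $J\subseteq I$. For $I\subseteq[k+1]$ let $\Delta_I=\mathrm{conv}(\{e_i:i\in I\})\subseteq\mathbb R^{k+1}$, where $e_1,\ldots,e_{k+1}$ is the standard basis. A binary nestohedron is a Minkowski sum $\sum_{I\in\mathcal B}y_I\Delta_I$, where $\mathcal B$ is a binary building set on $[k+1]$ for some $k\ge0$ and every $y_I$ is a positive real number. A polytope is integral if all its vertices have integer coordinates. All polytopes are convex. -}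

module Defs where

open import Level using (Level; _⊔_; 0ℓ) renaming (suc to lsuc)
open import Algebra.Bundles using (CommutativeRing)
open import Data.Bool.Base using (if_then_else_)
open import Data.Empty.Polymorphic using (⊥)
open import Data.Fin.Base as Fin using (Fin; zero; suc; toℕ)
open import Data.Fin.Properties using (all?; any?)
import Data.Fin.Properties as Finₚ
open import Data.Fin.Subset as Subset using (Subset; ⁅_⁆; Nonempty)
open import Data.Integer.Base using (ℤ; +_; -[1+_])
open import Data.List.Base using (List; length; lookup; filter; allFin)
open import Data.List.Membership.Propositional as List using ()
open import Data.List.Relation.Unary.Unique.Propositional using (Unique)
open import Data.Nat.Base as ℕ using (ℕ; zero; suc)
import Data.Nat.Properties as ℕₚ
open import Data.Product.Base using (Σ-syntax; ∃; ∃-syntax; _×_; _,_)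
open import Data.Sum.Base using (_⊎_)
open import Data.Vec.Functional using (Vector)
open import Function.Bundles using (_⇔_)
open import Function.Definitions using (Injective)
open import Relation.Binary.Core using (Rel)
open import Relation.Binary.PropositionalEquality.Core using (_≡_; _≢_)
open import Relation.Binary.Structures using (IsDecTotalOrder)
import Relation.Binary.Construct.NonStrictToStrict as ToStrict
open import Relation.Nullary.Decidable.Core using (Dec; does; _×-dec_; _→-dec_; ¬?)
open import Relation.Nullary.Negation.Core using (¬_)
open import Relation.Unary using (Pred; _∈_; _∪_; _≐_)

-- The real numbers of classical mathematics, axiomatised (uniquely up to
-- isomorphism) as a Dedekind-complete ordered field.  Comparison is decidable
-- because the order is a classical total order.
record RealNumbers (c ℓ₁ ℓ₂ : Level) : Set (lsuc (c ⊔ ℓ₁ ⊔ ℓ₂)) where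
  infix 4 _≤_
  field
    commutativeRing : CommutativeRing c ℓ₁

  open CommutativeRing commutativeRing public

  field
    0≉1             : ¬ (0# ≈ 1#)
    inverse         : ∀ x → ¬ (x ≈ 0#) → ∃[ y ] x * y ≈ 1#
    _≤_             : Rel Carrier ℓ₂
    isDecTotalOrder : IsDecTotalOrder _≈_ _≤_
    +-monoˡ-≤       : ∀ x y z → x ≤ y → x + z ≤ y + z
    *-nonneg        : ∀ x y → 0# ≤ x → 0# ≤ y → 0# ≤ x * y

  UpperBound : ∀ {s} → Pred Carrier s → Pred Carrier (c ⊔ ℓ₂ ⊔ s)
  UpperBound S b = ∀ x → x ∈ S → x ≤ b

  field
    complete : (S : Pred Carrier (c ⊔ ℓ₁ ⊔ ℓ₂)) → ∃ S → ∃ (UpperBound S) →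
               ∃[ s ] UpperBound S s × (∀ b → UpperBound S b → s ≤ b)

  open ToStrict _≈_ _≤_ public using (_<_)

  open import Algebra.Definitions.RawMonoid +-rawMonoid public
    using (sum) renaming (_×_ to _·_)

  fromℕ : ℕ → Carrier
  fromℕ n = n · 1#

  fromℤ : ℤ → Carrier
  fromℤ (+ n)    = fromℕ n
  fromℤ -[1+ n ] = - fromℕ (suc n)

record Permutation (n : ℕ) : Set where
  field
    size≥1    : 1 ℕ.≤ n
    at        : Fin n → ℕ
    positive  : ∀ i → 1 ℕ.≤ at i
    injective : Injective _≡_ _≡_ at

open Permutation public using (at)

IsDescent : ∀ {n} → Permutation n → Fin n → Set
IsDescent π i = ∃[ j ] toℕ j ≡ suc (toℕ i) × at π i ℕ.> at π j

-- The list d₁ < ⋯ < dₖ of all descents.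
record Descents {n} (π : Permutation n) (k : ℕ) : Set where
  field
    descent    : Fin k → Fin n
    increasing : ∀ {i j} → i Fin.< j → descent i Fin.< descent j
    exactly    : ∀ m → IsDescent π m ⇔ (∃[ i ] descent i ≡ m)

open Descents public using (descent)

record Hook {n} (π : Permutation n) : Set where
  field
    sw ne   : Fin n
    sw<ne   : sw Fin.< ne
    πsw<πne : at π sw ℕ.< at π ne

open Hook public using (sw; ne)

module _ {n} {π : Permutation n} where

  DirectlyAbove DirectlyBelow : Fin n → Hook π → Set
  DirectlyAbove m H = sw H Fin.< m × m Fin.< ne H × at π m ℕ.> at π (ne H)
  DirectlyBelow m H = sw H Fin.< m × m Fin.< ne H × at π m ℕ.< at π (ne H)

  directlyBelow? : ∀ m H → Dec (DirectlyBelow m H)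
  directlyBelow? m H =
    (sw H Finₚ.<? m) ×-dec (m Finₚ.<? ne H) ×-dec (at π m ℕₚ.<? at π (ne H))

  module Colouring {k} (H : Fin k → Hook π) where

    IsNE : Pred (Fin n) 0ℓ
    IsNE m = ∃[ i ] ne (H i) ≡ m

    isNE? : ∀ m → Dec (IsNE m)
    isNE? m = any? λ i → ne (H i) Finₚ.≟ m

    -- Colour zero is the sky and colour suc i is that of the hook H i.
    HasColour : Fin n → Fin (suc k) → Set
    HasColour m zero    = ∀ i → ¬ DirectlyBelow m (H i)
    HasColour m (suc i) = DirectlyBelow m (H i) ×
      (∀ j → DirectlyBelow m (H j) → at π (ne (H i)) ℕ.≤ at π (ne (H j)))

    hasColour? : ∀ m c → Dec (HasColour m c)
    hasColour? m zero    = all? λ i → ¬? (directlyBelow? m (H i))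
    hasColour? m (suc i) = directlyBelow? m (H i) ×-dec
      all? λ j → directlyBelow? m (H j) →-dec (at π (ne (H i)) ℕₚ.≤? at π (ne (H j)))

    composition : Vector ℕ (suc k)
    composition c = length (filter
      (λ m → ¬? (isNE? m) ×-dec hasColour? m c)
      (allFin n))

record IsBinaryBuildingSet {d} (B : List (Subset d)) : Set where
  field
    nonempty   : ∀ {I} → I List.∈ B → Nonempty I
    interval   : ∀ {I} → I List.∈ B →
                 Σ[ i ∈ Fin d ] Σ[ j ∈ Fin d ] i Fin.≤ j × (∀ m → m Subset.∈ I ⇔ (i Fin.≤ m × m Fin.≤ j))
    singletons : ∀ i → ⁅ i ⁆ List.∈ B
    laminar    : ∀ {I J} → I List.∈ B → J List.∈ B → Nonempty (I Subset.∩ J) →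
                 I Subset.⊆ J ⊎ J Subset.⊆ I

module Geometry {c ℓ₁ ℓ₂} (R : RealNumbers c ℓ₁ ℓ₂) where

  open RealNumbers R using
    (Carrier; _≈_; _≤_; _<_; _+_; _*_; 0#; 1#; sum; fromℕ; fromℤ)

  ℝ^_ : ℕ → Set c
  ℝ^ d = Vector Carrier d

  infix 4 _≋_
  _≋_ : ∀ {d} → ℝ^ d → ℝ^ d → Set ℓ₁
  x ≋ y = ∀ i → x i ≈ y i

  ⟨_,_⟩ : ∀ {d} → ℝ^ d → ℝ^ d → Carrier
  ⟨ x , y ⟩ = sum λ i → x i * y i

  conv : ∀ {d s} → Pred (ℝ^ d) s → Pred (ℝ^ d) (c ⊔ ℓ₁ ⊔ ℓ₂ ⊔ s)
  conv {d} S x = Σ[ m ∈ ℕ ] Σ[ w ∈ Vector Carrier m ] Σ[ p ∈ Vector (ℝ^ d) m ]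
    (∀ j → 0# ≤ w j) × sum w ≈ 1# × (∀ j → p j ∈ S) ×
    (∀ i → x i ≈ sum λ j → w j * p j i)

  IsPolytope : ∀ {d s} → Pred (ℝ^ d) s → Set (c ⊔ ℓ₁ ⊔ ℓ₂ ⊔ s)
  IsPolytope {d} P = Σ[ m ∈ ℕ ] Σ[ p ∈ Vector (ℝ^ d) m ]
    P ≐ conv λ x → ∃[ j ] x ≋ p j

  -- A vertex is a zero-dimensional face: the unique maximiser over P of some
  -- linear functional.
  IsVertex : ∀ {d s} → Pred (ℝ^ d) s → Pred (ℝ^ d) (c ⊔ ℓ₁ ⊔ ℓ₂ ⊔ s)
  IsVertex {d} P v = v ∈ P × Σ[ a ∈ ℝ^ d ] ∀ x → x ∈ P →
    ⟨ a , x ⟩ ≤ ⟨ a , v ⟩ × (⟨ a , x ⟩ ≈ ⟨ a , v ⟩ → x ≋ v)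

  IsIntegral : ∀ {d s} → Pred (ℝ^ d) s → Set (c ⊔ ℓ₁ ⊔ ℓ₂ ⊔ s)
  IsIntegral P = ∀ v → IsVertex P v → ∀ i → ∃[ z ] v i ≈ fromℤ z

  Plane : Set c
  Plane = Carrier × Carrier

  infix 4 _≈ₚ_
  _≈ₚ_ : Plane → Plane → Set ℓ₁
  (x , y) ≈ₚ (x′ , y′) = x ≈ x′ × y ≈ y′

  module _ {n} {π : Permutation n} where

    col row : Fin n → Carrier
    col i = fromℕ (suc (toℕ i))
    row i = fromℕ (at π i)

    plotPoint : Fin n → Plane
    plotPoint i = col i , row i

    vertical horizontal hook : Hook π → Pred Plane (ℓ₁ ⊔ ℓ₂)
    vertical   H (x , y) = x ≈ col (sw H) × row (sw H) ≤ y × y ≤ row (ne H)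
    horizontal H (x , y) = y ≈ row (ne H) × col (sw H) ≤ x × x ≤ col (ne H)
    hook H = vertical H ∪ horizontal H

    record ValidHookConfiguration {k} (D : Descents π k) : Set (c ⊔ ℓ₁ ⊔ ℓ₂) where
      field
        hooks       : Fin k → Hook π
        sw-descent  : ∀ i → sw (hooks i) ≡ descent D i
        none-above  : ∀ i m → ¬ DirectlyAbove m (hooks i)
        no-crossing : ∀ i j → i ≢ j → ∀ p → p ∈ hook (hooks i) → p ∈ hook (hooks j) →
          (p ≈ₚ plotPoint (ne (hooks i)) × p ≈ₚ plotPoint (sw (hooks j))) ⊎
          (p ≈ₚ plotPoint (sw (hooks i)) × p ≈ₚ plotPoint (ne (hooks j)))

    validCompositions : ∀ {k} → Descents π k → Pred (Vector ℕ (suc k)) (c ⊔ ℓ₁ ⊔ ℓ₂)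
    validCompositions D q = Σ[ 𝓗 ∈ ValidHookConfiguration D ] ∀ i →
      q i ≡ Colouring.composition (ValidHookConfiguration.hooks 𝓗) i

    Fer : ∀ {k} → Descents π k → Pred (ℝ^ suc k) (c ⊔ ℓ₁ ⊔ ℓ₂)
    Fer D = conv λ x → ∃[ q ] q ∈ validCompositions D × x ≋ (λ i → fromℕ (q i))

  -- A fertilitope of a permutation with k descents lives in ℝᵏ⁺¹; in
  -- particular there are none in ℝ⁰.
  IsFertilitope : ∀ {d s} → Pred (ℝ^ d) s → Set (c ⊔ ℓ₁ ⊔ ℓ₂ ⊔ s)
  IsFertilitope {zero}  P = ⊥
  IsFertilitope {suc k} P =
    Σ[ n ∈ ℕ ] Σ[ π ∈ Permutation n ] Σ[ D ∈ Descents π k ] P ≐ Fer D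

  e : ∀ {d} → Fin d → ℝ^ d
  e i j = if does (i Finₚ.≟ j) then 1# else 0#

  Δ : ∀ {d} → Subset d → Pred (ℝ^ d) (c ⊔ ℓ₁ ⊔ ℓ₂)
  Δ I = conv λ x → ∃[ i ] i Subset.∈ I × x ≋ e i

  infixr 7 _⊙_
  _⊙_ : ∀ {d s} → Carrier → Pred (ℝ^ d) s → Pred (ℝ^ d) (c ⊔ ℓ₁ ⊔ s)
  _⊙_ {d} t A x = Σ[ a ∈ ℝ^ d ] a ∈ A × x ≋ (λ i → t * a i)

  minkowskiSum : ∀ {d m s} → (Fin m → Pred (ℝ^ d) s) → Pred (ℝ^ d) (c ⊔ ℓ₁ ⊔ s)
  minkowskiSum {d} {m} A x = Σ[ a ∈ Vector (ℝ^ d) m ] (∀ j → a j ∈ A j) × x ≋ (λ i → sum λ j → a j i)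

  -- The building set is listed without repetition, so that y is one
  -- coefficient per member.
  IsBinaryNestohedron : ∀ {d s} → Pred (ℝ^ d) s → Set (c ⊔ ℓ₁ ⊔ ℓ₂ ⊔ s)
  IsBinaryNestohedron {zero}  P = ⊥
  IsBinaryNestohedron {suc k} P =
    Σ[ B ∈ List (Subset (suc k)) ] Unique B × IsBinaryBuildingSet B ×
    (Σ[ y ∈ Vector Carrier (length B) ] (∀ j → 0# < y j) × P ≐ minkowskiSum λ j → y j ⊙ Δ (lookup B j))

module Submission where

open import Defs
open import Data.Nat.Base using (ℕ)
open import Data.Product.Base using (∃; _×_)
open import Function.Bundles using (_⇔_)
open import Relation.Unary using (Pred)
import Algebra.Properties.Monoid.Mult as Mult
import Algebra.Properties.Ring as RingProperties
import Algebra.Properties.Semiring.Sum as SemiringSum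
import Algebra.Solver.Ring.NaturalCoefficients.Default as SemiringSolver
open import Data.Bool.Base using (if_then_else_; true; false)
open import Data.Fin.Base as Fin using (Fin; zero; suc; toℕ; _↑ˡ_; _↑ʳ_; splitAt)
open import Data.Fin.Properties as Fin using (all?; any?; toℕ-injective)
open import Data.Fin.Subset as Subset using (Subset; ⁅_⁆; ⊤; ⊥; Nonempty; _∩_; inside; outside)
import Data.Fin.Subset.Properties as Subset
open import Data.Integer.Base using (+_; -[1+_])
open import Data.List.Base as List using (List; []; _∷_; [_]; length; replicate; _∷ʳ_; filter; tabulate; allFin; lookup)
open import Data.List.Extrema.Nat using (max; xs≤max)
import Data.List.Membership.DecPropositional as DecMembership
open import Data.List.Membership.Propositional using (_∈_; _∉_; find; lose)
open import Data.List.Membership.Propositional.Properties using (∈-insert; ∈-filter⁺; ∈-filter⁻; ∈-allFin; ∈-++⁺ˡ; ∈-++⁺ʳ; ∈-++⁻; ∈-tabulate⁺; ∈-tabulate⁻; ∈-lookup)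
open import Data.List.Properties using (++-assoc; ++-identityʳ; length-++; length-replicate; ++-conicalʳ; ∷-injective; ∷-injectiveˡ; filter-accept; filter-reject; filter-≐; map-cong-local; map-tabulate; tabulate-cong; tabulate-lookup; length-tabulate)
open import Data.List.Relation.Binary.Pointwise as Pointwise using (Pointwise; []; _∷_)
open import Data.List.Relation.Unary.All as All using (All; []; _∷_)
import Data.List.Relation.Unary.All.Properties as All
open import Data.List.Relation.Unary.AllPairs using ([]; _∷_; AllPairs)
import Data.List.Relation.Unary.AllPairs.Properties as AllPairs
open import Data.List.Relation.Unary.Any as Any using (here; there)
open import Data.List.Relation.Unary.Any.Properties using (lookup-index)
open import Data.List.Relation.Unary.Unique.Propositional using (Unique)
import Data.List.Relation.Unary.Unique.Propositional.Properties as Unique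
open import Data.Maybe.Base using (Maybe; just; nothing)
open import Data.Nat.Base as ℕ using (zero; suc; z≤n; s≤s; z<s)
import Data.Nat.Properties as ℕ
open import Data.Product.Base using (∃-syntax; Σ-syntax; _,_; proj₁; proj₂)
open import Data.Sum.Base using (_⊎_; inj₁; inj₂)
import Data.Vec.Base as Vec
open import Data.Vec.Functional as Vector using (Vector)
import Data.Vec.Properties as Vec
open import Function.Base using (_∘_; id; case_of_)
open import Function.Bundles using (mk⇔; Equivalence)
open import Level using (_⊔_; 0ℓ; Lift; lift)
open import Relation.Binary.Definitions using (tri<; tri≈; tri>)
open import Relation.Binary.PropositionalEquality as ≡ using (_≡_; _≢_)
open import Relation.Binary.Structures using (IsDecTotalOrder)
open import Relation.Nullary.Decidable using (Dec; yes; no; _×-dec_; _→-dec_; ¬?; does; dec-true; dec-false)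
open import Relation.Nullary.Negation using (¬_; contradiction)
open import Relation.Unary using (Decidable; _≐_)
open import Relation.Unary.Properties using (≐-trans; ≐-sym)

open Equivalence using (to; from)

-- Only the arcs from the southwest to the northeast endpoints of the hooks matter:
-- valid configurations are the noncrossing choices of an arc at each descent that
-- ends at a left-to-right maximum, and a point takes the colour of the innermost
-- arc over it.  Choosing the arcs from right to left turns this into a process on
-- the increasing list of the points not yet under an arc.
--
-- Let V(π, u) be the set of compositions of π followed by u larger letters in
-- increasing order.  If M exceeds all letters of X and Y and Y is nonempty, then
-- V(XM, u) = V(X, u + 1), and V(XMY, u) is the union of V(XM, u₁) × V(Y, u₂) over
-- u₁ + u₂ + 1 = u, because the hook of M must end at one of the u letters.  By
-- induction, once V(π, n) is nonempty, V(π, n + v) is the discrete Minkowski sum of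
-- V(π, n) and v full simplices, and V(π, n) is given by a binary tree whose leaves
-- and nodes carry the coefficients of a binary building set.  Read backwards, the
-- same two rules produce a permutation for every tree.
--
-- Conversely a binary building set is read as a tree by cutting its interval after
-- the largest proper block at the left end.  The coefficients of an integral binary
-- nestohedron are integers, being differences of coordinates of vertices.

-- The obstacle is that V(π, u) may be empty for small u, since every hook needs a letter to end at.
-- The induction therefore carries the number n of letters that are still missing. A letter beyond
-- these n may be used in any part of the word, and this freedom of placement is what a full simplex
-- records; once nothing is missing, a new maximum turns it into weight at the root. A nonempty
-- fertilitope comes from a permutation with n = 0.
--
-- The recursion lives on lattice points, while the theorem speaks of real polytopes. The two levels
-- agree because convex hulls commute with products and Minkowski sums, and a dilated simplex with
-- integral factor is the hull of its lattice points.
--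
-- For integrality, a vertex has to come with a linear functional that singles it out. All points of
-- the polytope of a tree have the same coordinate sum, so adding a constant to the functional on
-- one subtree does not move its maximiser there. Hence either side of a node can be made to receive
-- the whole weight of that node, which yields enough vertices to isolate each coefficient.

module Words where

  open import Data.Nat.Base using (_+_; _<_; _≤_)
  open import Data.List.Base using (_++_; map)
  open ≡ using (refl; sym; trans; cong; cong₂; subst)
  open import Data.Nat.Properties hiding (_≟_)

  -- Scans of words from right to left

  module Scanning {A : Set} (val : A → ℕ) where

    data Below (x : A) : List A → Set where
      []    : Below x []
      below : ∀ {y T} → val x < val y → Below x (y ∷ T)

    -- Scan X S T q: the word X is read from right to left, starting and ending with
    -- the lists S and T of the letters that are neither sheltered by a hook nor at
    -- its northeast end.  At a descent x the hook ends at the letter b, shelters the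
    -- letters y ∷ P and contributes their number to the composition q.
    data Scan : List A → List A → List A → List ℕ → Set where
      done : ∀ {S} → Scan [] S S []
      rise : ∀ {x X S T q} → Scan X S T q → Below x T → Scan (x ∷ X) S (x ∷ T) q
      fall : ∀ {x y b X S P T T₀ q} → Scan X S T₀ q → T₀ ≡ y ∷ P ++ b ∷ T →
             val y ≤ val x → val x < val b →
             Scan (x ∷ X) S (x ∷ T) (suc (length P) ∷ q)

    scan-++ : ∀ {X Y S T U p q} → Scan Y S T q → Scan X T U p → Scan (X ++ Y) S U (p ++ q)
    scan-++ s done           = s
    scan-++ s (rise t x<)    = rise (scan-++ s t) x<
    scan-++ s (fall t e l m) = fall (scan-++ s t) e l m

    scan-split : ∀ X {Y S U r} → Scan (X ++ Y) S U r →
                 ∃[ T ] ∃[ p ] ∃[ q ] Scan Y S T q × Scan X T U p × r ≡ p ++ q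
    scan-split []      s = _ , [] , _ , s , done , refl
    scan-split (x ∷ X) (rise s x<) with scan-split X s
    ... | T , p , q , t , u , refl = T , p , q , t , rise u x< , refl
    scan-split (x ∷ X) (fall s e l m) with scan-split X s
    ... | T , p , q , t , u , refl = T , _ , q , t , fall u e l m , refl

    scan-head : ∀ {x X S T q} → Scan (x ∷ X) S T q → ∃[ T′ ] T ≡ x ∷ T′
    scan-head (rise _ _)     = _ , refl
    scan-head (fall _ _ _ _) = _ , refl

    -- The letters `F` lie behind everything the scan touches. The only new comparison arises when a
    -- letter is pushed onto an empty list and meets the head of `F`.
    scan-frame : ∀ {X S T q} F → All (λ x → All (λ f → val x < val f) F) X →
                 Scan X S T q → Scan X (S ++ F) (T ++ F) q
    scan-frame F []        done = done
    scan-frame F (x<F ∷ a) (rise {T = T} s x<) = rise (scan-frame F a s) (extend T x<F x<)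
      where
      extend : ∀ {x F} T → All (λ f → val x < val f) F → Below x T → Below x (T ++ F)
      extend []      []       _         = []
      extend []      (lt ∷ _) _         = below lt
      extend (_ ∷ _) _        (below h) = below h
    scan-frame F (_ ∷ a) (fall {y = y} {b = b} {P = P} {T = T} s refl l m) =
      fall (scan-frame F a s) (cong (y ∷_) (++-assoc P (b ∷ T) F)) l m

    -- A hook deletes only an initial stretch of the list, so the end `f ∷ F` of `T` persists from
    -- the moment `f` is on the list. As `f` exceeds every letter of `X`, it was there from the
    -- start.
    scan-unframe : ∀ {X S T q} P {f F} → All (λ x → val x < val f) X →
                   Scan X S T q → T ≡ P ++ f ∷ F → ∃[ S′ ] S ≡ S′ ++ f ∷ F × Scan X S′ P q
    scan-unframe P []         done e = P , e , done
    scan-unframe []      (x<f ∷ _) (rise _ _) refl = contradiction x<f (<-irrefl refl)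
    scan-unframe []      (x<f ∷ _) (fall _ _ _ _) refl = contradiction x<f (<-irrefl refl)
    scan-unframe (x ∷ P) (_ ∷ a) (rise s x<) refl with scan-unframe P a s refl
    ... | S′ , e , s′ = S′ , e , rise s′ (restrict P x<)
      where
      restrict : ∀ {x F} P → Below x (P ++ F) → Below x P
      restrict []      _         = []
      restrict (_ ∷ _) (below h) = below h
    scan-unframe (x ∷ P) {f} {F} (_ ∷ a) (fall {y = y} {b = b} {P = Q} s refl l m) refl
      with scan-unframe (y ∷ Q ++ b ∷ P) a s (cong (y ∷_) (sym (++-assoc Q (b ∷ P) (f ∷ F))))
    ... | S′ , e , s′ = S′ , e , fall s′ refl l m

  module _ {A B : Set} (v : A → ℕ) (w : B → ℕ) (Q R : A → B → Set)
           (Q⇒R : ∀ {x x′} → Q x x′ → R x x′)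
           (<⇔< : ∀ {x x′ y y′} → Q x x′ → R y y′ → (v x < v y) ⇔ (w x′ < w y′)) where

    private
      module V = Scanning v
      module W = Scanning w
    open V using (rise; fall; done; []; below)

    private
      split : ∀ P {b T U} → Pointwise R (P ++ b ∷ T) U →
              ∃[ P′ ] ∃[ b′ ] ∃[ T′ ] U ≡ P′ ++ b′ ∷ T′ × R b b′ × Pointwise R T T′ × length P ≡ length P′
      split []      (r ∷ rs) = [] , _ , _ , refl , r , rs , refl
      split (_ ∷ P) (r ∷ rs) with split P rs
      ... | P′ , b′ , T′ , refl , r′ , rs′ , e = _ ∷ P′ , b′ , T′ , refl , r′ , rs′ , cong suc e

    -- A scan compares only the letter being read with letters on the list, so relations that
    -- respect these comparisons carry it over. This serves both to exchange large letters and to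
    -- pass between positions and values.
    scan-simulate : ∀ {X X′ S S′ T q} → Pointwise Q X X′ → Pointwise R S S′ → V.Scan X S T q →
                    ∃[ T′ ] Pointwise R T T′ × W.Scan X′ S′ T′ q
    scan-simulate []       rs done = _ , rs , W.done
    scan-simulate (q ∷ qs) rs (rise s x<) with scan-simulate qs rs s
    ... | T′ , ts , s′ = _ , Q⇒R q ∷ ts , W.rise s′ (transport x< ts)
      where
      transport : ∀ {T T′} → V.Below _ T → Pointwise R T T′ → W.Below _ T′
      transport []        []      = W.[]
      transport (below h) (r ∷ _) = W.below (to (<⇔< q r) h)
    scan-simulate (q ∷ qs) rs (fall {P = P} s refl l m) with scan-simulate qs rs s
    ... | _ , y≈ ∷ ts , s′ with split P ts
    ... | P′ , b′ , T′ , refl , r , ts′ , e =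
      _ , Q⇒R q ∷ ts′ ,
      subst (λ k → W.Scan _ _ _ (suc k ∷ _)) (sym e)
        (W.fall s′ refl (≮⇒≥ λ h → <⇒≱ (from (<⇔< q y≈) h) l) (to (<⇔< q r) m))

  module Word = Scanning id
  open Word

  LargeRel : ℕ → ℕ → ℕ → Set
  LargeRel N x y = x ≡ y ⊎ (N ≤ x × N ≤ y)

  scan-large : ∀ {N X S S′ T q} → All (_< N) X → Pointwise (LargeRel N) S S′ → Scan X S T q →
               ∃[ T′ ] length T ≡ length T′ × Scan X S′ T′ q
  scan-large {N} {X} X<N rs s
    with scan-simulate id id (λ x y → x ≡ y × x < N) (LargeRel N) (λ p → inj₁ (proj₁ p)) compat (diag X<N) rs s
    where
    diag : ∀ {X} → All (_< N) X → Pointwise (λ x y → x ≡ y × x < N) X X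
    diag []       = []
    diag (p ∷ ps) = (refl , p) ∷ diag ps
    compat : ∀ {x x′ y y′} → x ≡ x′ × x < N → LargeRel N y y′ → (x < y) ⇔ (x′ < y′)
    compat (refl , _)   (inj₁ refl)    = mk⇔ id id
    compat (refl , x<N) (inj₂ (a , b)) = mk⇔ (λ _ → <-≤-trans x<N b) (λ _ → <-≤-trans x<N a)
  ... | T′ , ts , s′ = T′ , Pointwise.Pointwise-length ts , s′

  -- The compositions of the word X followed by u larger letters in increasing
  -- order; being larger than X, these may all be represented by the letter N.
  Comp : ℕ → List ℕ → ℕ → List ℕ → Set
  Comp N X u c = ∃[ T ] ∃[ q ] Scan X (replicate u N) T q × c ≡ length T ∷ q

  large-refl : ∀ {N} S → Pointwise (LargeRel N) S S
  large-refl []      = []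
  large-refl (x ∷ S) = inj₁ refl ∷ large-refl S

  scan-max : ∀ {N M u T q} → M < N → Scan [ M ] (replicate u N) T q → T ≡ M ∷ replicate u N × q ≡ []
  scan-max M<N (rise done x<) = refl , refl
  scan-max {u = suc u} M<N (fall done e l m) = contradiction M<N (≤⇒≯ (≤-trans (≤-reflexive (∷-injectiveˡ e)) l))

  scan-max⁺ : ∀ {N M} u → M < N → Scan [ M ] (replicate u N) (M ∷ replicate u N) []
  scan-max⁺ zero    M<N = rise done []
  scan-max⁺ (suc u) M<N = rise done (below M<N)

  -- `M` lies below all final letters, so it is not hooked and stays on the list, where it exceeds
  -- all of `X` and acts as one more final letter.
  comp-∷ʳ : ∀ {N X M u c} → All (_< M) X → M < N → Comp N (X ∷ʳ M) u c ⇔ Comp N X (suc u) c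
  comp-∷ʳ {N} {X} {M} {u} X<M M<N = mk⇔ f g
    where
    f : ∀ {c} → Comp N (X ∷ʳ M) u c → Comp N X (suc u) c
    f (T , _ , s , refl) with scan-split X s
    ... | _ , p , q , s₁ , s₂ , refl with scan-max M<N s₁
    -- The threshold is `M` itself: seen from `X`, both `M` and `N` are large.
    ... | refl , refl with scan-large X<M (inj₂ (≤-refl , <⇒≤ M<N) ∷ large-refl _) s₂
    ... | T′ , e , s′ = T′ , p , s′ , cong₂ _∷_ e (++-identityʳ p)
    g : ∀ {c} → Comp N X (suc u) c → Comp N (X ∷ʳ M) u c
    g (T , p , s , refl) with scan-large X<M (inj₂ (<⇒≤ M<N , ≤-refl) ∷ large-refl _) s
    ... | T′ , e , s′ = T′ , p ++ [] , scan-++ (scan-max⁺ u M<N) s′ , cong₂ _∷_ e (sym (++-identityʳ p))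

  replicate-split : ∀ {N : ℕ} u P {b T} → replicate u N ≡ P ++ b ∷ T →
    ∃[ u₂ ] ∃[ u₁ ] u ≡ u₂ + suc u₁ × P ≡ replicate u₂ N × b ≡ N × T ≡ replicate u₁ N
  replicate-split (suc u) []      refl = 0 , u , refl , refl , refl , refl
  replicate-split (suc u) (x ∷ P) e with ∷-injective e
  ... | refl , e′ with replicate-split u P e′
  ... | u₂ , u₁ , refl , refl , e₁ , e₂ = suc u₂ , u₁ , refl , refl , e₁ , e₂

  replicate-join : ∀ (N : ℕ) u₂ u₁ → replicate u₂ N ++ N ∷ replicate u₁ N ≡ replicate (u₂ + suc u₁) N
  replicate-join N zero     u₁ = refl
  replicate-join N (suc u₂) u₁ = cong (N ∷_) (replicate-join N u₂ u₁)

  -- The hook of `M` shelters `u₂` final letters, ends at the next and leaves `u₁`. What is sky for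
  -- `Y` takes the colour of this hook, so `c₂` enters unchanged. For `X` the list is then the same
  -- as if `M` stood before `u₁` letters, whence the word `X ∷ʳ M`.
  CompSplit : ℕ → List ℕ → List ℕ → ℕ → List ℕ → Set
  CompSplit N X Y u c = ∃[ u₂ ] ∃[ u₁ ] ∃[ c₁ ] ∃[ c₂ ]
    u ≡ u₂ + suc u₁ × Comp N X u₁ c₁ × Comp N Y u₂ c₂ × c ≡ c₁ ++ c₂

  -- M, being larger than what surrounds it, is hooked to one of the u final
  -- letters, which splits them into those sheltered by that hook and the others.
  comp-split : ∀ {N X M y Y u c} → All (_< M) (y ∷ Y) → M < N →
    Comp N (X ++ M ∷ y ∷ Y) u c ⇔
    CompSplit N (X ∷ʳ M) (y ∷ Y) u c
  comp-split {N} {X} {M} {y} {Y} {u} Y<M@(y<M ∷ _) M<N = mk⇔ f g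
    where
    f : ∀ {c} → Comp N (X ++ M ∷ y ∷ Y) u c → CompSplit N (X ∷ʳ M) (y ∷ Y) u c
    f (U , _ , s , refl) with scan-split X s
    ... | _ , p , q , rise s₁ x< , s₂ , refl with scan-head s₁ | x<
    ... | _ , refl | below M<y = contradiction M<y (<-asym y<M)
    f (U , _ , s , refl) | _ , p , _ , fall {P = P} {T = T} {q = q} s₁ refl l M<b , s₂ , refl
      with scan-head s₁
    -- The end `b` of the hook exceeds `M` and so all of `y ∷ Y`; hence it is one of the final
    -- letters.
    ... | _ , refl with scan-unframe (y ∷ P) (All.map (λ h → <-trans h M<b) Y<M) s₁ refl
    ... | S′ , e , s₁′ with replicate-split u S′ e
    ... | u₂ , u₁ , refl , refl , refl , refl =
      u₂ , u₁ , length U ∷ (p ++ []) , suc (length P) ∷ q , refl ,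
      (U , p ++ [] , scan-++ (scan-max⁺ u₁ M<N) s₂ , refl) ,
      (y ∷ P , q , s₁′ , refl) ,
      cong (length U ∷_) (cong (_++ (suc (length P) ∷ q)) (sym (++-identityʳ p)))
    g : ∀ {c} → CompSplit N (X ∷ʳ M) (y ∷ Y) u c → Comp N (X ++ M ∷ y ∷ Y) u c
    g (u₂ , u₁ , _ , _ , refl , (U , _ , s₂ , refl) , (T , q , s₁ , refl) , refl) with scan-split X s₂
    ... | _ , p , _ , s₃ , s₄ , refl with scan-max M<N s₃
    ... | refl , refl with scan-head s₁
    ... | P , refl =
      U , p ++ suc (length P) ∷ q ,
      scan-++ (fall (subst (λ S → Scan _ S _ _) (replicate-join N u₂ u₁)
                      (scan-frame (N ∷ replicate u₁ N) (All.map (λ h → <-trans h M<N ∷ All.replicate⁺ u₁ (<-trans h M<N)) Y<M) s₁))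
                    refl (<⇒≤ y<M) M<N) s₄ ,
      cong (length U ∷_) (cong (_++ (suc (length P) ∷ q)) (++-identityʳ p))

  -- Discrete Minkowski sums with dilated simplices

  data Add : ℕ → List ℕ → List ℕ → Set where
    []  : Add 0 [] []
    _∷_ : ∀ {x u c d} a → Add u c d → Add (a + u) (x ∷ c) (a + x ∷ d)

  add-cast : ∀ {u v c d d′} → u ≡ v → d ≡ d′ → Add u c d → Add v c d′
  add-cast refl refl a = a

  add-cast-head : ∀ {u v c x y d} → u ≡ v → x ≡ y → Add u c (x ∷ d) → Add v c (y ∷ d)
  add-cast-head refl refl a = a

  add-suc-head : ∀ {u x c y d} → Add u (x ∷ c) (y ∷ d) → Add u (suc x ∷ c) (suc y ∷ d)
  add-suc-head {x = x} (a ∷ as) = add-cast-head refl (+-suc a x) (a ∷ as)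

  add-zero : ∀ c → Add 0 c c
  add-zero []      = []
  add-zero (x ∷ c) = 0 ∷ add-zero c

  add-zero⁻¹ : ∀ {u c d} → u ≡ 0 → Add u c d → d ≡ c
  add-zero⁻¹ e []          = refl
  add-zero⁻¹ e (zero ∷ as) = cong (_ ∷_) (add-zero⁻¹ e as)

  add-single : ∀ {u x d} → Add u [ x ] d → d ≡ [ u + x ]
  add-single (a ∷ []) = cong (λ u → [ u + _ ]) (sym (+-identityʳ a))

  add-single⁺ : ∀ u x → Add u [ x ] [ u + x ]
  add-single⁺ u x = add-cast (+-identityʳ u) refl (u ∷ [])

  add-++ : ∀ {u v c c′ d d′} → Add u c c′ → Add v d d′ → Add (u + v) (c ++ d) (c′ ++ d′)
  add-++ []       b = b
  add-++ {v = v} (_∷_ {u = u} x a) b = add-cast (sym (+-assoc x u v)) refl (x ∷ add-++ a b)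

  add-++⁻ : ∀ {w d e} c → Add w (c ++ d) e →
            ∃[ u ] ∃[ v ] ∃[ c′ ] ∃[ d′ ] u + v ≡ w × Add u c c′ × Add v d d′ × e ≡ c′ ++ d′
  add-++⁻ []      a       = 0 , _ , [] , _ , refl , [] , a , refl
  add-++⁻ (x ∷ c) (y ∷ a) with add-++⁻ c a
  ... | u , v , c′ , d′ , refl , a₁ , a₂ , refl = y + u , v , _ , d′ , +-assoc y u v , y ∷ a₁ , a₂ , refl

  interchange : ∀ a b c d → (a + b) + (c + d) ≡ (a + c) + (b + d)
  interchange a b c d = +-interchange a b c d
    where
    open import Algebra.Properties.CommutativeSemigroup +-commutativeSemigroup using () renaming (interchange to +-interchange)

  add-trans : ∀ {u v c d e} → Add u c d → Add v d e → Add (u + v) c e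
  add-trans [] [] = []
  add-trans (_∷_ {x} {u} a as) (_∷_ {u = v} b bs) =
    add-cast-head (interchange a b u v)
      (trans (cong (_+ x) (+-comm a b)) (+-assoc b a x))
      ((a + b) ∷ add-trans as bs)

  -- The integer decomposition property of dilated simplices: the units are given to the first
  -- summand from left to right until `u` of them are used.
  add-split : ∀ u v {w c e} → w ≡ u + v → Add w c e → ∃[ d ] Add u c d × Add v d e
  add-split zero    v {c = c} refl as = c , add-zero c , as
  add-split (suc u) v {c = c} e (zero ∷ as) with add-split (suc u) v e as
  ... | d , as₁ , as₂ = _ ∷ d , 0 ∷ as₁ , 0 ∷ as₂
  add-split (suc u) v {c = x ∷ _} e (suc a ∷ as) with add-split u v (suc-injective e) (_∷_ {x = x} a as)
  ... | _ , b ∷ bs , cs = _ , suc b ∷ bs , add-suc-head cs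

  -- The weights of a binary building set: a node stands for the union of the
  -- intervals of its subtrees, with weight 0 if this union is not in the set.
  data Tree {a} (A : Set a) : ℕ → Set a where
    leaf : A → Tree A 1
    node : ∀ {m n} → Tree A m → Tree A n → A → Tree A (m + n)

  data Leaves {a p} {A : Set a} (P : A → Set p) : ∀ {n} → Tree A n → Set (a ⊔ p) where
    leaf : ∀ {x} → P x → Leaves P (leaf x)
    node : ∀ {m n} {l : Tree A m} {r : Tree A n} {y} → Leaves P l → Leaves P r → Leaves P (node l r y)

  Gen : ∀ {n} → Tree ℕ n → List ℕ → Set
  Gen (leaf a)     c = c ≡ [ a ]
  Gen (node l r y) c = ∃[ c₁ ] ∃[ c₂ ] Gen l c₁ × Gen r c₂ × Add y (c₁ ++ c₂) c

  gen-inhabited : ∀ {n} (t : Tree ℕ n) → ∃[ x ] ∃[ c ] Gen t (x ∷ c)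
  gen-inhabited (leaf a) = a , [] , refl
  gen-inhabited (node l r y) with gen-inhabited l | gen-inhabited r
  ... | x , c , g | z , d , h =
    y + x , c ++ z ∷ d , _ , _ , g , h , add-cast (+-identityʳ y) refl (y ∷ add-zero _)

  add-length : ∀ {u c d} → Add u c d → length d ≡ length c
  add-length []       = refl
  add-length (_ ∷ as) = cong suc (add-length as)

  gen-length : ∀ {n} (t : Tree ℕ n) {c} → Gen t c → length c ≡ n
  gen-length (leaf a)     refl = refl
  gen-length (node l r y) (c₁ , c₂ , g , h , a) =
    trans (add-length a) (trans (length-++ c₁) (cong₂ _+_ (gen-length l g) (gen-length r h)))

  -- The simplex on all coordinates belongs to the root, so one more copy of it changes the root
  -- weight alone.
  bump : ∀ {n} → Tree ℕ n → Tree ℕ n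
  bump (leaf a)     = leaf (suc a)
  bump (node l r y) = node l r (suc y)

  gen-bump : ∀ {n} (t : Tree ℕ n) {c} → Gen (bump t) c → ∃[ b ] Gen t b × Add 1 b c
  gen-bump (leaf a)     refl = _ , refl , 1 ∷ []
  gen-bump (node l r y) (c₁ , c₂ , g , h , a) with add-split y 1 (sym (+-comm y 1)) a
  ... | d , a₁ , a₂ = d , (c₁ , c₂ , g , h , a₁) , a₂

  gen-bump⁺ : ∀ {n} (t : Tree ℕ n) {b c} → Gen t b → Add 1 b c → Gen (bump t) c
  gen-bump⁺ (leaf a)     refl as = add-single as
  gen-bump⁺ (node l r y) (c₁ , c₂ , g , h , a) a′ =
    c₁ , c₂ , g , h , add-cast (+-comm y 1) refl (add-trans a a′)

  bump-leaves : ∀ {n} {t : Tree ℕ n} → Leaves (0 <_) t → Leaves (0 <_) (bump t)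
  bump-leaves (leaf p)   = leaf z<s
  bump-leaves (node p q) = node p q

  -- Compositions exist once n large letters are appended to X, and each further
  -- one adds a full simplex.
  Tiles : ∀ {d} → List ℕ → ℕ → Tree ℕ d → Set
  Tiles X n t = ∀ {N} → All (_< N) X → ∀ {u c} →
    Comp N X u c ⇔ (∃[ v ] ∃[ b ] u ≡ n + v × Gen t b × Add v b c)

  comp-[] : ∀ {N u c} → Comp N [] u c ⇔ c ≡ [ u ]
  comp-[] {u = u} = mk⇔ (λ { (_ , _ , done , refl) → cong [_] (length-replicate u) })
    (λ { refl → _ , _ , done , cong [_] (sym (length-replicate u)) })

  tiles-single : ∀ M → Tiles [ M ] 0 (leaf 1)
  tiles-single M (M<N ∷ []) = mk⇔
    (λ c → case to comp-[] (to (comp-∷ʳ [] M<N) c) of λ { refl → _ , _ , refl , refl , add-cast refl (cong [_] (+-comm _ 1)) (add-single⁺ _ 1) })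
    (λ { (v , _ , refl , refl , a) → from (comp-∷ʳ [] M<N) (from comp-[] (trans (add-single a) (cong [_] (+-comm v 1)))) })

  -- With no deficit left the new maximum is a surplus letter: every composition now contains one
  -- more full simplex, which the root absorbs.
  tiles-∷ʳ-zero : ∀ {d X M} {t : Tree ℕ d} → All (_< M) X → Tiles X 0 t → Tiles (X ∷ʳ M) 0 (bump t)
  tiles-∷ʳ-zero {X = X} {t = t} X<M T XM<N with All.∷ʳ⁻ XM<N
  ... | X<N , M<N = mk⇔
    (λ c → case to (T X<N) (to (comp-∷ʳ X<M M<N) c) of λ
      { (suc v , b , refl , g , a) → case add-split 1 v refl a of λ
        { (b′ , a₁ , a₂) → v , b′ , refl , gen-bump⁺ t g a₁ , a₂ } })
    (λ { (v , b′ , refl , g , a₂) → case gen-bump t g of λ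
      { (b , g′ , a₁) → from (comp-∷ʳ X<M M<N) (from (T X<N) (suc v , b , refl , g′ , add-trans a₁ a₂)) } })

  -- The new maximum supplies one of the missing letters, so the deficit drops and the tree stays.
  tiles-∷ʳ-suc : ∀ {d X M n} {t : Tree ℕ d} → All (_< M) X → Tiles X (suc n) t → Tiles (X ∷ʳ M) n t
  tiles-∷ʳ-suc X<M T XM<N with All.∷ʳ⁻ XM<N
  ... | X<N , M<N = mk⇔
    (λ c → case to (T X<N) (to (comp-∷ʳ X<M M<N) c) of λ
      { (v , b , refl , g , a) → v , b , refl , g , a })
    (λ { (v , b , refl , g , a) → from (comp-∷ʳ X<M M<N) (from (T X<N) (v , b , refl , g , a)) })

  -- The `suc` pays for the letter at which the hook of `M` ends. A surplus is shared between the
  -- two sides in all possible ways, which is the same as adding full simplices on their joint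
  -- coordinates; at the minimum of letters there is none, hence root weight 0.
  tiles-split : ∀ {d₁ d₂ X M y Y n₁ n₂} {t₁ : Tree ℕ d₁} {t₂ : Tree ℕ d₂} →
    All (_< M) X → All (_< M) (y ∷ Y) → Tiles (X ∷ʳ M) n₁ t₁ → Tiles (y ∷ Y) n₂ t₂ →
    Tiles (X ++ M ∷ y ∷ Y) (suc (n₁ + n₂)) (node t₁ t₂ 0)
  tiles-split {X = X} {M} {n₁ = n₁} {n₂} X<M Y<M T₁ T₂ X++<N with All.++⁻ X X++<N
  ... | X<N , M<N ∷ Y<N = mk⇔
    (λ c → case to (comp-split {X = X} Y<M M<N) c of λ
      { (_ , _ , c₁ , c₂ , refl , w₁ , w₂ , refl) →
        case (to (T₁ (All.∷ʳ⁺ X<N M<N)) w₁ , to (T₂ Y<N) w₂) of λ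
        { ((v₁ , b₁ , refl , g₁ , a₁) , (v₂ , b₂ , refl , g₂ , a₂)) →
          v₁ + v₂ , b₁ ++ b₂ , eq v₁ v₂ , (b₁ , b₂ , g₁ , g₂ , add-zero _) , add-++ a₁ a₂ } })
    (λ { (v , _ , refl , (b₁ , b₂ , g₁ , g₂ , a₀) , a) → case add-zero⁻¹ refl a₀ of λ
      { refl → case add-++⁻ b₁ a of λ
        { (v₁ , v₂ , c₁ , c₂ , refl , a₁ , a₂ , refl) →
          from (comp-split {X = X} Y<M M<N)
            (n₂ + v₂ , n₁ + v₁ , c₁ , c₂ , sym (eq v₁ v₂) ,
             from (T₁ (All.∷ʳ⁺ X<N M<N)) (v₁ , b₁ , refl , g₁ , a₁) ,
             from (T₂ Y<N) (v₂ , b₂ , refl , g₂ , a₂) , refl) } } })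
    where
    eq : ∀ v₁ v₂ → (n₂ + v₂) + suc (n₁ + v₁) ≡ suc (n₁ + n₂) + (v₁ + v₂)
    eq v₁ v₂ = trans (+-suc (n₂ + v₂) (n₁ + v₁)) (cong suc
      (trans (+-comm (n₂ + v₂) (n₁ + v₁)) (interchange n₁ v₁ n₂ v₂)))

  -- From words to trees and back

  record Tiling (X : List ℕ) : Set where
    constructor tiling
    field
      {size}  : ℕ
      deficit : ℕ
      tree    : Tree ℕ size
      leaves  : Leaves (0 <_) tree
      tiles   : Tiles X deficit tree

  tiling-∷ʳ : ∀ {X M} → All (_< M) X → Tiling X → Tiling (X ∷ʳ M)
  tiling-∷ʳ X<M (tiling zero    t p T) = tiling 0 (bump t) (bump-leaves p) (tiles-∷ʳ-zero X<M T)
  tiling-∷ʳ X<M (tiling (suc n) t p T) = tiling n t p (tiles-∷ʳ-suc X<M T)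

  unique-++ : ∀ {xs ys : List ℕ} → Unique (xs ++ ys) → Unique xs × Unique ys
  unique-++ {[]}     u       = [] , u
  unique-++ {x ∷ xs} (p ∷ u) with unique-++ {xs} u
  ... | a , b = All.++⁻ˡ xs p ∷ a , b

  max-split : ∀ x xs → Unique (x ∷ xs) →
    ∃[ X ] ∃[ M ] ∃[ Y ] x ∷ xs ≡ X ++ M ∷ Y × All (_< M) X × All (_< M) Y
  max-split x []        u = [] , x , [] , refl , [] , []
  max-split x (x′ ∷ xs) (x∉ ∷ u) with max-split x′ xs u
  ... | X , M , Y , e , X<M , Y<M with <-cmp x M
  ... | tri< x<M _ _ = x ∷ X , M , Y , cong (x ∷_) e , x<M ∷ X<M , Y<M
  ... | tri≈ _ x≡M _ = contradiction x≡M (All.lookup (subst (All (x ≢_)) e x∉) (∈-insert X))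
  ... | tri> _ _ M<x = [] , x , _ , refl , [] ,
    subst (All (_< x)) (sym e) (All.++⁺ (All.map (λ h → <-trans h M<x) X<M) (M<x ∷ All.map (λ h → <-trans h M<x) Y<M))

  -- Induction on the length, cutting at the maximal letter. The two sides are not subterms of the
  -- word, so the fuel `f` bounds the recursion.
  tiling-of : ∀ f x xs → length xs < f → Unique (x ∷ xs) → Tiling (x ∷ xs)
  tiling-of (suc f) x xs (s≤s len) u with max-split x xs u
  ... | X , M , Y , e , X<M , Y<M = subst Tiling (sym e)
          (glue Y Y<M lY (proj₂ (unique-++ {[ M ]} (proj₂ uXMY)))
            (prefix X X<M lX (proj₁ uXMY)))
    where
    uXMY : Unique X × Unique (M ∷ Y)
    uXMY = unique-++ (subst Unique e u)
    lXY : length xs ≡ length X + length Y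
    lXY = suc-injective (trans (cong length e) (trans (length-++ X) (+-suc (length X) (length Y))))
    lX : length X ≤ f
    lX = ≤-trans (m≤m+n (length X) (length Y)) (subst (_≤ f) lXY len)
    lY : length Y ≤ f
    lY = ≤-trans (m≤n+m (length Y) (length X)) (subst (_≤ f) lXY len)
    prefix : ∀ X → All (_< M) X → length X ≤ f → Unique X → Tiling (X ∷ʳ M)
    prefix []      _   _ _ = tiling 0 (leaf 1) (leaf z<s) (tiles-single M)
    prefix (z ∷ X) X<M l u = tiling-∷ʳ X<M (tiling-of f z X l u)
    glue : ∀ Y → All (_< M) Y → length Y ≤ f → Unique Y → Tiling (X ∷ʳ M) → Tiling (X ++ M ∷ Y)
    glue []      _   _ _ T = T
    glue (y ∷ Y) Y<M l u (tiling n₁ t₁ p₁ T₁) with tiling-of f y Y l u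
    ... | tiling n₂ t₂ p₂ T₂ = tiling _ _ (node p₁ p₂) (tiles-split X<M Y<M T₁ T₂)

  -- The word ends in its maximum because `tiles-split` takes its left factor in the form XM. The
  -- floor `β` allows one word to be built entirely above another.
  record Realisation {d} (β : ℕ) (t : Tree ℕ d) : Set where
    constructor realisation
    field
      {front} : List ℕ
      top     : ℕ
      β<front : All (β <_) front
      β<top   : β < top
      front<  : All (_< top) front
      unique  : Unique front
      tiles   : Tiles (front ∷ʳ top) 0 t

  realise-bump : ∀ {d β} {t : Tree ℕ d} → Realisation β t → Realisation β (bump t)
  realise-bump (realisation top β<f β<t f< u T) =
    realisation (suc top) (All.∷ʳ⁺ β<f β<t) (m<n⇒m<1+n β<t) <suc
      (AllPairs.++⁺ u ([] ∷ []) (All.map (λ h → <⇒≢ h ∷ []) f<)) (tiles-∷ʳ-zero <suc T)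
    where <suc = All.∷ʳ⁺ (All.map m<n⇒m<1+n f<) ≤-refl

  -- The word of the left subtree is built above that of the right one, so that its last letter `M`
  -- is the maximum of the two words together, as `tiles-split` demands.
  realise : ∀ {d} {t : Tree ℕ d} → Leaves (0 <_) t → ∀ β → Realisation β t
  realise {t = leaf (suc a)} (leaf _) β = go a
    where
    go : ∀ a → Realisation β (leaf (suc a))
    go zero    = realisation (suc β) [] ≤-refl [] [] (tiles-single _)
    go (suc a) = realise-bump (go a)
  realise {t = node l r y} (node p q) β with realise q β
  ... | realisation {front = Y} N β<Y β<N Y<N uY TY with realise p N
  ... | realisation {front = X} M N<X N<M X<M uX TX = go y
    where
    Y∷ʳN<M : All (_< M) (Y ∷ʳ N)
    Y∷ʳN<M = All.∷ʳ⁺ (All.map (λ h → <-trans h N<M) Y<N) N<M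
    T₁ : ∀ Z → Z ≡ Y ∷ʳ N → Tiles (X ++ M ∷ Z) 1 (node l r 0)
    T₁ []      e = contradiction (++-conicalʳ Y [ N ] (sym e)) λ ()
    T₁ (y ∷ Z) e = tiles-split X<M (subst (All (_< M)) (sym e) Y∷ʳN<M) TX (λ {N} → subst (λ Z → Tiles Z 0 r) (sym e) TY {N})
    all< : All (_< suc M) (X ++ M ∷ Y ∷ʳ N)
    all< = All.++⁺ (All.map m<n⇒m<1+n X<M) (≤-refl ∷ All.map m<n⇒m<1+n Y∷ʳN<M)
    unique : Unique (X ++ M ∷ Y ∷ʳ N)
    unique = AllPairs.++⁺ uX
      (All.map (λ h → <⇒≢ h ∘ sym) Y∷ʳN<M ∷ AllPairs.++⁺ uY ([] ∷ []) (All.map (λ h → <⇒≢ h ∷ []) Y<N))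
      (All.zipWith (λ { (x<M , N<x) → <⇒≢ x<M ∷ All.∷ʳ⁺ (All.map (λ h → <⇒≢ (<-trans h N<x) ∘ sym) Y<N) (<⇒≢ N<x ∘ sym) })
        (X<M , N<X))
    go : ∀ y → Realisation β (node l r y)
    -- The word X M Y N has deficit 1, owed to the hook of `M`. The new maximum `suc M` settles it
    -- and leaves root weight 0; each further maximum adds 1.
    go zero = realisation (suc M)
      (All.++⁺ (All.map (<-trans β<N) N<X) (<-trans β<N N<M ∷ All.∷ʳ⁺ β<Y β<N))
      (m<n⇒m<1+n (<-trans β<N N<M)) all< unique (tiles-∷ʳ-suc all< (T₁ _ refl))
    go (suc y) = realise-bump (go y)

-- Hook configurations as noncrossing arcs, and their scans

module Hookings where

  open import Data.List.Base using (_++_; map)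
  open ≡ using (refl; sym; trans; cong; cong₂; subst; subst₂)
  open Words

  open module FinMembership {n} = DecMembership (Fin._≟_ {n}) using (_∈?_)

  module _ {n : ℕ} where

    Sorted : List (Fin n) → Set
    Sorted = AllPairs Fin._<_

    -- Reduces equations between filtered lists of positions to equivalences of membership.
    sorted-≡ : ∀ {xs ys} → Sorted xs → Sorted ys → (∀ m → m ∈ xs ⇔ m ∈ ys) → xs ≡ ys
    sorted-≡ []       []       e = refl
    sorted-≡ []       (_ ∷ _)  e = case from (e _) (here refl) of λ ()
    sorted-≡ (_ ∷ _)  []       e = case to (e _) (here refl) of λ ()
    sorted-≡ {x ∷ xs} {y ∷ ys} (p ∷ ps) (q ∷ qs) e = cong₂ _∷_ x≡y (sorted-≡ ps qs tails)
      where
      x≤y : x Fin.≤ y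
      x≤y with from (e y) (here refl)
      ... | here refl = ℕ.≤-refl
      ... | there y∈  = ℕ.<⇒≤ (All.lookup p y∈)
      y≤x : y Fin.≤ x
      y≤x with to (e x) (here refl)
      ... | here refl = ℕ.≤-refl
      ... | there x∈  = ℕ.<⇒≤ (All.lookup q x∈)
      x≡y : x ≡ y
      x≡y = Fin.≤-antisym x≤y y≤x
      tails : ∀ m → m ∈ xs ⇔ m ∈ ys
      tails m = mk⇔
        (λ m∈ → case to (e m) (there m∈) of λ
          { (here refl) → contradiction (All.lookup p m∈) (ℕ.≤⇒≯ y≤x)
          ; (there m∈′) → m∈′ })
        (λ m∈ → case from (e m) (there m∈) of λ
          { (here refl) → contradiction (All.lookup q m∈) (ℕ.≤⇒≯ x≤y)
          ; (there m∈′) → m∈′ })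

    sorted-++ : ∀ Q {b T} → Sorted (Q ++ b ∷ T) →
                Sorted Q × Sorted T × (∀ {m} → m ∈ Q → m Fin.< b) × (∀ {m} → m ∈ T → b Fin.< m)
    sorted-++ []      (p ∷ s) = [] , s , (λ ()) , All.lookup p
    sorted-++ (x ∷ Q) (p ∷ s) with sorted-++ Q s
    ... | sQ , sT , Q<b , b<T = All.++⁻ˡ Q p ∷ sQ , sT ,
      (λ { (here refl) → All.lookup p (∈-++⁺ʳ Q (here refl)) ; (there m∈) → Q<b m∈ }) , b<T

    -- These are the suffixes of `allFin n`, that is, the positions already read by a scan from the
    -- right.
    record Final (W : List (Fin n)) : Set where
      constructor final
      field
        sorted : Sorted W
        upward : ∀ {m m′} → m ∈ W → m Fin.≤ m′ → m′ ∈ W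

    final-allFin : Final (allFin n)
    final-allFin = final (AllPairs.tabulate⁺-< id) (λ _ _ → ∈-allFin _)

    module _ {p : Fin n} {W : List (Fin n)} (F : Final (p ∷ W)) where

      final-> : ∀ {m} → m ∈ W → p Fin.< m
      final-> with Final.sorted F
      ... | p<W ∷ _ = All.lookup p<W

      final-tail : Final W
      final-tail with Final.sorted F
      ... | p<W ∷ s = final s λ m∈ m≤m′ → case Final.upward F (there m∈) m≤m′ of λ
        { (here refl) → contradiction (All.lookup p<W m∈) (ℕ.≤⇒≯ m≤m′)
        ; (there m∈′) → m∈′ }

      final-∋ : ∀ {m} → p Fin.< m → m ∈ W
      final-∋ p<m with Final.upward F (here refl) (ℕ.<⇒≤ p<m)
      ... | here refl = contradiction p<m (ℕ.<-irrefl refl)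
      ... | there m∈  = m∈

    final-next : ∀ {p y W} → Final (p ∷ y ∷ W) → toℕ y ≡ suc (toℕ p)
    final-next {p} {y} F = ℕ.≤-antisym
      (subst (toℕ y ℕ.≤_) (Fin.toℕ-fromℕ< p+1<n) (case final-∋ F p<j of λ
        { (here e)   → ℕ.≤-reflexive (cong toℕ (sym e))
        ; (there m∈) → ℕ.<⇒≤ (final-> (final-tail F) m∈) }))
      (final-> F (here refl))
      where
      p+1<n : suc (toℕ p) ℕ.< n
      p+1<n = ℕ.≤-<-trans (final-> F (here refl)) (Fin.toℕ<n y)
      j : Fin n
      j = Fin.fromℕ< p+1<n
      p<j : p Fin.< j
      p<j = ℕ.≤-reflexive (sym (Fin.toℕ-fromℕ< p+1<n))

  module _ {n} (π : Permutation n) where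

    private v = at π

    isDescent? : Decidable (IsDescent π)
    isDescent? i = any? λ j → (toℕ j ℕ.≟ suc (toℕ i)) ×-dec (v j ℕ.<? v i)

    -- Hooks are described by a function b sending each descent to its northeast
    -- endpoint; its other values are irrelevant.
    Covers : (Fin n → Fin n) → Fin n → Fin n → Set
    Covers b d m = d Fin.< m × m Fin.≤ b d

    -- The northeast endpoint of an arc counts as covered, so a free point is neither sheltered by a
    -- hook starting in `Q` nor the end of one. `Q` is either a suffix already read or the set of
    -- points to the right of a given one.
    Free : (Fin n → Fin n) → Pred (Fin n) 0ℓ → Pred (Fin n) 0ℓ
    Free b Q m = ∀ d → Q d → IsDescent π d → ¬ Covers b d m

    free? : ∀ b {Q} → Decidable Q → Decidable (Free b Q)
    free? b Q? m = all? λ d → Q? d →-dec (isDescent? d →-dec ¬? ((d Fin.<? m) ×-dec (m Fin.≤? b d)))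

    visible : List (Fin n) → (Fin n → Fin n) → List (Fin n)
    visible W b = filter (free? b (_∈? W)) W

    -- The points whose innermost arc starts at `p`. In a noncrossing family an arc over such a
    -- point that starts further left encloses the arc of `p`, so only arcs starting to the right of
    -- `p` can intervene.
    Inside : (Fin n → Fin n) → Fin n → Pred (Fin n) 0ℓ
    Inside b p m = p Fin.< m × m Fin.< b p × Free b (p Fin.<_) m

    inside? : ∀ b p → Decidable (Inside b p)
    inside? b p m = (p Fin.<? m) ×-dec (m Fin.<? b p) ×-dec free? b (p Fin.<?_) m

    insideCount : (Fin n → Fin n) → Fin n → ℕ
    insideCount b p = length (filter (inside? b p) (allFin n))

    counts : List (Fin n) → (Fin n → Fin n) → List ℕ
    counts W b = map (insideCount b) (filter isDescent? W)

    ∈-visible⁻ : ∀ W b {m} → m ∈ visible W b → m ∈ W × Free b (_∈ W) m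
    ∈-visible⁻ W b = ∈-filter⁻ (free? b (_∈? W))

    ∈-visible⁺ : ∀ W b {m} → m ∈ W → Free b (_∈ W) m → m ∈ visible W b
    ∈-visible⁺ W b = ∈-filter⁺ (free? b (_∈? W))

    -- At `m` equal to `d`, `dominates` says that the hook goes up; elsewhere it says that no point
    -- lies above the hook. By `noncrossing` one arc may start where another ends, but two arcs
    -- cannot share an end.
    record Hooking (W : List (Fin n)) (b : Fin n → Fin n) : Set where
      field
        rises       : ∀ {d} → d ∈ W → IsDescent π d → d Fin.< b d
        dominates   : ∀ {d} → d ∈ W → IsDescent π d → ∀ {m} → d Fin.≤ m → m Fin.< b d → v m ℕ.< v (b d)
        noncrossing : ∀ {d d′} → d ∈ W → d′ ∈ W → IsDescent π d → IsDescent π d′ → d Fin.< d′ →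
                      b d Fin.≤ d′ ⊎ b d′ Fin.< b d

    open Hooking

    hooking-tail : ∀ {p W b} → Hooking (p ∷ W) b → Hooking W b
    hooking-tail h = record
      { rises       = rises h ∘ there
      ; dominates   = dominates h ∘ there
      ; noncrossing = λ d∈ d′∈ → noncrossing h (there d∈) (there d′∈) }

    module _ {p : Fin n} {W : List (Fin n)} (F : Final (p ∷ W)) (b : Fin n → Fin n) where

      private
        sortedVisible : ∀ {W} → Final W → Sorted (visible W b)
        sortedVisible {W} F = AllPairs.filter⁺ (free? b (_∈? W)) (Final.sorted F)

        p<visible : All (p Fin.<_) (visible W b)
        p<visible = All.tabulate (final-> F ∘ proj₁ ∘ ∈-visible⁻ W b)

        free-p : Free b (_∈ p ∷ W) p
        free-p d (here refl) _ (d<p , _) = ℕ.<-irrefl refl d<p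
        free-p d (there d∈)  _ (d<p , _) = ℕ.<-asym d<p (final-> F d∈)

      visible-rise : ¬ IsDescent π p → visible (p ∷ W) b ≡ p ∷ visible W b
      visible-rise ¬dp = sorted-≡ (sortedVisible F) (p<visible ∷ sortedVisible (final-tail F)) λ m → mk⇔ f g
        where
        f : ∀ {m} → m ∈ visible (p ∷ W) b → m ∈ p ∷ visible W b
        f m∈ with ∈-visible⁻ (p ∷ W) b m∈
        ... | here refl , _  = here refl
        ... | there m∈W , fr = there (∈-visible⁺ W b m∈W (λ d d∈ → fr d (there d∈)))
        g : ∀ {m} → m ∈ p ∷ visible W b → m ∈ visible (p ∷ W) b
        g (here refl) = ∈-visible⁺ (p ∷ W) b (here refl) free-p
        g (there m∈) with ∈-visible⁻ W b m∈
        ... | m∈W , fr = ∈-visible⁺ (p ∷ W) b (there m∈W) λ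
          { d (here refl) dd → contradiction dd ¬dp ; d (there d∈) dd → fr d d∈ dd }

      -- Among the points visible after `p`, those before the end of its hook are exactly the ones
      -- that have this hook as innermost arc. They leave the list together with the endpoint.
      visible-fall : ∀ Q {T} → IsDescent π p → p Fin.< b p → visible W b ≡ Q ++ b p ∷ T →
                     visible (p ∷ W) b ≡ p ∷ T × insideCount b p ≡ length Q
      visible-fall Q {T} dp p<bp e =
        sorted-≡ (sortedVisible F) (All.tabulate (λ m∈ → ℕ.<-trans p<bp (bp<T m∈)) ∷ sT) (λ m → mk⇔ f g) ,
        cong length (sorted-≡ (AllPairs.filter⁺ (inside? b p) (Final.sorted final-allFin)) sQ λ m → mk⇔ f′ g′)
        where
        facts = sorted-++ Q (subst Sorted e (sortedVisible (final-tail F)))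
        sQ = proj₁ facts
        sT = proj₁ (proj₂ facts)
        Q<bp = proj₁ (proj₂ (proj₂ facts))
        bp<T = proj₂ (proj₂ (proj₂ facts))
        visible⁻ : ∀ {m} → m ∈ Q ++ b p ∷ T → m ∈ W × Free b (_∈ W) m
        visible⁻ m∈ = ∈-visible⁻ W b (subst (_ ∈_) (sym e) m∈)
        visible⁺ : ∀ {m} → m ∈ W → Free b (_∈ W) m → m ∈ Q ++ b p ∷ T
        visible⁺ m∈ fr = subst (_ ∈_) e (∈-visible⁺ W b m∈ fr)
        f : ∀ {m} → m ∈ visible (p ∷ W) b → m ∈ p ∷ T
        f m∈ with ∈-visible⁻ (p ∷ W) b m∈
        ... | here refl , _  = here refl
        ... | there m∈W , fr with ∈-++⁻ Q (visible⁺ m∈W (λ d d∈ → fr d (there d∈)))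
        ... | inj₁ m∈Q         = contradiction (final-> F m∈W , ℕ.<⇒≤ (Q<bp m∈Q)) (fr p (here refl) dp)
        ... | inj₂ (here refl) = contradiction (final-> F m∈W , ℕ.≤-refl) (fr p (here refl) dp)
        ... | inj₂ (there m∈T) = there m∈T
        g : ∀ {m} → m ∈ p ∷ T → m ∈ visible (p ∷ W) b
        g (here refl) = ∈-visible⁺ (p ∷ W) b (here refl) free-p
        g (there m∈T) with visible⁻ (∈-++⁺ʳ Q (there m∈T))
        ... | m∈W , fr = ∈-visible⁺ (p ∷ W) b (there m∈W) λ
          { d (here refl) _ (_ , m≤bp) → contradiction (bp<T m∈T) (ℕ.≤⇒≯ m≤bp)
          ; d (there d∈) dd → fr d d∈ dd }
        f′ : ∀ {m} → m ∈ filter (inside? b p) (allFin n) → m ∈ Q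
        f′ m∈ with ∈-filter⁻ (inside? b p) {xs = allFin n} m∈
        ... | _ , p<m , m<bp , fr with ∈-++⁻ Q (visible⁺ (final-∋ F p<m) (λ d d∈ → fr d (final-> F d∈)))
        ... | inj₁ m∈Q         = m∈Q
        ... | inj₂ (here refl) = contradiction m<bp (ℕ.<-irrefl refl)
        ... | inj₂ (there m∈T) = contradiction m<bp (ℕ.<-asym (bp<T m∈T))
        g′ : ∀ {m} → m ∈ Q → m ∈ filter (inside? b p) (allFin n)
        g′ m∈Q with visible⁻ (∈-++⁺ˡ m∈Q)
        ... | m∈W , fr = ∈-filter⁺ (inside? b p) (∈-allFin _)
          (final-> F m∈W , Q<bp m∈Q , λ d p<d → fr d (final-∋ F p<d))

    rise-at : ∀ {p y} → ¬ IsDescent π p → toℕ y ≡ suc (toℕ p) → v p ℕ.< v y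
    rise-at {p} {y} ¬dp e with ℕ.<-cmp (v p) (v y)
    ... | tri< l _ _ = l
    ... | tri≈ _ q _ = contradiction (trans (sym e) (cong toℕ (sym (Permutation.injective π q)))) (ℕ.1+n≢n)
    ... | tri> _ _ g = contradiction (y , e , g) ¬dp

    fall-at : ∀ {p y} → IsDescent π p → toℕ y ≡ suc (toℕ p) → v y ℕ.< v p
    fall-at (j , e′ , l) e = subst (λ j → v j ℕ.< _) (toℕ-injective (trans e′ (sym e))) l

    -- Visible points are left-to-right maxima of `W`. From any earlier point one can climb to the
    -- next point, if it is no descent, or else to the end of its hook, which comes before `t` since
    -- the hook does not cover `t`.
    visible-max : ∀ {W b t m} → Final W → Hooking W b → t ∈ visible W b → m ∈ W → m Fin.< t → v m ℕ.< v t
    visible-max {p ∷ W} {b} {t} F h t∈ m∈ m<t with ∈-visible⁻ (p ∷ W) b t∈ | m∈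
    ... | here refl , _ | here refl  = contradiction m<t (ℕ.<-irrefl refl)
    ... | here refl , _ | there m∈W  = contradiction m<t (ℕ.<-asym (final-> F m∈W))
    ... | there t∈W , fr | there m∈W = visible-max (final-tail F) (hooking-tail h)
      (∈-visible⁺ W b t∈W (λ d d∈ → fr d (there d∈))) m∈W m<t
    ... | there t∈W , fr | here refl with isDescent? p
    ... | yes dp = ℕ.<-trans (dominates h (here refl) dp ℕ.≤-refl p<bp)
        (visible-max (final-tail F) (hooking-tail h) t∈′ (final-∋ F p<bp)
          (ℕ.≰⇒> λ t≤bp → fr p (here refl) dp (final-> F t∈W , t≤bp)))
      where
      p<bp : p Fin.< b p
      p<bp = rises h (here refl) dp
      t∈′ : t ∈ visible W b
      t∈′ = ∈-visible⁺ W b t∈W (λ d d∈ → fr d (there d∈))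
    ... | no ¬dp = go W F t∈W t∈′ (hooking-tail h)
      where
      t∈′ : t ∈ visible W b
      t∈′ = ∈-visible⁺ W b t∈W (λ d d∈ → fr d (there d∈))
      go : ∀ W → Final (p ∷ W) → t ∈ W → t ∈ visible W b → Hooking W b → v p ℕ.< v t
      go (y ∷ W) F (here refl) _ _ = rise-at ¬dp (final-next F)
      go (y ∷ W) F (there t∈) t∈′ h = ℕ.<-trans (rise-at ¬dp (final-next F))
        (visible-max (final-tail F) h t∈′ (here refl) (final-> (final-tail F) t∈))

    open Scanning v using (Scan; done; rise; fall; []; below; scan-head)

    ∈-split : ∀ {A : Set} {x : A} {xs} → x ∈ xs → ∃[ Q ] ∃[ T ] xs ≡ Q ++ x ∷ T
    ∈-split (here refl) = [] , _ , refl
    ∈-split (there x∈) with ∈-split x∈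
    ... | Q , T , refl = _ ∷ Q , T , refl

    counts-rise : ∀ {p W} b → ¬ IsDescent π p → counts (p ∷ W) b ≡ counts W b
    counts-rise b ¬dp = cong (map (insideCount b)) (filter-reject isDescent? ¬dp)

    counts-fall : ∀ {p W} b → IsDescent π p → counts (p ∷ W) b ≡ insideCount b p ∷ counts W b
    counts-fall b dp = cong (map (insideCount b)) (filter-accept isDescent? dp)

    hooking⇒scan : ∀ {W b} → Final W → Hooking W b → Scan W [] (visible W b) (counts W b)
    hooking⇒scan {[]}    F h = done
    hooking⇒scan {p ∷ W} {b} F h = case isDescent? p of λ
      { (no ¬dp) → subst₂ (Scan (p ∷ W) []) (sym (visible-rise F b ¬dp)) (sym (counts-rise b ¬dp))
                     (rise s (next W F s ¬dp))
      ; (yes dp) → subst₂ (Scan (p ∷ W) []) (sym (proj₁ (facts dp)))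
                     (sym (trans (counts-fall b dp) (cong (_∷ _) (proj₂ (facts dp)))))
                     (step W F s (proj₁ (bp-split dp)) dp (proj₂ (proj₂ (bp-split dp)))) }
      where
      s : Scan W [] (visible W b) (counts W b)
      s = hooking⇒scan (final-tail F) (hooking-tail h)
      next : ∀ W {T q} → Final (p ∷ W) → Scan W [] T q → ¬ IsDescent π p → Scanning.Below v p T
      next []      F done _ = []
      next (y ∷ W) F s ¬dp with scan-head s
      ... | _ , refl = below (rise-at ¬dp (final-next F))
      bp-split : IsDescent π p → ∃[ Q ] ∃[ T ] visible W b ≡ Q ++ b p ∷ T
      -- A hook from `W` that covers `b p` would cross the hook of `p`; so `b p` is on the list.
      bp-split dp = ∈-split (∈-visible⁺ W b (final-∋ F (rises h (here refl) dp)) λ d d∈ dd (d<bp , bp≤bd) →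
        case noncrossing h (here refl) (there d∈) dp dd (final-> F d∈) of λ
          { (inj₁ bp≤d) → ℕ.<⇒≱ d<bp bp≤d ; (inj₂ bd<bp) → ℕ.<⇒≱ bd<bp bp≤bd })
      facts : ∀ dp → visible (p ∷ W) b ≡ p ∷ proj₁ (proj₂ (bp-split dp)) × insideCount b p ≡ length (proj₁ (bp-split dp))
      facts dp = visible-fall F b (proj₁ (bp-split dp)) dp (rises h (here refl) dp) (proj₂ (proj₂ (bp-split dp)))
      step : ∀ W {S T q} → Final (p ∷ W) → Scan W [] S q → ∀ Q → IsDescent π p → S ≡ Q ++ b p ∷ T →
             Scan (p ∷ W) [] (p ∷ T) (length Q ∷ q)
      step []      F done []      dp ()
      step []      F done (_ ∷ _) dp ()
      step (y ∷ W) F s Q dp e with scan-head s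
      -- An empty `Q` would make `b p` the point right after the descent `p`, which is lower than
      -- `p`.
      step (y ∷ W) F s []      dp refl | _ , refl = contradiction (fall-at dp (final-next F))
        (ℕ.<-asym (dominates h (here refl) dp ℕ.≤-refl (rises h (here refl) dp)))
      step (y ∷ W) F s (x ∷ Q) dp refl | _ , refl = fall s refl (ℕ.<⇒≤ (fall-at dp (final-next F)))
        (dominates h (here refl) dp ℕ.≤-refl (rises h (here refl) dp))

    -- A scan determines `b` one descent at a time; what is known about `W` has to survive a change
    -- of `b` at a point outside `W`.
    AgreeOn : List (Fin n) → (b b′ : Fin n → Fin n) → Set
    AgreeOn W b b′ = ∀ {d} → d ∈ W → b d ≡ b′ d

    module _ {W : List (Fin n)} {b b′ : Fin n → Fin n} (F : Final W) (e : AgreeOn W b b′) where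

      hooking-cong : Hooking W b → Hooking W b′
      hooking-cong h = record
        { rises       = λ {d} d∈ dd → subst (d Fin.<_) (e d∈) (rises h d∈ dd)
        ; dominates   = λ {d} d∈ dd {m} d≤m → subst (λ x → m Fin.< x → v m ℕ.< v x) (e d∈) (dominates h d∈ dd d≤m)
        ; noncrossing = λ {d} {d′} d∈ d′∈ dd dd′ l →
            subst₂ (λ x y → x Fin.≤ d′ ⊎ y Fin.< x) (e d∈) (e d′∈) (noncrossing h d∈ d′∈ dd dd′ l) }

      private
        free-cong : ∀ {Q : Pred (Fin n) 0ℓ} {m} → (∀ {d} → Q d → d ∈ W) → Free b Q m ⇔ Free b′ Q m
        free-cong Q⊆W = mk⇔
          (λ fr d qd dd (l , m≤) → fr d qd dd (l , subst (_ Fin.≤_) (sym (e (Q⊆W qd))) m≤))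
          (λ fr d qd dd (l , m≤) → fr d qd dd (l , subst (_ Fin.≤_) (e (Q⊆W qd)) m≤))

      visible-cong : visible W b ≡ visible W b′
      visible-cong = filter-≐ (free? b (_∈? W)) (free? b′ (_∈? W)) (to (free-cong id) , from (free-cong id)) W

      insideCount-cong : ∀ {p} → p ∈ W → insideCount b p ≡ insideCount b′ p
      insideCount-cong {p} p∈ = cong length (filter-≐ (inside? b p) (inside? b′ p)
        ( (λ { (l , u , fr) → l , subst (_ Fin.<_) (e p∈) u , to (free-cong above) fr })
        , (λ { (l , u , fr) → l , subst (_ Fin.<_) (sym (e p∈)) u , from (free-cong above) fr })) (allFin n))
        where
        above : ∀ {d} → p Fin.< d → d ∈ W
        above p<d = Final.upward F p∈ (ℕ.<⇒≤ p<d)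

      counts-cong : counts W b ≡ counts W b′
      counts-cong = map-cong-local (All.tabulate (insideCount-cong ∘ proj₁ ∘ ∈-filter⁻ isDescent?))

    update : (Fin n → Fin n) → Fin n → Fin n → Fin n → Fin n
    update b p t x with x Fin.≟ p
    ... | yes _ = t
    ... | no  _ = b x

    update-≡ : ∀ b p t → update b p t p ≡ t
    update-≡ b p t with p Fin.≟ p
    ... | yes _ = refl
    ... | no ¬e = contradiction refl ¬e

    update-≢ : ∀ b p t {x} → x ≢ p → b x ≡ update b p t x
    update-≢ b p t {x} x≢p with x Fin.≟ p
    ... | yes e = contradiction e x≢p
    ... | no _  = refl

    hooking-rise : ∀ {p W b} → ¬ IsDescent π p → Hooking W b → Hooking (p ∷ W) b
    hooking-rise {p} {W} ¬dp h = record
      { rises       = λ d∈ dd → rises h (tail d∈ dd) dd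
      ; dominates   = λ d∈ dd → dominates h (tail d∈ dd) dd
      ; noncrossing = λ d∈ d′∈ dd dd′ → noncrossing h (tail d∈ dd) (tail d′∈ dd′) dd dd′ }
      where
      tail : ∀ {d} → d ∈ p ∷ W → IsDescent π d → d ∈ W
      tail (here refl) dd = contradiction dd ¬dp
      tail (there d∈)  _  = d∈

    -- Visibility of the endpoint gives both conditions on the new hook: the endpoint is a
    -- left-to-right maximum, so nothing lies above the hook, and no arc from `W` covers it, so
    -- nothing crosses the hook.
    hooking-fall : ∀ {p W b} → Final (p ∷ W) → IsDescent π p → Hooking W b →
                   b p ∈ visible W b → v p ℕ.< v (b p) → Hooking (p ∷ W) b
    hooking-fall {p} {W} {b} F dp h bp∈ vp<vbp = record
      { rises       = λ { (here refl) _ → final-> F bp∈W ; (there d∈) → rises h d∈ }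
      ; dominates   = λ
        { (here refl) _ {m} p≤m m<bp → dom m p≤m m<bp
        ; (there d∈) → dominates h d∈ }
      ; noncrossing = λ
        { (here refl) (here refl) _ _ l → contradiction l (ℕ.<-irrefl refl)
        ; (here refl) (there d′∈) _ dd′ l → cross d′∈ dd′
        ; (there d∈) (here refl) _ _ l → contradiction l (ℕ.<-asym (final-> F d∈))
        ; (there d∈) (there d′∈) → noncrossing h d∈ d′∈ } }
      where
      bp∈W : b p ∈ W
      bp∈W = proj₁ (∈-visible⁻ W b bp∈)
      dom : ∀ m → p Fin.≤ m → m Fin.< b p → v m ℕ.< v (b p)
      dom m p≤m m<bp with Final.upward F (here refl) p≤m
      ... | here refl = vp<vbp
      ... | there m∈  = visible-max (final-tail F) h bp∈ m∈ m<bp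
      cross : ∀ {d} → d ∈ W → IsDescent π d → b p Fin.≤ d ⊎ b d Fin.< b p
      cross {d} d∈ dd with b p Fin.≤? d
      ... | yes bp≤d = inj₁ bp≤d
      ... | no bp≰d with b d Fin.<? b p
      ... | yes bd<bp = inj₂ bd<bp
      ... | no bd≮bp  = contradiction (ℕ.≰⇒> bp≰d , ℕ.≮⇒≥ bd≮bp) (proj₂ (∈-visible⁻ W b bp∈) d d∈ dd)

    scan⇒hooking : ∀ {W T q} → Final W → Scan W [] T q →
                   ∃[ b ] Hooking W b × T ≡ visible W b × q ≡ counts W b
    -- A placeholder: its value is replaced at every descent met later.
    scan⇒hooking F done = id , record { rises = λ () ; dominates = λ () ; noncrossing = λ () } , refl , refl
    scan⇒hooking {p ∷ W} F (rise {T = T} s x<) with scan⇒hooking (final-tail F) s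
    ... | b , h , refl , refl = b , hooking-rise ¬dp h , sym (visible-rise F b ¬dp) ,
      sym (counts-rise b ¬dp)
      where
      notDescent : ∀ W {T q} → Final (p ∷ W) → Scan W [] T q → Scanning.Below v p T → ¬ IsDescent π p
      notDescent [] F _ _ (j , e , _) = case final-∋ F (ℕ.≤-reflexive (sym e)) of λ ()
      notDescent (y ∷ W) F s x< dp with scan-head s | x<
      ... | _ , refl | below p<y = ℕ.<-asym p<y (fall-at dp (final-next F))
      ¬dp = notDescent W F s x<
    scan⇒hooking {p ∷ W} F (fall {b = t} {P = P} {T = T} s e l m) with scan⇒hooking (final-tail F) s
    ... | b , h , refl , refl = b′ , h′ , sym (proj₁ facts) ,
        trans (cong₂ _∷_ (sym (proj₂ facts)) (counts-cong (final-tail F) agree))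
              (sym (counts-fall b′ dp))
      where
      b′ = update b p t
      agree : AgreeOn W b b′
      agree d∈ = update-≢ b p t λ { refl → ℕ.<-irrefl refl (final-> F d∈) }
      descent-p : ∀ W {S y S′ q} → Final (p ∷ W) → Scan W [] S q → S ≡ y ∷ S′ → v y ℕ.≤ v p → IsDescent π p
      descent-p [] F done () _
      descent-p (y ∷ W) F s e l with scan-head s | e
      ... | _ , refl | refl = y , final-next F , ℕ.≤∧≢⇒< l λ q →
        case Permutation.injective π q of λ { refl → ℕ.<-irrefl refl (final-> F (here refl)) }
      dp : IsDescent π p
      dp = descent-p W F s e l
      e′ : visible W b′ ≡ (_ ∷ P) ++ b′ p ∷ T
      e′ = trans (sym (visible-cong (final-tail F) agree)) (trans e (cong (λ x → _ ∷ P ++ x ∷ T) (sym (update-≡ b p t))))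
      b′p∈ : b′ p ∈ visible W b′
      b′p∈ = subst (b′ p ∈_) (sym e′) (∈-++⁺ʳ (_ ∷ P) (here refl))
      h′ : Hooking (p ∷ W) b′
      h′ = hooking-fall F dp (hooking-cong (final-tail F) agree h) b′p∈ (subst (λ x → v p ℕ.< v x) (sym (update-≡ b p t)) m)
      facts = visible-fall F b′ (_ ∷ P) dp (rises h′ (here refl) dp) e′

  module _ {n k} {π : Permutation n} (D : Descents π k) where

    private v = at π

    descents-listed : filter (isDescent? π) (allFin n) ≡ tabulate (descent D)
    descents-listed = sorted-≡
      (AllPairs.filter⁺ (isDescent? π) (Final.sorted final-allFin))
      (AllPairs.tabulate⁺-< (Descents.increasing D))
      λ m → mk⇔
        (λ m∈ → case to (Descents.exactly D m) (proj₂ (∈-filter⁻ (isDescent? π) {xs = allFin n} m∈)) of λ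
          { (i , refl) → ∈-tabulate⁺ i })
        (λ m∈ → case ∈-tabulate⁻ m∈ of λ
          { (i , refl) → ∈-filter⁺ (isDescent? π) (∈-allFin _) (from (Descents.exactly D _) (i , refl)) })

    -- A valid hook configuration with the disjointness of plane hooks expressed by positions alone;
    -- the heights of nested hooks are controlled by `none-above`.
    record Arcs (H : Fin k → Hook π) : Set where
      field
        sw-descent : ∀ i → sw (H i) ≡ descent D i
        none-above : ∀ i m → ¬ DirectlyAbove m (H i)
        nested     : ∀ i j → sw (H i) Fin.< sw (H j) → ne (H i) Fin.≤ sw (H j) ⊎ ne (H j) Fin.< ne (H i)

    module _ {H : Fin k → Hook π} {b : Fin n → Fin n}
             (sw≡ : ∀ i → sw (H i) ≡ descent D i) (b≡ : ∀ i → b (descent D i) ≡ ne (H i))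
             (h : Hooking π (allFin n) b) where

      private
        S N : Fin k → Fin n
        S = sw ∘ H
        N = ne ∘ H

        bS : ∀ i → b (S i) ≡ N i
        bS i = trans (cong b (sw≡ i)) (b≡ i)

        dS : ∀ i → IsDescent π (S i)
        dS i = from (Descents.exactly D (S i)) (i , sym (sw≡ i))

        index : ∀ {d} → IsDescent π d → ∃[ i ] S i ≡ d
        index {d} dd with to (Descents.exactly D d) dd
        ... | i , e = i , trans (sw≡ i) e

        dom : ∀ i {m} → S i Fin.≤ m → m Fin.< N i → v m ℕ.< v (N i)
        dom i S≤m = subst (λ x → _ Fin.< x → _ ℕ.< v x) (bS i) (Hooking.dominates h (∈-allFin _) (dS i) S≤m)

        cross : ∀ i j → S i Fin.< S j → N i Fin.≤ S j ⊎ N j Fin.< N i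
        cross i j l = subst₂ (λ x y → x Fin.≤ S j ⊎ y Fin.< x) (bS i) (bS j)
          (Hooking.noncrossing h (∈-allFin _) (∈-allFin _) (dS i) (dS j) l)

        free⇔ : ∀ {Q m} → Free π b Q m ⇔ (∀ i → Q (S i) → S i Fin.< m → ¬ m Fin.≤ N i)
        free⇔ = mk⇔
          (λ fr i q l u → fr (S i) q (dS i) (l , subst (_ Fin.≤_) (sym (bS i)) u))
          (λ fr d q dd (l , u) → case index dd of λ { (i , refl) → fr i q l (subst (_ Fin.≤_) (bS i) u) })

        strict : ∀ {m} → ¬ Colouring.IsNE H m → ∀ i → m Fin.≤ N i → m Fin.< N i
        strict {m} ¬ne i l = ℕ.≤∧≢⇒< l λ e → ¬ne (i , sym (toℕ-injective e))

        sky⇔ : ∀ {m} → (¬ Colouring.IsNE H m × Colouring.HasColour H m zero) ⇔ Free π b (_∈ allFin n) m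
        sky⇔ {m} = mk⇔
          (λ (¬ne , c) → from free⇔ λ i _ l u →
            c i (l , strict ¬ne i u , dom i (ℕ.<⇒≤ l) (strict ¬ne i u)))
          (λ fr → (λ { (i , refl) → to free⇔ fr i (∈-allFin _) (sw<ne i) ℕ.≤-refl })
                , (λ { i (l , u , _) → to free⇔ fr i (∈-allFin _) l (ℕ.<⇒≤ u) }))
          where
          sw<ne : ∀ i → S i Fin.< N i
          sw<ne i = Hook.sw<ne (H i)

        -- Of two nested hooks the inner one ends at a lower point, since no point lies above the
        -- outer one. So the lowest hook over a point is the innermost one.
        inside⇔ : ∀ {i m} → (¬ Colouring.IsNE H m × Colouring.HasColour H m (suc i)) ⇔ Inside π b (S i) m
        inside⇔ {i} {m} = mk⇔ f g
          where
          f : ¬ Colouring.IsNE H m × Colouring.HasColour H m (suc i) → Inside π b (S i) m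
          f (¬ne , (l , u , _) , lowest) = l , subst (m Fin.<_) (sym (bS i)) u , from free⇔ λ j Si<Sj Sj<m m≤Nj →
            let m<Nj = strict ¬ne j m≤Nj in
            case cross i j Si<Sj of λ
              { (inj₁ Ni≤Sj) → ℕ.<-asym u (ℕ.≤-<-trans Ni≤Sj Sj<m)
              ; (inj₂ Nj<Ni) → ℕ.<⇒≱ (dom i (ℕ.<⇒≤ (ℕ.<-trans Si<Sj (ℕ.<-trans Sj<m m<Nj))) Nj<Ni)
                                  (lowest j (Sj<m , m<Nj , dom j (ℕ.<⇒≤ Sj<m) m<Nj)) }
          g : Inside π b (S i) m → ¬ Colouring.IsNE H m × Colouring.HasColour H m (suc i)
          g (l , u′ , fr) = ¬ne , (l , u , dom i (ℕ.<⇒≤ l) u) , lowest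
            where
            u : m Fin.< N i
            u = subst (m Fin.<_) (bS i) u′
            outer : ∀ {j} → S j Fin.< S i → m Fin.≤ N j → N i Fin.< N j
            outer {j} Sj<Si m≤Nj = case cross j i Sj<Si of λ
              { (inj₁ Nj≤Si) → contradiction (ℕ.≤-trans m≤Nj Nj≤Si) (ℕ.<⇒≱ l)
              ; (inj₂ Ni<Nj) → Ni<Nj }
            same : ∀ {j} → S j ≡ S i → N j ≡ N i
            same e = trans (sym (bS _)) (trans (cong b e) (bS i))
            ¬ne : ¬ Colouring.IsNE H m
            ¬ne (j , refl) with Fin.<-cmp (S i) (S j)
            ... | tri< Si<Sj _ _ = to free⇔ fr j Si<Sj (Hook.sw<ne (H j)) ℕ.≤-refl
            ... | tri≈ _ e _     = ℕ.<-irrefl (cong toℕ (same (sym e))) u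
            ... | tri> _ _ Sj<Si = ℕ.<-asym u (outer Sj<Si ℕ.≤-refl)
            lowest : ∀ j → DirectlyBelow m (H j) → v (N i) ℕ.≤ v (N j)
            lowest j (Sj<m , m<Nj , _) with Fin.<-cmp (S i) (S j)
            ... | tri< Si<Sj _ _ = contradiction (ℕ.<⇒≤ m<Nj) (to free⇔ fr j Si<Sj Sj<m)
            ... | tri≈ _ e _     = ℕ.≤-reflexive (cong v (sym (same (sym e))))
            ... | tri> _ _ Sj<Si = ℕ.<⇒≤ (dom j (ℕ.<⇒≤ (ℕ.<-trans Sj<Si (Hook.sw<ne (H i)))) (outer Sj<Si (ℕ.<⇒≤ m<Nj)))

      composition-visible : tabulate (Colouring.composition H) ≡
                            length (visible π (allFin n) b) ∷ counts π (allFin n) b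
      composition-visible = cong₂ _∷_
        (cong length (filter-≐ _ (free? π b (_∈? allFin n)) ((λ {m} → to (sky⇔ {m})) , from sky⇔) (allFin n)))
        (trans (tabulate-cong λ i → trans
                 (cong length (filter-≐ _ (inside? π b (S i)) ((λ {m} → to (inside⇔ {i} {m})) , from inside⇔) (allFin n)))
                 (cong (insideCount π b) (sw≡ i)))
          (trans (sym (map-tabulate (descent D) (insideCount π b))) (cong (map _) (sym descents-listed))))

    open Scanning v using (Scan)

    descent-injective : ∀ {i j} → descent D i ≡ descent D j → i ≡ j
    descent-injective {i} {j} e with Fin.<-cmp i j
    ... | tri< l _ _ = contradiction (Descents.increasing D l) (ℕ.<-irrefl (cong toℕ e))
    ... | tri≈ _ q _ = q
    ... | tri> _ _ g = contradiction (Descents.increasing D g) (ℕ.<-irrefl (cong toℕ (sym e)))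

    arcs⇒scan : ∀ {H} → Arcs H →
                ∃[ T ] ∃[ q ] Scan (allFin n) [] T q × tabulate (Colouring.composition H) ≡ length T ∷ q
    arcs⇒scan {H} A = _ , _ , hooking⇒scan π final-allFin h , composition-visible {H = H} sw-descent b≡ h
      where
      open Arcs A
      b : Fin n → Fin n
      b d with any? (λ i → descent D i Fin.≟ d)
      ... | yes (i , _) = ne (H i)
      -- A placeholder, since only the values of `b` at descents are consulted.
      ... | no _        = d
      b≡ : ∀ i → b (descent D i) ≡ ne (H i)
      b≡ i with any? (λ j → descent D j Fin.≟ descent D i)
      ... | yes (j , e) = cong (ne ∘ H) (descent-injective e)
      ... | no ¬e       = contradiction (i , refl) ¬e
      as-hook : ∀ {d} → IsDescent π d → ∃[ i ] d ≡ sw (H i) × b d ≡ ne (H i)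
      as-hook {d} dd with to (Descents.exactly D d) dd
      ... | i , refl = i , sym (sw-descent i) , b≡ i
      dom : ∀ i {m} → sw (H i) Fin.≤ m → m Fin.< ne (H i) → v m ℕ.< v (ne (H i))
      dom i {m} l u with Fin.<-cmp (sw (H i)) m
      ... | tri≈ _ refl _ = Hook.πsw<πne (H i)
      ... | tri> _ _ g    = contradiction g (ℕ.≤⇒≯ l)
      ... | tri< l′ _ _   with ℕ.<-cmp (v m) (v (ne (H i)))
      ... | tri< q _ _ = q
      ... | tri≈ _ q _ = contradiction u (ℕ.<-irrefl (cong toℕ (Permutation.injective π q)))
      ... | tri> _ _ q = contradiction (l′ , u , q) (none-above i m)
      h : Hooking π (allFin n) b
      h = record
        { rises       = λ _ dd → case as-hook dd of λ
            { (i , refl , e) → subst (sw (H i) Fin.<_) (sym e) (Hook.sw<ne (H i)) }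
        ; dominates   = λ _ dd {m} l → case as-hook dd of λ
            { (i , refl , e) → subst (λ x → m Fin.< x → v m ℕ.< v x) (sym e) (dom i l) }
        ; noncrossing = λ _ _ dd dd′ l → case as-hook dd , as-hook dd′ of λ
            { ((i , refl , e) , (j , refl , e′)) →
              subst₂ (λ x y → x Fin.≤ sw (H j) ⊎ y Fin.< x) (sym e) (sym e′) (nested i j l) } }

    scan⇒arcs : ∀ {T q} → Scan (allFin n) [] T q →
                ∃[ H ] Arcs H × tabulate (Colouring.composition H) ≡ length T ∷ q
    scan⇒arcs s with scan⇒hooking π final-allFin s
    ... | b , h , refl , refl = H , A , composition-visible {H = H} (λ _ → refl) (λ _ → refl) h
      where
      dd : ∀ i → IsDescent π (descent D i)
      dd i = from (Descents.exactly D _) (i , refl)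
      rise′ : ∀ i → descent D i Fin.< b (descent D i)
      rise′ i = Hooking.rises h (∈-allFin _) (dd i)
      H : Fin k → Hook π
      H i = record
        { sw = descent D i ; ne = b (descent D i) ; sw<ne = rise′ i
        ; πsw<πne = Hooking.dominates h (∈-allFin _) (dd i) ℕ.≤-refl (rise′ i) }
      A : Arcs H
      A = record
        { sw-descent = λ _ → refl
        ; none-above = λ { i m (l , u , g) → ℕ.<-asym g (Hooking.dominates h (∈-allFin _) (dd i) (ℕ.<⇒≤ l) u) }
        ; nested     = λ i j → Hooking.noncrossing h (∈-allFin _) (∈-allFin _) (dd i) (dd j) }

-- Polytopes of weighted trees as hulls of lattice points

module Polytopes where

  open import Data.Vec.Functional using (_++_)
  open Words using (Tree; leaf; node; Gen; Add; gen-length; add-single; add-zero; add-cast-head; Leaves)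

  mapTree : ∀ {a b} {A : Set a} {B : Set b} → (A → B) → ∀ {n} → Tree A n → Tree B n
  mapTree f (leaf x)     = leaf (f x)
  mapTree f (node l r y) = node (mapTree f l) (mapTree f r) (f y)

  totalℕ : ∀ {n} → Vector ℕ n → ℕ
  totalℕ = Vector.foldr ℕ._+_ 0

  add-tabulate : ∀ {n u} (p q : Vector ℕ n) → Add u (tabulate p) (tabulate q) →
                 ∃[ z ] (∀ i → q i ≡ p i ℕ.+ z i) × totalℕ z ≡ u
  add-tabulate p q a = go p q a ≡.refl ≡.refl
    where
    go : ∀ {n u c d} (p q : Vector ℕ n) → Add u c d → c ≡ tabulate p → d ≡ tabulate q →
         ∃[ z ] (∀ i → q i ≡ p i ℕ.+ z i) × totalℕ z ≡ u
    go {zero}  p q Add.[] e e′ = (λ ()) , (λ ()) , ≡.refl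
    go {suc n} p q (a Add.∷ as) e e′ with ∷-injective e | ∷-injective e′
    ... | ≡.refl , es | e₀ , es′ with go (p ∘ suc) (q ∘ suc) as es es′
    ... | z , eq , ≡.refl = (λ { zero → a ; (suc i) → z i }) ,
      (λ { zero → ≡.trans (≡.sym e₀) (ℕ.+-comm a (p zero)) ; (suc i) → eq i }) , ≡.refl

  add-tabulate⁺ : ∀ {n} (p q z : Vector ℕ n) → (∀ i → q i ≡ p i ℕ.+ z i) →
                  Add (totalℕ z) (tabulate p) (tabulate q)
  add-tabulate⁺ {zero}  p q z e = Add.[]
  add-tabulate⁺ {suc n} p q z e = add-cast-head ≡.refl (≡.trans (ℕ.+-comm (z zero) (p zero)) (≡.sym (e zero)))
    (z zero Add.∷ add-tabulate⁺ (p ∘ suc) (q ∘ suc) (z ∘ suc) (e ∘ suc))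

  as-vector : ∀ {n} (c : List ℕ) → length c ≡ n → ∃[ q ] c ≡ tabulate {n = n} q
  as-vector c ≡.refl = List.lookup c , ≡.sym (tabulate-lookup c)

  tabulate-++ : ∀ {m n} (p : Vector ℕ m) (q : Vector ℕ n) → tabulate p List.++ tabulate q ≡ tabulate (p ++ q)
  tabulate-++ {zero}  p q = ≡.refl
  tabulate-++ {suc m} p q = ≡.cong (p zero ∷_) (≡.trans (tabulate-++ (p ∘ suc) q) (tabulate-cong shift))
    where
    shift : ∀ i → ((p ∘ suc) ++ q) i ≡ (p ++ q) (suc i)
    shift i with splitAt m i
    ... | inj₁ _ = ≡.refl
    ... | inj₂ _ = ≡.refl

  gen-node : ∀ {m n y} {l : Tree ℕ m} {r : Tree ℕ n} {q} → Gen (node l r y) (tabulate q) ⇔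
    (∃[ q₁ ] ∃[ q₂ ] ∃[ z ] Gen l (tabulate q₁) × Gen r (tabulate q₂) × totalℕ z ≡ y × (∀ i → q i ≡ (q₁ ++ q₂) i ℕ.+ z i))
  gen-node {l = l} {r} {q} = mk⇔
    (λ { (c₁ , c₂ , g₁ , g₂ , a) → case as-vector c₁ (gen-length l g₁) , as-vector c₂ (gen-length r g₂) of λ
      { ((q₁ , ≡.refl) , (q₂ , ≡.refl)) → case add-tabulate (q₁ ++ q₂) q (≡.subst (λ c → Add _ c _) (tabulate-++ q₁ q₂) a) of λ
        { (z , e , s) → q₁ , q₂ , z , g₁ , g₂ , s , e } } })
    (λ { (q₁ , q₂ , z , g₁ , g₂ , ≡.refl , e) → tabulate q₁ , tabulate q₂ , g₁ , g₂ ,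
      ≡.subst (λ c → Add _ c _) (≡.sym (tabulate-++ q₁ q₂)) (add-tabulate⁺ (q₁ ++ q₂) q z e) })

  module Real {c ℓ₁ ℓ₂} (R : RealNumbers c ℓ₁ ℓ₂) where

    open RealNumbers R public hiding (zero)
    open Geometry R public
    open SemiringSum semiring public using (sum-cong-≋; ∑-distrib-+; *-distribˡ-sum; *-distribʳ-sum; sum-replicate-zero)
    open SemiringSolver commutativeSemiring public using (solve; _:+_; _:*_; _:=_)
    open RingProperties ring public using (-‿distribˡ-*; -‿distribʳ-*; -‿involutive; +-cancelʳ; +-cancelˡ)
    module ≤ = IsDecTotalOrder isDecTotalOrder

    ≤-cong : ∀ {x y x′ y′} → x ≈ x′ → y ≈ y′ → x ≤ y → x′ ≤ y′
    ≤-cong p q = ≤.≤-respˡ-≈ p ∘ ≤.≤-respʳ-≈ q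

    +-mono-≤ : ∀ {x y z w} → x ≤ y → z ≤ w → x + z ≤ y + w
    +-mono-≤ {x} {y} {z} {w} p q = ≤.trans (+-monoˡ-≤ x y z p)
      (≤-cong (+-comm z y) (+-comm w y) (+-monoˡ-≤ z w y q))

    +-monoʳ-≤ : ∀ z {x y} → x ≤ y → z + x ≤ z + y
    +-monoʳ-≤ z p = +-mono-≤ (≤.refl {z}) p

    0≤+ : ∀ {x y} → 0# ≤ x → 0# ≤ y → 0# ≤ x + y
    0≤+ p q = ≤.≤-respˡ-≈ (+-identityˡ 0#) (+-mono-≤ p q)

    +-cancelʳ-≤ : ∀ {x y} z → x + z ≤ y + z → x ≤ y
    +-cancelʳ-≤ {x} {y} z p = ≤-cong (undo x) (undo y) (+-monoˡ-≤ _ _ (- z) p)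
      where
      undo : ∀ x → (x + z) + - z ≈ x
      undo x = trans (+-assoc x z (- z)) (trans (+-congˡ (-‿inverseʳ z)) (+-identityʳ x))

    ≤⇒0≤- : ∀ {x y} → x ≤ y → 0# ≤ y + - x
    ≤⇒0≤- {x} {y} p = ≤.≤-respˡ-≈ (-‿inverseʳ x) (+-monoˡ-≤ x y (- x) p)

    -+ : ∀ x y → (y + - x) + x ≈ y
    -+ x y = trans (+-assoc y (- x) x) (trans (+-congˡ (-‿inverseˡ x)) (+-identityʳ y))

    0≤-⇒≤ : ∀ {x y} → 0# ≤ y + - x → x ≤ y
    0≤-⇒≤ {x} {y} p = ≤-cong (+-identityˡ x) (-+ x y) (+-monoˡ-≤ _ _ x p)

    *-monoˡ-≤ : ∀ {w x y} → 0# ≤ w → x ≤ y → w * x ≤ w * y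
    *-monoˡ-≤ {w} {x} {y} 0≤w x≤y = 0≤-⇒≤ (≤.≤-respʳ-≈
      (trans (distribˡ w y (- x)) (+-congˡ (sym (-‿distribʳ-* w x)))) (*-nonneg w _ 0≤w (≤⇒0≤- x≤y)))

    0≤1 : 0# ≤ 1#
    0≤1 with ≤.total 0# 1#
    ... | inj₁ p = p
    ... | inj₂ 1≤0 = ≤.≤-respʳ-≈ square (*-nonneg (- 1#) (- 1#) 0≤-1 0≤-1)
      where
      0≤-1 : 0# ≤ - 1#
      0≤-1 = ≤.≤-respʳ-≈ (+-identityˡ (- 1#)) (≤⇒0≤- 1≤0)
      square : - 1# * - 1# ≈ 1#
      square = trans (sym (-‿distribˡ-* 1# (- 1#))) (trans (-‿cong (*-identityˡ (- 1#))) (-‿involutive 1#))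

    1≰0 : ¬ 1# ≤ 0#
    1≰0 p = 0≉1 (≤.antisym 0≤1 p)

    inverse-nonneg : ∀ {x y} → 0# ≤ x → x * y ≈ 1# → 0# ≤ y
    inverse-nonneg {x} {y} 0≤x xy≈1 with ≤.total 0# y
    ... | inj₁ p   = p
    ... | inj₂ y≤0 = contradiction (≤-cong xy≈1 (zeroʳ x) (*-monoˡ-≤ 0≤x y≤0)) 1≰0

    fromℕ-+ : ∀ m n → fromℕ (m ℕ.+ n) ≈ fromℕ m + fromℕ n
    fromℕ-+ = Mult.×-homo-+ +-monoid 1#

    0≤fromℕ : ∀ n → 0# ≤ fromℕ n
    0≤fromℕ zero    = ≤.refl
    0≤fromℕ (suc n) = 0≤+ 0≤1 (0≤fromℕ n)

    fromℕ-suc-≰ : ∀ n → ¬ fromℕ (suc n) ≤ 0#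
    fromℕ-suc-≰ n p = 1≰0 (≤.trans (≤.≤-respˡ-≈ (+-identityʳ 1#) (+-monoʳ-≤ 1# (0≤fromℕ n))) p)

    fromℕ-mono : ∀ {m n} → m ℕ.≤ n → fromℕ m ≤ fromℕ n
    fromℕ-mono {n = n} z≤n = 0≤fromℕ n
    fromℕ-mono (s≤s p) = +-monoʳ-≤ 1# (fromℕ-mono p)

    fromℕ-cancel-≤ : ∀ {m n} → fromℕ m ≤ fromℕ n → m ℕ.≤ n
    fromℕ-cancel-≤ {zero}          p = z≤n
    fromℕ-cancel-≤ {suc m} {zero}  p = contradiction p (fromℕ-suc-≰ m)
    fromℕ-cancel-≤ {suc m} {suc n} p = s≤s (fromℕ-cancel-≤
      (+-cancelʳ-≤ 1# (≤-cong (+-comm 1# (fromℕ m)) (+-comm 1# (fromℕ n)) p)))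

    fromℕ-injective : ∀ {m n} → fromℕ m ≈ fromℕ n → m ≡ n
    fromℕ-injective e = ℕ.≤-antisym (fromℕ-cancel-≤ (≤.reflexive e)) (fromℕ-cancel-≤ (≤.reflexive (sym e)))

    fromℕ-totalℕ : ∀ {n} (z : Vector ℕ n) → fromℕ (totalℕ z) ≈ sum (fromℕ ∘ z)
    fromℕ-totalℕ {zero}  z = refl
    fromℕ-totalℕ {suc n} z = trans (fromℕ-+ (z zero) _) (+-congˡ (fromℕ-totalℕ (z ∘ suc)))

    sum-zero : ∀ {n} {f : Vector Carrier n} → (∀ i → f i ≈ 0#) → sum f ≈ 0#
    sum-zero {n} e = trans (sum-cong-≋ e) (sum-replicate-zero n)

    sum-single : ∀ {n} (f : Vector Carrier n) j → (∀ i → i ≢ j → f i ≈ 0#) → sum f ≈ f j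
    sum-single f zero    e = trans (+-congˡ (sum-zero λ i → e (suc i) λ ())) (+-identityʳ (f zero))
    sum-single f (suc j) e = trans (+-cong (e zero λ ()) (sum-single (f ∘ suc) j λ i i≢j → e (suc i) (i≢j ∘ Fin.suc-injective)))
      (+-identityˡ (f (suc j)))

    sum-nonneg : ∀ {n} {f : Vector Carrier n} → (∀ i → 0# ≤ f i) → 0# ≤ sum f
    sum-nonneg {zero}  p = ≤.refl
    sum-nonneg {suc n} p = 0≤+ (p zero) (sum-nonneg (p ∘ suc))

    sum-++ : ∀ {m n} (x : Vector Carrier m) (y : Vector Carrier n) → sum (x ++ y) ≈ sum x + sum y
    sum-++ {zero}  x y = sym (+-identityˡ (sum y))
    sum-++ {suc m} x y = trans (+-congˡ (trans (sum-cong-≋ shift) (sum-++ (x ∘ suc) y))) (sym (+-assoc _ _ _))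
      where
      shift : ∀ i → (x ++ y) (suc i) ≈ ((x ∘ suc) ++ y) i
      shift i with splitAt m i
      ... | inj₁ _ = refl
      ... | inj₂ _ = refl

    infixl 6 _⊕_
    infixl 7 _·ᵛ_
    _⊕_ : ∀ {d} → ℝ^ d → ℝ^ d → ℝ^ d
    (x ⊕ y) i = x i + y i

    _·ᵛ_ : ∀ {d} → Carrier → ℝ^ d → ℝ^ d
    (w ·ᵛ x) i = w * x i

    𝟎 : ∀ {d} → ℝ^ d
    𝟎 _ = 0#

    ≋-refl : ∀ {d} {x : ℝ^ d} → x ≋ x
    ≋-refl i = refl

    ≋-sym : ∀ {d} {x y : ℝ^ d} → x ≋ y → y ≋ x
    ≋-sym p i = sym (p i)

    ≋-trans : ∀ {d} {x y z : ℝ^ d} → x ≋ y → y ≋ z → x ≋ z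
    ≋-trans p q i = trans (p i) (q i)

    -- An inductive form of `conv`. The total weight `σ` is left free because removing one point
    -- from a convex combination leaves a combination that is no longer convex.
    data Hull {d s} (S : Pred (ℝ^ d) s) : Carrier → ℝ^ d → Set (c ⊔ ℓ₁ ⊔ ℓ₂ ⊔ s) where
      nil  : ∀ {σ x} → σ ≈ 0# → x ≋ 𝟎 → Hull S σ x
      cons : ∀ {w p σ′ x′ σ x} → 0# ≤ w → S p → Hull S σ′ x′ →
             σ ≈ w + σ′ → x ≋ w ·ᵛ p ⊕ x′ → Hull S σ x

    module _ {d s} {S : Pred (ℝ^ d) s} where

      hull-resp : ∀ {σ σ′ x x′} → σ ≈ σ′ → x ≋ x′ → Hull S σ x → Hull S σ′ x′
      hull-resp e f (nil e′ f′)        = nil (trans (sym e) e′) (≋-trans (≋-sym f) f′)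
      hull-resp e f (cons p q h e′ f′) = cons p q h (trans (sym e) e′) (≋-trans (≋-sym f) f′)

      hull-point : ∀ {x} → S x → Hull S 1# x
      hull-point {x} p = cons 0≤1 p (nil refl ≋-refl) (sym (+-identityʳ 1#))
        (λ i → sym (trans (+-identityʳ (1# * x i)) (*-identityˡ (x i))))

      hull-⊕ : ∀ {σ τ x y} → Hull S σ x → Hull S τ y → Hull S (σ + τ) (x ⊕ y)
      hull-⊕ (nil e f) h = hull-resp (sym (trans (+-congʳ e) (+-identityˡ _)))
        (λ i → sym (trans (+-congʳ (f i)) (+-identityˡ _))) h
      hull-⊕ (cons p q h e f) h′ = cons p q (hull-⊕ h h′)
        (trans (+-congʳ e) (+-assoc _ _ _)) (λ i → trans (+-congʳ (f i)) (+-assoc _ _ _))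

      hull-sum : ∀ {m} (w : Vector Carrier m) (p : Vector (ℝ^ d) m) → (∀ j → 0# ≤ w j) → (∀ j → S (p j)) →
                 Hull S (sum w) (λ i → sum λ j → w j * p j i)
      hull-sum {zero}  w p 0≤w Sp = nil refl ≋-refl
      hull-sum {suc m} w p 0≤w Sp =
        cons (0≤w zero) (Sp zero) (hull-sum (w ∘ suc) (p ∘ suc) (0≤w ∘ suc) (Sp ∘ suc)) refl ≋-refl

      hull-sum⁻¹ : ∀ {σ x} → Hull S σ x → Σ[ m ∈ ℕ ] Σ[ w ∈ Vector Carrier m ] Σ[ p ∈ Vector (ℝ^ d) m ]
        (∀ j → 0# ≤ w j) × sum w ≈ σ × (∀ j → S (p j)) × (∀ i → x i ≈ sum λ j → w j * p j i)
      hull-sum⁻¹ (nil e f) = 0 , (λ ()) , (λ ()) , (λ ()) , sym e , (λ ()) , f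
      hull-sum⁻¹ (cons {w} {p} 0≤w Sp h e f) with hull-sum⁻¹ h
      ... | m , ws , ps , 0≤ws , e′ , Sps , f′ =
        suc m , (λ { zero → w ; (suc j) → ws j }) , (λ { zero → p ; (suc j) → ps j }) ,
        (λ { zero → 0≤w ; (suc j) → 0≤ws j }) , trans (+-congˡ e′) (sym e) ,
        (λ { zero → Sp ; (suc j) → Sps j }) , (λ i → trans (f i) (+-congˡ (f′ i)))

      conv⇒hull : ∀ {x} → conv S x → Hull S 1# x
      conv⇒hull (m , w , p , 0≤w , e , Sp , f) = hull-resp e (≋-sym f) (hull-sum w p 0≤w Sp)

      hull⇒conv : ∀ {x} → Hull S 1# x → conv S x
      hull⇒conv = hull-sum⁻¹

    hull-mono : ∀ {d s t} {S : Pred (ℝ^ d) s} {T : Pred (ℝ^ d) t} → (∀ {x} → S x → T x) →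
                ∀ {σ x} → Hull S σ x → Hull T σ x
    hull-mono S⊆T (nil e f)        = nil e f
    hull-mono S⊆T (cons p q h e f) = cons p (S⊆T q) (hull-mono S⊆T h) e f

    conv-mono : ∀ {d s t} {S : Pred (ℝ^ d) s} {T : Pred (ℝ^ d) t} → (∀ {x} → S x → T x) →
                ∀ {x} → conv S x → conv T x
    conv-mono {S = S} {T} S⊆T h = hull⇒conv {S = T} (hull-mono (λ {x} → S⊆T {x}) (conv⇒hull {S = S} h))

    module _ {d₁ d₂ d} (op : ℝ^ d₁ → ℝ^ d₂ → ℝ^ d)
      (op-cong : ∀ {x x′ y y′} → x ≋ x′ → y ≋ y′ → op x y ≋ op x′ y′)
      (op-⊕ : ∀ x x′ y y′ → op (x ⊕ x′) (y ⊕ y′) ≋ op x y ⊕ op x′ y′)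
      (op-· : ∀ w x y → op (w ·ᵛ x) (w ·ᵛ y) ≋ w ·ᵛ op x y) where

      Image : ∀ {s t} → Pred (ℝ^ d₁) s → Pred (ℝ^ d₂) t → Pred (ℝ^ d) (c ⊔ s ⊔ t)
      Image A B z = ∃[ x ] ∃[ y ] A x × B y × z ≡ op x y

      private
        op-zero : ∀ {x y} → x ≋ 𝟎 → y ≋ 𝟎 → op x y ≋ 𝟎
        op-zero {x} {y} e f i = trans (op-cong (λ i → trans (e i) (sym (zeroˡ (x i)))) (λ i → trans (f i) (sym (zeroˡ (y i)))) i)
          (trans (op-· 0# x y i) (zeroˡ _))

        hull-point-op : ∀ {s t} {A : Pred (ℝ^ d₁) s} {B : Pred (ℝ^ d₂) t} {w p τ y} → 0# ≤ w → A p → Hull B τ y →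
          Hull (Image A B) (w * τ) (op ((w * τ) ·ᵛ p) (w ·ᵛ y))
        hull-point-op {w = w} {p} 0≤w a (nil e f) = nil (trans (*-congˡ e) (zeroʳ w))
          (op-zero (λ i → trans (*-congʳ (trans (*-congˡ e) (zeroʳ w))) (zeroˡ (p i)))
                   (λ i → trans (*-congˡ (f i)) (zeroʳ w)))
        hull-point-op {w = w} {p} {τ} {y} 0≤w a (cons {v} {q} {τ′} {y′} 0≤v b h e f) =
          cons (*-nonneg w v 0≤w 0≤v) (p , q , a , b , ≡.refl) (hull-point-op 0≤w a h)
            (trans (*-congˡ e) (distribˡ w v τ′))
            (λ i → trans (op-cong
                (λ j → trans (*-congʳ (trans (*-congˡ e) (distribˡ w v τ′))) (distribʳ (p j) (w * v) (w * τ′)))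
                (λ j → trans (*-congˡ (f j)) (trans (distribˡ w _ _) (+-congʳ (sym (*-assoc w v (q j)))))) i)
              (trans (op-⊕ _ _ _ _ i) (+-congʳ (op-· (w * v) p q i))))

      -- Uses the products of the weights. As `op` is linear in the pair of its arguments, and not
      -- bilinear, summing over all pairs of points multiplies `x` by the total weight `τ` of `y`,
      -- and `y` by `σ`.
      hull-op : ∀ {s t} {A : Pred (ℝ^ d₁) s} {B : Pred (ℝ^ d₂) t} {σ τ x y} → Hull A σ x → Hull B τ y →
                Hull (Image A B) (σ * τ) (op (τ ·ᵛ x) (σ ·ᵛ y))
      hull-op {τ = τ} {y = y} (nil e f) h = nil (trans (*-congʳ e) (zeroˡ τ))
        (op-zero (λ i → trans (*-congˡ (f i)) (zeroʳ τ)) (λ i → trans (*-congʳ e) (zeroˡ (y i))))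
      hull-op {τ = τ} {x} {y} (cons {w} {p} {σ′} {x′} 0≤w a h e f) h′ = hull-resp
        (trans (sym (distribʳ τ w σ′)) (*-congʳ (sym e)))
        (λ i → sym (trans (op-cong (λ j → trans (*-congˡ (f j)) (rearrange w τ (p j) (x′ j)))
                              (λ j → trans (*-congʳ e) (distribʳ (y j) w σ′)) i)
                     (op-⊕ _ _ _ _ i)))
        (hull-⊕ (hull-point-op 0≤w a h′) (hull-op h h′))
        where
        rearrange : ∀ w τ p x → τ * (w * p + x) ≈ (w * τ) * p + τ * x
        rearrange = solve 4 (λ w τ p x → τ :* (w :* p :+ x) := (w :* τ) :* p :+ τ :* x) refl

      hull-op₁ : ∀ {s t} {A : Pred (ℝ^ d₁) s} {B : Pred (ℝ^ d₂) t} {x y} → Hull A 1# x → Hull B 1# y →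
                 Hull (Image A B) 1# (op x y)
      hull-op₁ h h′ = hull-resp (*-identityˡ 1#) (op-cong (λ i → *-identityˡ _) (λ i → *-identityˡ _)) (hull-op h h′)

    hull-sumset : ∀ {d s t} {A : Pred (ℝ^ d) s} {B : Pred (ℝ^ d) t} {x y} → Hull A 1# x → Hull B 1# y →
                  Hull (λ z → ∃[ x ] ∃[ y ] A x × B y × z ≡ x ⊕ y) 1# (x ⊕ y)
    hull-sumset = hull-op₁ _⊕_ (λ e f i → +-cong (e i) (f i))
      (λ x x′ y y′ i → solve 4 (λ a b c d → (a :+ b) :+ (c :+ d) := (a :+ c) :+ (b :+ d)) refl (x i) (x′ i) (y i) (y′ i))
      (λ w x y i → sym (distribˡ w (x i) (y i)))

    ++-cong : ∀ {m n} {x x′ : ℝ^ m} {y y′ : ℝ^ n} → x ≋ x′ → y ≋ y′ → (x ++ y) ≋ (x′ ++ y′)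
    ++-cong {m} e f i with splitAt m i
    ... | inj₁ j = e j
    ... | inj₂ j = f j

    ++-⊕ : ∀ {m n} (x x′ : ℝ^ m) (y y′ : ℝ^ n) → ((x ⊕ x′) ++ (y ⊕ y′)) ≋ (x ++ y) ⊕ (x′ ++ y′)
    ++-⊕ {m} x x′ y y′ i with splitAt m i
    ... | inj₁ j = refl
    ... | inj₂ j = refl

    ++-· : ∀ {m n} w (x : ℝ^ m) (y : ℝ^ n) → ((w ·ᵛ x) ++ (w ·ᵛ y)) ≋ w ·ᵛ (x ++ y)
    ++-· {m} w x y i with splitAt m i
    ... | inj₁ j = refl
    ... | inj₂ j = refl

    hull-++ : ∀ {m n s t} {A : Pred (ℝ^ m) s} {B : Pred (ℝ^ n) t} {x y} → Hull A 1# x → Hull B 1# y →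
              Hull (λ z → ∃[ x ] ∃[ y ] A x × B y × z ≡ x ++ y) 1# (x ++ y)
    hull-++ = hull-op₁ _++_ ++-cong ++-⊕ ++-·

    -- The σ-fold dilation of the polytope of a tree; with all dilations at hand,
    -- convexity is an induction on the tree.
    ⟦_⟧ : ∀ {d} → Tree Carrier d → Carrier → Pred (ℝ^ d) (c ⊔ ℓ₁ ⊔ ℓ₂)
    ⟦ leaf a ⟧     σ x = Lift (c ⊔ ℓ₁ ⊔ ℓ₂) (x zero ≈ σ * a)
    ⟦ node l r y ⟧ σ x = ∃[ x₁ ] ∃[ x₂ ] ∃[ z ] ⟦ l ⟧ σ x₁ × ⟦ r ⟧ σ x₂ ×
      (∀ i → 0# ≤ z i) × sum z ≈ σ * y × x ≋ (x₁ ++ x₂) ⊕ z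

    tree-resp : ∀ {d} (t : Tree Carrier d) {σ σ′ x x′} → σ ≈ σ′ → x ≋ x′ → ⟦ t ⟧ σ x → ⟦ t ⟧ σ′ x′
    tree-resp (leaf a) e f (lift g) = lift (trans (sym (f zero)) (trans g (*-congʳ e)))
    tree-resp (node l r y) e f (x₁ , x₂ , z , g₁ , g₂ , 0≤z , s , h) =
      x₁ , x₂ , z , tree-resp l e ≋-refl g₁ , tree-resp r e ≋-refl g₂ , 0≤z , trans s (*-congʳ e) , ≋-trans (≋-sym f) h

    tree-zero : ∀ {d} (t : Tree Carrier d) → ⟦ t ⟧ 0# 𝟎
    tree-zero (leaf a)     = lift (sym (zeroˡ a))
    tree-zero (node {m} {n} l r y) = 𝟎 , 𝟎 , 𝟎 , tree-zero l , tree-zero r , (λ _ → ≤.refl) ,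
      trans (sum-zero {m ℕ.+ n} {𝟎} λ _ → refl) (sym (zeroˡ y)) , (λ i → sym (trans (+-identityʳ _) (zeros i)))
      where
      zeros : ∀ i → (𝟎 {m} ++ 𝟎 {n}) i ≈ 0#
      zeros i with splitAt m i
      ... | inj₁ _ = refl
      ... | inj₂ _ = refl

    tree-⊕ : ∀ {d} (t : Tree Carrier d) {σ τ x y} → ⟦ t ⟧ σ x → ⟦ t ⟧ τ y → ⟦ t ⟧ (σ + τ) (x ⊕ y)
    tree-⊕ (leaf a) {σ} {τ} (lift g) (lift h) = lift (trans (+-cong g h) (sym (distribʳ a σ τ)))
    tree-⊕ (node l r y) {σ} {τ} (x₁ , x₂ , z , g₁ , g₂ , 0≤z , s , e) (x₁′ , x₂′ , z′ , g₁′ , g₂′ , 0≤z′ , s′ , e′) =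
      x₁ ⊕ x₁′ , x₂ ⊕ x₂′ , z ⊕ z′ , tree-⊕ l g₁ g₁′ , tree-⊕ r g₂ g₂′ , (λ i → 0≤+ (0≤z i) (0≤z′ i)) ,
      trans (∑-distrib-+ z z′) (trans (+-cong s s′) (sym (distribʳ y σ τ))) ,
      λ i → trans (+-cong (e i) (e′ i)) (trans
        (solve 4 (λ a b c d → (a :+ b) :+ (c :+ d) := (a :+ c) :+ (b :+ d)) refl ((x₁ ++ x₂) i) (z i) ((x₁′ ++ x₂′) i) (z′ i))
        (+-congʳ (sym (++-⊕ x₁ x₁′ x₂ x₂′ i))))

    tree-· : ∀ {d} (t : Tree Carrier d) {σ w x} → 0# ≤ w → ⟦ t ⟧ σ x → ⟦ t ⟧ (w * σ) (w ·ᵛ x)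
    tree-· (leaf a) {σ} {w} 0≤w (lift g) = lift (trans (*-congˡ g) (sym (*-assoc w σ a)))
    tree-· (node l r y) {σ} {w} 0≤w (x₁ , x₂ , z , g₁ , g₂ , 0≤z , s , e) =
      w ·ᵛ x₁ , w ·ᵛ x₂ , w ·ᵛ z , tree-· l 0≤w g₁ , tree-· r 0≤w g₂ , (λ i → *-nonneg w (z i) 0≤w (0≤z i)) ,
      trans (sym (*-distribˡ-sum w z)) (trans (*-congˡ s) (sym (*-assoc w σ y))) ,
      λ i → trans (*-congˡ (e i)) (trans (distribˡ w _ _) (+-congʳ (sym (++-· w x₁ x₂ i))))

    hull⇒tree : ∀ {d} (t : Tree Carrier d) {σ x} → Hull (⟦ t ⟧ 1#) σ x → ⟦ t ⟧ σ x
    hull⇒tree t (nil e f)        = tree-resp t (sym e) (≋-sym f) (tree-zero t)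
    hull⇒tree t (cons 0≤w p h e f) = tree-resp t (trans (+-congʳ (*-identityʳ _)) (sym e)) (≋-sym f)
      (tree-⊕ t (tree-· t 0≤w p) (hull⇒tree t h))

    LatticePoints : ∀ {d} → Tree ℕ d → Pred (ℝ^ d) ℓ₁
    LatticePoints t x = ∃[ q ] Gen t (tabulate q) × x ≋ fromℕ ∘ q

    fromℕ-++ : ∀ {m n} (p : Vector ℕ m) (q : Vector ℕ n) i → fromℕ ((p ++ q) i) ≈ ((fromℕ ∘ p) ++ (fromℕ ∘ q)) i
    fromℕ-++ {m} p q i with splitAt m i
    ... | inj₁ _ = refl
    ... | inj₂ _ = refl

    lattice⇒tree : ∀ {d} (t : Tree ℕ d) {x} → LatticePoints t x → ⟦ mapTree fromℕ t ⟧ 1# x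
    lattice⇒tree (leaf a) (q , g , e) =
      lift (trans (e zero) (trans (reflexive (≡.cong fromℕ (proj₁ (∷-injective g)))) (sym (*-identityˡ _))))
    lattice⇒tree (node l r y) (q , g , e) with to (gen-node {l = l} {r}) g
    ... | q₁ , q₂ , z , g₁ , g₂ , ≡.refl , e′ = fromℕ ∘ q₁ , fromℕ ∘ q₂ , fromℕ ∘ z ,
      lattice⇒tree l (q₁ , g₁ , ≋-refl) , lattice⇒tree r (q₂ , g₂ , ≋-refl) , 0≤fromℕ ∘ z ,
      trans (sym (fromℕ-totalℕ z)) (sym (*-identityˡ _)) ,
      λ i → trans (e i) (trans (reflexive (≡.cong fromℕ (e′ i))) (trans (fromℕ-+ ((q₁ ++ q₂) i) (z i)) (+-congʳ (fromℕ-++ q₁ q₂ i))))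

    spike : ∀ {d} → ℕ → Fin d → Vector ℕ d
    spike y i j = if does (i Fin.≟ j) then y else 0

    spike-≡ : ∀ {d} y (i : Fin d) → spike y i i ≡ y
    spike-≡ y i rewrite dec-true (i Fin.≟ i) ≡.refl = ≡.refl

    spike-≢ : ∀ {d} y {i j : Fin d} → i ≢ j → spike y i j ≡ 0
    spike-≢ y {i} {j} i≢j rewrite dec-false (i Fin.≟ j) i≢j = ≡.refl

    totalℕ-spike : ∀ {d} y (i : Fin d) → totalℕ (spike y i) ≡ y
    totalℕ-spike {d} y i = fromℕ-injective (trans (fromℕ-totalℕ (spike y i)) (trans
      (sum-single (fromℕ ∘ spike y i) i λ j j≢i → reflexive (≡.cong fromℕ (spike-≢ y (j≢i ∘ ≡.sym))))
      (reflexive (≡.cong fromℕ (spike-≡ y i)))))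

    sum≈0⇒≋𝟎 : ∀ {d} {z : ℝ^ d} → (∀ i → 0# ≤ z i) → sum z ≈ 0# → z ≋ 𝟎
    sum≈0⇒≋𝟎 {suc d} {z} 0≤z e = λ { zero → z₀≈0 ; (suc i) → sum≈0⇒≋𝟎 (0≤z ∘ suc) tail≈0 i }
      where
      tail≥0 = sum-nonneg (0≤z ∘ suc)
      z₀≈0 : z zero ≈ 0#
      z₀≈0 = ≤.antisym (≤-cong (+-identityʳ _) e (+-monoʳ-≤ (z zero) tail≥0)) (0≤z zero)
      tail≈0 : sum (z ∘ suc) ≈ 0#
      tail≈0 = trans (sym (+-identityˡ _)) (trans (+-congʳ (sym z₀≈0)) e)

    -- The point `z` is the combination of the corners `y` times `e i` with weights `z i / y`. For
    -- `y` zero one cannot divide, but then the simplex is the origin.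
    hull-simplex : ∀ {d} y {z : ℝ^ d} → (∀ i → 0# ≤ z i) → sum z ≈ fromℕ y →
                   Hull (λ x → ∃[ u ] totalℕ u ≡ y × x ≋ fromℕ ∘ u) 1# z
    hull-simplex {d} zero {z} 0≤z e = hull-point ((λ _ → 0) , zeros d , sum≈0⇒≋𝟎 0≤z e)
      where
      zeros : ∀ d → totalℕ {d} (λ _ → 0) ≡ 0
      zeros zero    = ≡.refl
      zeros (suc d) = zeros d
    hull-simplex {d} (suc y) {z} 0≤z e with inverse (fromℕ (suc y)) (fromℕ-suc-≰ y ∘ ≤.reflexive)
    ... | v , yv≈1 = hull-resp
      (trans (sym (*-distribʳ-sum v z)) (trans (*-congʳ e) yv≈1))
      (λ j → trans (sum-single (λ i → (z i * v) * fromℕ (spike (suc y) i j)) j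
                      λ i i≢j → trans (*-congˡ (reflexive (≡.cong fromℕ (spike-≢ (suc y) i≢j)))) (zeroʳ _))
               (trans (*-congˡ (reflexive (≡.cong fromℕ (spike-≡ (suc y) j)))) (trans (*-assoc (z j) v _)
                 (trans (*-congˡ (trans (*-comm v _) yv≈1)) (*-identityʳ (z j))))))
      (hull-sum (λ i → z i * v) (λ i → fromℕ ∘ spike (suc y) i)
        (λ i → *-nonneg (z i) v (0≤z i) (inverse-nonneg (0≤fromℕ (suc y)) yv≈1))
        (λ i → spike (suc y) i , totalℕ-spike (suc y) i , ≋-refl))

    -- The two side parts and the simplex part of a point each lie in a hull of lattice points, and
    -- hulls are compatible with concatenation and with sums.
    tree⇒hull : ∀ {d} (t : Tree ℕ d) {x} → ⟦ mapTree fromℕ t ⟧ 1# x → Hull (LatticePoints t) 1# x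
    tree⇒hull (leaf a) (lift g) =
      hull-point ((λ _ → a) , ≡.refl , λ { zero → trans g (*-identityˡ _) })
    tree⇒hull (node l r y) (x₁ , x₂ , z , g₁ , g₂ , 0≤z , s , e) = hull-resp refl (≋-sym e)
      (hull-mono combine (hull-sumset (hull-++ (tree⇒hull l g₁) (tree⇒hull r g₂))
        (hull-simplex y 0≤z (trans s (*-identityˡ _)))))
      where
      combine : ∀ {x} → _ → LatticePoints (node l r y) x
      combine (_ , _ , (_ , _ , (q₁ , g₁ , e₁) , (q₂ , g₂ , e₂) , ≡.refl) , (u , s , e₃) , ≡.refl) =
        (λ i → (q₁ ++ q₂) i ℕ.+ u i) , from (gen-node {l = l} {r}) (q₁ , q₂ , u , g₁ , g₂ , s , λ _ → ≡.refl) ,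
        λ i → trans (+-cong (trans (++-cong e₁ e₂ i) (sym (fromℕ-++ q₁ q₂ i))) (e₃ i)) (sym (fromℕ-+ ((q₁ ++ q₂) i) (u i)))

    conv-lattice : ∀ {d} (t : Tree ℕ d) → conv (LatticePoints t) ≐ ⟦ mapTree fromℕ t ⟧ 1#
    conv-lattice t = (λ h → hull⇒tree _ (hull-mono (lattice⇒tree t) (conv⇒hull h))) , (λ h → hull⇒conv (tree⇒hull t h))

-- Fertilitopes are the polytopes of trees with natural weights

module Fertilitopes where

  open Words
  open Hookings
  open Polytopes

  tiles-zero : ∀ {d X N c} {t : Tree ℕ d} → Tiles X 0 t → All (ℕ._< N) X → Comp N X 0 c ⇔ Gen t c
  tiles-zero T X<N = mk⇔
    (λ w → case to (T X<N) w of λ { (zero , _ , ≡.refl , g , a) → ≡.subst (Gen _) (≡.sym (add-zero⁻¹ ≡.refl a)) g })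
    (λ g → from (T X<N) (0 , _ , ≡.refl , g , add-zero _))

  letters : ∀ {n} → Permutation n → List ℕ
  letters {n} π = List.map (at π) (allFin n)

  scan-letters : ∀ {n} (π : Permutation n) {W T q} → Scanning.Scan (at π) W [] T q →
                 ∃[ T′ ] length T ≡ length T′ × Word.Scan (List.map (at π) W) [] T′ q
  scan-letters π {W} s with scan-simulate (at π) id (λ i x → at π i ≡ x) (λ i x → at π i ≡ x) id
      (λ { ≡.refl ≡.refl → mk⇔ id id }) (graph W) [] s
    where
    graph : ∀ W → Pointwise (λ i x → at π i ≡ x) W (List.map (at π) W)
    graph []      = []
    graph (i ∷ W) = ≡.refl ∷ graph W
  ... | T′ , ts , s′ = T′ , Pointwise.Pointwise-length ts , s′

  scan-letters⁻¹ : ∀ {n} (π : Permutation n) {W T q} → Word.Scan (List.map (at π) W) [] T q →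
                   ∃[ T′ ] length T ≡ length T′ × Scanning.Scan (at π) W [] T′ q
  scan-letters⁻¹ π {W} s with scan-simulate id (at π) (λ x i → x ≡ at π i) (λ x i → x ≡ at π i) id
      (λ { ≡.refl ≡.refl → mk⇔ id id }) (graph W) [] s
    where
    graph : ∀ W → Pointwise (λ x i → x ≡ at π i) (List.map (at π) W) W
    graph []      = []
    graph (i ∷ W) = ≡.refl ∷ graph W
  ... | T′ , ts , s′ = T′ , Pointwise.Pointwise-length ts , s′

  arcs⇔comp : ∀ {n k N} {π : Permutation n} (D : Descents π k) {c} →
    (∃[ H ] Arcs D H × tabulate (Colouring.composition H) ≡ c) ⇔ Comp N (letters π) 0 c
  arcs⇔comp {π = π} D = mk⇔
    (λ { (H , A , ≡.refl) → case arcs⇒scan D A of λ { (T , q , s , e) → case scan-letters π s of λ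
      { (T′ , e′ , s′) → T′ , q , s′ , ≡.trans e (≡.cong (_∷ q) e′) } } })
    (λ { (T , q , s , ≡.refl) → case scan-letters⁻¹ π s of λ { (T′ , e′ , s′) → case scan⇒arcs D s′ of λ
      { (H , A , e) → H , A , ≡.trans e (≡.cong (_∷ q) (≡.sym e′)) } } })

  bound : List ℕ → ℕ
  bound X = suc (max 0 X)

  <bound : ∀ X → All (ℕ._< bound X) X
  <bound X = All.map s≤s (xs≤max 0 X)

  letters-tiling : ∀ {n} (π : Permutation n) → Tiling (letters π)
  letters-tiling {zero}  π = contradiction (Permutation.size≥1 π) λ ()
  letters-tiling {suc n} π = tiling-of _ _ _ ℕ.≤-refl (Unique.map⁺ (Permutation.injective π) (Unique.allFin⁺ (suc n)))

  Encodes : ∀ {n k d} {π : Permutation n} → Descents π k → Tree ℕ d → Set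
  Encodes D t = ∀ c → (∃[ H ] Arcs D H × tabulate (Colouring.composition H) ≡ c) ⇔ Gen t c

  -- The configuration `H₀` forces the deficit of the word to be zero, and the length of its
  -- composition shows that the tree has `suc k` leaves.
  composition-tree : ∀ {n k} {π : Permutation n} (D : Descents π k) {H₀} → Arcs D H₀ →
    Σ[ t ∈ Tree ℕ (suc k) ] Leaves (0 ℕ.<_) t ×
      Encodes D t
  composition-tree {k = k} {π = π} D {H₀} A₀ with letters-tiling π | to (arcs⇔comp {N = bound (letters π)} D) (_ , A₀ , ≡.refl)
  ... | tiling n₀ t p T | w with to (T (<bound _)) w
  ... | v , b , e , g , a with ℕ.m+n≡0⇒m≡0 n₀ (≡.sym e)
  ... | ≡.refl with ≡.trans (≡.sym (gen-length t (to (tiles-zero {X = letters π} T (<bound _)) w))) (length-tabulate (Colouring.composition H₀))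
  ... | ≡.refl = t , p , λ c → mk⇔
    (to (tiles-zero {X = letters π} T (<bound (letters π))) ∘ to (arcs⇔comp {N = bound (letters π)} D)) (from (arcs⇔comp {N = bound (letters π)} D) ∘ from (tiles-zero {X = letters π} T (<bound (letters π))))

  list-permutation : ∀ x X → Unique (x ∷ X) → All (0 ℕ.<_) (x ∷ X) → Permutation (length (x ∷ X))
  list-permutation x X u 0<X = record
    { size≥1    = s≤s z≤n
    ; at        = lookup (x ∷ X)
    ; positive  = λ i → All.lookup 0<X (∈-lookup i)
    ; injective = λ {i} {j} → Unique-lookup (x ∷ X) u i j }
    where
    Unique-lookup : ∀ xs → Unique xs → ∀ i j → lookup xs i ≡ lookup xs j → i ≡ j
    Unique-lookup (x ∷ xs) _       zero    zero    e = ≡.refl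
    Unique-lookup (x ∷ xs) (p ∷ _) zero    (suc j) e = contradiction e (All.lookup p (∈-lookup j))
    Unique-lookup (x ∷ xs) (p ∷ _) (suc i) zero    e = contradiction (≡.sym e) (All.lookup p (∈-lookup i))
    Unique-lookup (x ∷ xs) (_ ∷ u) (suc i) (suc j) e = ≡.cong suc (Unique-lookup xs u i j e)

  letters-list : ∀ x X u 0<X → letters (list-permutation x X u 0<X) ≡ x ∷ X
  letters-list x X u 0<X = ≡.trans (map-tabulate id (lookup (x ∷ X))) (tabulate-lookup (x ∷ X))

  allDescents : ∀ {n} (π : Permutation n) → Descents π (length (filter (isDescent? π) (allFin n)))
  allDescents {n} π = record
    { descent    = lookup ds
    ; increasing = λ {i} {j} → lookup-< ds (AllPairs.filter⁺ (isDescent? π) (Final.sorted final-allFin)) i j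
    ; exactly    = λ m → mk⇔
        (λ dm → let m∈ = ∈-filter⁺ (isDescent? π) (∈-allFin m) dm in Any.index m∈ , ≡.sym (lookup-index m∈))
        (λ { (i , ≡.refl) → proj₂ (∈-filter⁻ (isDescent? π) {xs = allFin n} (∈-lookup i)) }) }
    where
    ds = filter (isDescent? π) (allFin n)
    lookup-< : ∀ xs → Sorted xs → ∀ i j → i Fin.< j → lookup xs i Fin.< lookup xs j
    lookup-< (x ∷ xs) (p ∷ _) zero    (suc j) l       = All.lookup p (∈-lookup j)
    lookup-< (x ∷ xs) (_ ∷ s) (suc i) (suc j) (s≤s l) = lookup-< xs s i j l

  tree-permutation : ∀ {k} (t : Tree ℕ (suc k)) → Leaves (0 ℕ.<_) t →
    ∃[ n ] Σ[ π ∈ Permutation n ] Σ[ D ∈ Descents π k ]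
      Encodes D t
  tree-permutation {k} t p with realise p 0
  ... | realisation {front = X} M 0<X 0<M X<M u T =
    build (X ∷ʳ M) (AllPairs.++⁺ u ([] ∷ []) (All.map (λ h → ℕ.<⇒≢ h ∷ []) X<M)) (All.∷ʳ⁺ 0<X 0<M) T
      (λ e → case ≡.trans (≡.sym (length-++ X)) (≡.cong length e) of λ e′ → case ≡.trans (ℕ.+-comm 1 (length X)) e′ of λ ())
    where
    build : ∀ Z → Unique Z → All (0 ℕ.<_) Z → Tiles Z 0 t → Z ≢ [] →
            ∃[ n ] Σ[ π ∈ Permutation n ] Σ[ D ∈ Descents π k ] Encodes D t
    build []      _ _   _ ne = contradiction ≡.refl ne
    build (z ∷ Z) u 0<Z T _  = length (z ∷ Z) , π , transport (allDescents π) encodes (count≡k encodes)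
      where
      π : Permutation (length (z ∷ Z))
      π = list-permutation z Z u 0<Z
      T′ : Tiles (letters π) 0 t
      T′ = ≡.subst (λ X → Tiles X 0 t) (≡.sym (letters-list z Z u 0<Z)) (λ {N} → T {N})
      encodes : Encodes (allDescents π) t
      encodes c = mk⇔
        (to (tiles-zero {X = letters π} T′ (<bound (letters π))) ∘ to (arcs⇔comp {N = bound (letters π)} (allDescents π)))
        (from (arcs⇔comp {N = bound (letters π)} (allDescents π)) ∘ from (tiles-zero {X = letters π} T′ (<bound (letters π))))
      -- The number of descents of the constructed permutation is read off from the length of one
      -- composition generated by the tree.
      count≡k : ∀ {k′} {D : Descents π k′} → Encodes D t → k′ ≡ k
      count≡k enc with gen-inhabited t
      ... | x , c , g with from (enc (x ∷ c)) g
      ... | H , A , e = ℕ.suc-injective (≡.trans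
        (≡.sym (≡.trans (≡.cong length (≡.sym e)) (length-tabulate (Colouring.composition H)))) (gen-length t g))
      transport : ∀ {k′} (D : Descents π k′) → Encodes D t → k′ ≡ k → Σ[ D ∈ Descents π k ] Encodes D t
      transport D e ≡.refl = D , e

  tabulate-injective : ∀ {n} {p q : Vector ℕ n} → tabulate p ≡ tabulate q → ∀ i → p i ≡ q i
  tabulate-injective e zero    = proj₁ (∷-injective e)
  tabulate-injective e (suc i) = tabulate-injective (proj₂ (∷-injective e)) i

  module Fertility {c ℓ₁ ℓ₂} (R : RealNumbers c ℓ₁ ℓ₂) where

    open Real R

    module _ {n k} {π : Permutation n} (D : Descents π k) where

      private v = at π

      col-cancel-≤ : ∀ {i j : Fin n} → col {π = π} i ≤ col {π = π} j → i Fin.≤ j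
      col-cancel-≤ p = ℕ.s≤s⁻¹ (fromℕ-cancel-≤ p)

      col-mono-≤ : ∀ {i j : Fin n} → i Fin.≤ j → col {π = π} i ≤ col {π = π} j
      col-mono-≤ p = fromℕ-mono (s≤s p)

      col-injective : ∀ {i j : Fin n} → col {π = π} i ≈ col {π = π} j → i ≡ j
      col-injective e = Fin.toℕ-injective (ℕ.suc-injective (fromℕ-injective e))

      vhc⇒arcs : (𝓗 : ValidHookConfiguration D) → Arcs D (ValidHookConfiguration.hooks 𝓗)
      vhc⇒arcs 𝓗 = record { sw-descent = sw-descent ; none-above = none-above ; nested = nested }
        where
        open ValidHookConfiguration 𝓗 renaming (hooks to H)
        dominated : ∀ i m → sw (H i) Fin.< m → m Fin.< ne (H i) → v m ℕ.< v (ne (H i))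
        dominated i m l u with ℕ.<-cmp (v m) (v (ne (H i)))
        ... | tri< q _ _ = q
        ... | tri≈ _ q _ = contradiction u (ℕ.<-irrefl (≡.cong toℕ (Permutation.injective π q)))
        ... | tri> _ _ q = contradiction (l , u , q) (none-above i m)
        nested : ∀ i j → sw (H i) Fin.< sw (H j) → ne (H i) Fin.≤ sw (H j) ⊎ ne (H j) Fin.< ne (H i)
        nested i j Si<Sj with ℕ.≤-<-connex (toℕ (ne (H i))) (toℕ (sw (H j)))
        ... | inj₁ l = inj₁ l
        ... | inj₂ Sj<Ni with ℕ.≤-<-connex (toℕ (ne (H i))) (toℕ (ne (H j)))
        ... | inj₂ l = inj₂ l
        -- Here the horizontal part of the first hook meets the vertical part of the second, in the
        -- column where the second starts and the row where the first ends. That column is neither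
        -- the last nor the first one of the first hook, so the contact is forbidden.
        ... | inj₁ Ni≤Nj = contradiction
          (no-crossing i j (λ { ≡.refl → ℕ.<-irrefl ≡.refl Si<Sj })
            (col {π = π} (sw (H j)) , row {π = π} (ne (H i)))
            (inj₂ (refl , col-mono-≤ (ℕ.<⇒≤ Si<Sj) , col-mono-≤ (ℕ.<⇒≤ Sj<Ni)))
            (inj₁ (refl , fromℕ-mono (ℕ.<⇒≤ (dominated i _ Si<Sj Sj<Ni)) , fromℕ-mono vNi≤vNj)))
          λ { (inj₁ ((x≈ , _) , _)) → ℕ.<-irrefl (≡.cong toℕ (col-injective x≈)) Sj<Ni
            ; (inj₂ ((x≈ , _) , _)) → ℕ.<-irrefl (≡.cong toℕ (≡.sym (col-injective x≈))) Si<Sj }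
          where
          vNi≤vNj : v (ne (H i)) ℕ.≤ v (ne (H j))
          vNi≤vNj with ℕ.m≤n⇒m<n∨m≡n Ni≤Nj
          ... | inj₁ Ni<Nj = ℕ.<⇒≤ (dominated j _ Sj<Ni Ni<Nj)
          ... | inj₂ e     = ℕ.≤-reflexive (≡.cong v (Fin.toℕ-injective e))

      hook-left : (h : Hook π) → ∀ {p} → hook h p → col {π = π} (sw h) ≤ proj₁ p
      hook-left h (inj₁ (x≈ , _))     = ≤.reflexive (sym x≈)
      hook-left h (inj₂ (_ , l , _))  = l

      hook-top : (h : Hook π) → ∀ {p} → hook h p → proj₂ p ≤ row {π = π} (ne h)
      hook-top h (inj₁ (_ , _ , u)) = u
      hook-top h (inj₂ (y≈ , _))    = ≤.reflexive y≈

      -- The hook `h′` stays right of its first column and below its top row. So it misses the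
      -- vertical part of `h`, and also the horizontal part if it ends lower; otherwise contact is
      -- possible only where `h` ends and `h′` starts.
      hooks-meet : (h h′ : Hook π) → sw h Fin.< sw h′ →
        ne h Fin.≤ sw h′ ⊎ (ne h′ Fin.< ne h × v (ne h′) ℕ.< v (ne h)) →
        ∀ p → hook h p → hook h′ p → p ≈ₚ plotPoint {π = π} (ne h) × p ≈ₚ plotPoint {π = π} (sw h′)
      hooks-meet h h′ S<S′ _ p (inj₁ (x≈ , _)) q =
        contradiction (col-cancel-≤ (≤.≤-respʳ-≈ x≈ (hook-left h′ q))) (ℕ.<⇒≱ S<S′)
      hooks-meet h h′ S<S′ (inj₂ (_ , lower)) p (inj₂ (y≈ , _)) q =
        contradiction (fromℕ-cancel-≤ (≤.≤-respˡ-≈ y≈ (hook-top h′ q))) (ℕ.<⇒≱ lower)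
      hooks-meet h h′ S<S′ (inj₁ N≤S′) (x , y) (inj₂ (y≈ , _ , x≤)) q = (x≈ , y≈) ,
        ≡.subst (λ i → (x , y) ≈ₚ plotPoint {π = π} i) N≡S′ (x≈ , y≈)
        where
        S′≤x = hook-left h′ q
        N≡S′ : ne h ≡ sw h′
        N≡S′ = Fin.≤-antisym N≤S′ (col-cancel-≤ (≤.trans S′≤x x≤))
        x≈ : x ≈ col {π = π} (ne h)
        x≈ = ≤.antisym x≤ (≤.trans (col-mono-≤ N≤S′) S′≤x)

      arcs⇒vhc : ∀ {H} → Arcs D H → Σ[ 𝓗 ∈ ValidHookConfiguration D ] ValidHookConfiguration.hooks 𝓗 ≡ H
      arcs⇒vhc {H} A = record
        { hooks = H ; sw-descent = sw-descent ; none-above = none-above ; no-crossing = no-crossing } , ≡.refl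
        where
        open Arcs A
        below-outer : ∀ i j → sw (H i) Fin.< sw (H j) → ne (H j) Fin.< ne (H i) → v (ne (H j)) ℕ.< v (ne (H i))
        below-outer i j Si<Sj Nj<Ni with ℕ.<-cmp (v (ne (H j))) (v (ne (H i)))
        ... | tri< q _ _ = q
        ... | tri≈ _ q _ = contradiction Nj<Ni (ℕ.<-irrefl (≡.cong toℕ (Permutation.injective π q)))
        ... | tri> _ _ q = contradiction (ℕ.<-trans Si<Sj (Hook.sw<ne (H j)) , Nj<Ni , q) (none-above i _)
        meet : ∀ i j → sw (H i) Fin.< sw (H j) → ∀ p → hook (H i) p → hook (H j) p →
               p ≈ₚ plotPoint {π = π} (ne (H i)) × p ≈ₚ plotPoint {π = π} (sw (H j))
        meet i j l = hooks-meet (H i) (H j) l (case nested i j l of λ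
          { (inj₁ q) → inj₁ q ; (inj₂ q) → inj₂ (q , below-outer i j l q) })
        no-crossing : ∀ i j → i ≢ j → ∀ p → hook (H i) p → hook (H j) p → _
        no-crossing i j i≢j p a b with Fin.<-cmp (sw (H i)) (sw (H j))
        ... | tri< l _ _ = inj₁ (meet i j l p a b)
        ... | tri≈ _ e _ = contradiction (descent-injective D (≡.trans (≡.sym (sw-descent i)) (≡.trans e (sw-descent j)))) i≢j
        ... | tri> _ _ g = case meet j i g p b a of λ { (x , y) → inj₂ (y , x) }

      valid⇔arcs : ∀ {q} → validCompositions D q ⇔ (∃[ H ] Arcs D H × tabulate (Colouring.composition H) ≡ tabulate q)
      valid⇔arcs = mk⇔
        (λ { (𝓗 , e) → _ , vhc⇒arcs 𝓗 , tabulate-cong (≡.sym ∘ e) })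
        (λ { (H , A , e) → case arcs⇒vhc A of λ { (𝓗 , ≡.refl) → 𝓗 , ≡.sym ∘ tabulate-injective e } })

      module _ {t : Tree ℕ (suc k)} (gen : Encodes D t) where

        fer≐tree : Fer D ≐ ⟦ mapTree fromℕ t ⟧ 1#
        fer≐tree = ≐-trans
          ( conv-mono {S = Compositions} {T = LatticePoints t} (λ { (q , vq , e) → q , to (gen _) (to valid⇔arcs vq) , e })
          , conv-mono {S = LatticePoints t} {T = Compositions} (λ { (q , g , e) → q , from valid⇔arcs (from (gen _) g) , e }))
          (conv-lattice t)
          where
          Compositions : Pred (ℝ^ suc k) (c ⊔ ℓ₁ ⊔ ℓ₂)
          Compositions x = ∃[ q ] validCompositions D q × x ≋ fromℕ ∘ q

      fer⇒tree : ∃ (Fer D) → Σ[ t ∈ Tree ℕ (suc k) ] Leaves (0 ℕ.<_) t × Fer D ≐ ⟦ mapTree fromℕ t ⟧ 1#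
      -- An empty combination has total weight 0, so a point of the hull yields at least one valid
      -- configuration.
      fer⇒tree (x , zero , w , p , 0≤w , e , _) = contradiction e 0≉1
      fer⇒tree (x , suc m , w , p , 0≤w , e , Sp , _) with Sp zero
      ... | q , (𝓗 , _) , _ with composition-tree D (vhc⇒arcs 𝓗)
      ... | t , pos , gen = t , pos , fer≐tree gen

    -- The normal form with which integral binary nestohedra are compared as well.
    fertilitope⇔tree : ∀ {k s} {P : Pred (ℝ^ suc k) s} → ∃ P →
      IsFertilitope P ⇔ (Σ[ t ∈ Tree ℕ (suc k) ] Leaves (0 ℕ.<_) t × P ≐ ⟦ mapTree fromℕ t ⟧ 1#)
    fertilitope⇔tree {P = P} (x , Px) = mk⇔ f g
      where
      f : IsFertilitope P → _
      f (n , π , D , P≐F) with fer⇒tree D (x , proj₁ P≐F Px)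
      ... | t , pos , F≐t = t , pos , ≐-trans P≐F F≐t
      g : _ → IsFertilitope P
      g (t , pos , P≐t) with tree-permutation t pos
      ... | n , π , D , gen = n , π , D , ≐-trans P≐t (≐-sym (fer≐tree D gen))

-- Binary building sets as binary trees

module BuildingSets where

  open import Data.List.Base using (map; _++_)
  open ≡ using (refl; sym; trans; cong; subst; subst₂)
  open Words using (Tree; leaf; node; Leaves)

  module _ {m n : ℕ} where

    by-sides : ∀ {p} (P : Pred (Fin (m ℕ.+ n)) p) → (∀ i → P (i ↑ˡ n)) → (∀ j → P (m ↑ʳ j)) → ∀ k → P k
    by-sides P l r k with splitAt m k in eq
    ... | inj₁ i = subst P (Fin.splitAt⁻¹-↑ˡ eq) (l i)
    ... | inj₂ j = subst P (Fin.splitAt⁻¹-↑ʳ eq) (r j)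

    ↑ˡ<↑ʳ : ∀ (i : Fin m) (j : Fin n) → (i ↑ˡ n) Fin.< (m ↑ʳ j)
    ↑ˡ<↑ʳ i j = subst₂ ℕ._<_ (sym (Fin.toℕ-↑ˡ i n)) (sym (Fin.toℕ-↑ʳ m j)) (ℕ.≤-trans (Fin.toℕ<n i) (ℕ.m≤m+n m (toℕ j)))

    module _ (s : Subset m) (r : Subset n) where

      ∈-++ˡ : ∀ i → i Subset.∈ s ⇔ (i ↑ˡ n) Subset.∈ (s Vec.++ r)
      ∈-++ˡ i = mk⇔
        (λ p → Vec.lookup⇒[]= _ _ (trans (Vec.lookup-++ˡ s r i) (Vec.[]=⇒lookup p)))
        (λ p → Vec.lookup⇒[]= _ _ (trans (sym (Vec.lookup-++ˡ s r i)) (Vec.[]=⇒lookup p)))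

      ∈-++ʳ : ∀ j → j Subset.∈ r ⇔ (m ↑ʳ j) Subset.∈ (s Vec.++ r)
      ∈-++ʳ j = mk⇔
        (λ p → Vec.lookup⇒[]= _ _ (trans (Vec.lookup-++ʳ s r j) (Vec.[]=⇒lookup p)))
        (λ p → Vec.lookup⇒[]= _ _ (trans (sym (Vec.lookup-++ʳ s r j)) (Vec.[]=⇒lookup p)))

    extˡ : Subset m → Subset (m ℕ.+ n)
    extˡ s = s Vec.++ ⊥

    extʳ : Subset n → Subset (m ℕ.+ n)
    extʳ r = ⊥ Vec.++ r

  sets : ∀ {a} {A : Set a} {d} → List (Subset d × A) → List (Subset d)
  sets = map proj₁

  -- An interval of Fin d, enumerated by ι, with the subsets of Fin m regarded
  -- as subsets of Fin d.
  record Segment {m d} (ι : Fin m → Fin d) (ext : Subset m → Subset d) : Set where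
    field
      ∈-ext  : ∀ s x → x Subset.∈ s ⇔ ι x Subset.∈ ext s
      image  : ∀ s {y} → y Subset.∈ ext s → ∃[ x ] y ≡ ι x
      ι-≤    : ∀ x x′ → x Fin.≤ x′ ⇔ ι x Fin.≤ ι x′
      convex : ∀ {x x′ y} → ι x Fin.≤ y → y Fin.≤ ι x′ → ∃[ z ] y ≡ ι z

    ext-injective : ∀ {s s′} → ext s ≡ ext s′ → s ≡ s′
    ext-injective {s} {s′} e = Subset.⊆-antisym
      (λ {x} p → from (∈-ext s′ x) (subst (ι x Subset.∈_) e (to (∈-ext s x) p)))
      (λ {x} p → from (∈-ext s x) (subst (ι x Subset.∈_) (sym e) (to (∈-ext s′ x) p)))

    ext-⁅⁆ : ∀ x → ext ⁅ x ⁆ ≡ ⁅ ι x ⁆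
    ext-⁅⁆ x = Subset.⊆-antisym
      (λ y∈ → case image ⁅ x ⁆ y∈ of λ
        { (z , refl) → case Subset.x∈⁅y⁆⇒x≡y x (from (∈-ext ⁅ x ⁆ z) y∈) of λ { refl → Subset.x∈⁅x⁆ (ι x) } })
      (λ y∈ → case Subset.x∈⁅y⁆⇒x≡y (ι x) y∈ of λ { refl → to (∈-ext ⁅ x ⁆ x) (Subset.x∈⁅x⁆ x) })

    ext-nonempty : ∀ {s} → Nonempty s ⇔ Nonempty (ext s)
    ext-nonempty {s} = mk⇔ (λ (x , p) → ι x , to (∈-ext s x) p)
      (λ (y , p) → case image s p of λ { (x , refl) → x , from (∈-ext s x) p })

    ext-⊆ : ∀ {s s′} → s Subset.⊆ s′ ⇔ ext s Subset.⊆ ext s′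
    ext-⊆ {s} {s′} = mk⇔ f g
      where
      f : s Subset.⊆ s′ → ext s Subset.⊆ ext s′
      f p q with image s q
      ... | x , refl = to (∈-ext s′ x) (p (from (∈-ext s x) q))
      g : ext s Subset.⊆ ext s′ → s Subset.⊆ s′
      g p {x} q = from (∈-ext s′ x) (p (to (∈-ext s x) q))

    ext-comparable : ∀ {s s′} → (s Subset.⊆ s′ ⊎ s′ Subset.⊆ s) ⇔ (ext s Subset.⊆ ext s′ ⊎ ext s′ Subset.⊆ ext s)
    ext-comparable {s} {s′} = mk⇔ f g
      where
      f : s Subset.⊆ s′ ⊎ s′ Subset.⊆ s → ext s Subset.⊆ ext s′ ⊎ ext s′ Subset.⊆ ext s
      f (inj₁ p) = inj₁ (to ext-⊆ p)
      f (inj₂ p) = inj₂ (to ext-⊆ p)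
      g : ext s Subset.⊆ ext s′ ⊎ ext s′ Subset.⊆ ext s → s Subset.⊆ s′ ⊎ s′ Subset.⊆ s
      g (inj₁ p) = inj₁ (from ext-⊆ p)
      g (inj₂ p) = inj₂ (from ext-⊆ p)

    ext-∩ : ∀ {s s′} → Nonempty (s ∩ s′) ⇔ Nonempty (ext s ∩ ext s′)
    ext-∩ {s} {s′} = mk⇔
      (λ (x , p) → case Subset.x∈p∩q⁻ s s′ p of λ
        { (a , b) → ι x , Subset.x∈p∩q⁺ (to (∈-ext s x) a , to (∈-ext s′ x) b) })
      (λ (y , p) → case Subset.x∈p∩q⁻ (ext s) (ext s′) p of λ
        { (a , b) → case image s a of λ
          { (x , refl) → x , Subset.x∈p∩q⁺ (from (∈-ext s x) a , from (∈-ext s′ x) b) } })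

  Interval : ∀ {d} → Subset d → Set
  Interval {d} I = Σ[ i ∈ Fin d ] Σ[ j ∈ Fin d ] i Fin.≤ j × (∀ m → m Subset.∈ I ⇔ (i Fin.≤ m × m Fin.≤ j))

  interval-⊤ : ∀ {d} → Fin d → Interval {d} ⊤
  interval-⊤ {suc d} _ = zero , Fin.fromℕ d , z≤n , λ m → mk⇔ (λ _ → z≤n , Fin.≤fromℕ m) (λ _ → Subset.∈⊤)

  module _ {m d} {ι : Fin m → Fin d} {ext : Subset m → Subset d} (E : Segment ι ext) where

    open Segment E

    ext-interval : ∀ {s} → Interval s → Interval (ext s)
    ext-interval {s} (i , j , i≤j , e) = ι i , ι j , to (ι-≤ i j) i≤j , λ y → mk⇔
      (λ p → case image s p of λ { (x , refl) → case to (e x) (from (∈-ext s x) p) of λ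
        { (a , b) → to (ι-≤ i x) a , to (ι-≤ x j) b } })
      (λ (a , b) → case convex a b of λ { (x , refl) →
        to (∈-ext s x) (from (e x) (from (ι-≤ i x) a , from (ι-≤ x j) b)) })

    ext-interval⁻¹ : ∀ {s} → Interval (ext s) → Interval s
    ext-interval⁻¹ {s} (i , j , i≤j , e)
      with image s (from (e i) (ℕ.≤-refl , i≤j)) | image s (from (e j) (i≤j , ℕ.≤-refl))
    ... | i′ , refl | j′ , refl = i′ , j′ , from (ι-≤ i′ j′) i≤j , λ x → mk⇔
      (λ p → case to (e (ι x)) (to (∈-ext s x) p) of λ { (a , b) → from (ι-≤ i′ x) a , from (ι-≤ x j′) b })
      (λ (a , b) → from (∈-ext s x) (from (e (ι x)) (to (ι-≤ i′ x) a , to (ι-≤ x j′) b)))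

    building-restrict : ∀ {B B′} → (∀ {s} → s ∈ B′ → ext s ∈ B) → (∀ {s} → Nonempty s → ext s ∈ B → s ∈ B′) →
                        IsBinaryBuildingSet B → IsBinaryBuildingSet B′
    building-restrict f g b = record
      { nonempty   = λ s∈ → from ext-nonempty (nonempty (f s∈))
      ; interval   = λ s∈ → ext-interval⁻¹ (interval (f s∈))
      ; singletons = λ i → g (i , Subset.x∈⁅x⁆ i) (subst (_∈ _) (sym (ext-⁅⁆ i)) (singletons (ι i)))
      ; laminar    = λ s∈ s′∈ ne → from ext-comparable (laminar (f s∈) (f s′∈) (to ext-∩ ne)) }
      where open IsBinaryBuildingSet b

  module _ {m n : ℕ} where

    left-segment : Segment {m} {m ℕ.+ n} (_↑ˡ n) (extˡ {m} {n})
    left-segment = record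
      { ∈-ext  = λ s → ∈-++ˡ s ⊥
      ; image  = λ s {y} → by-sides (λ y → y Subset.∈ extˡ {m} {n} s → ∃[ x ] y ≡ x ↑ˡ n) (λ i _ → i , refl)
                   (λ j p → contradiction (from (∈-++ʳ s ⊥ j) p) Subset.∉⊥) y
      ; ι-≤    = λ x x′ → mk⇔ (subst₂ ℕ._≤_ (sym (Fin.toℕ-↑ˡ x n)) (sym (Fin.toℕ-↑ˡ x′ n)))
                              (subst₂ ℕ._≤_ (Fin.toℕ-↑ˡ x n) (Fin.toℕ-↑ˡ x′ n))
      ; convex = λ {x} {x′} {y} _ → by-sides (λ y → y Fin.≤ (x′ ↑ˡ n) → ∃[ z ] y ≡ z ↑ˡ n) (λ i _ → i , refl)
                   (λ j p → contradiction (↑ˡ<↑ʳ x′ j) (ℕ.≤⇒≯ p)) y }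

    right-segment : Segment {n} {m ℕ.+ n} (m ↑ʳ_) (extʳ {m} {n})
    right-segment = record
      { ∈-ext  = λ s → ∈-++ʳ ⊥ s
      ; image  = λ s {y} → by-sides (λ y → y Subset.∈ extʳ {m} {n} s → ∃[ x ] y ≡ m ↑ʳ x)
                   (λ i p → contradiction (from (∈-++ˡ ⊥ s i) p) Subset.∉⊥) (λ j _ → j , refl) y
      ; ι-≤    = λ x x′ → mk⇔
                   (λ p → subst₂ ℕ._≤_ (sym (Fin.toℕ-↑ʳ m x)) (sym (Fin.toℕ-↑ʳ m x′)) (ℕ.+-monoʳ-≤ m p))
                   (λ p → ℕ.+-cancelˡ-≤ m _ _ (subst₂ ℕ._≤_ (Fin.toℕ-↑ʳ m x) (Fin.toℕ-↑ʳ m x′) p))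
      ; convex = λ {x} {x′} {y} p _ → by-sides (λ y → (m ↑ʳ x) Fin.≤ y → ∃[ z ] y ≡ m ↑ʳ z)
                   (λ i p → contradiction (↑ˡ<↑ʳ i x) (ℕ.≤⇒≯ p)) (λ j _ → j , refl) y p }

    sides-disjoint : ∀ {s r y} → y Subset.∈ extˡ {m} {n} s → ¬ y Subset.∈ extʳ {m} {n} r
    sides-disjoint {s} {r} p q with Segment.image left-segment s p | Segment.image right-segment r q
    ... | i , refl | j , e = ℕ.<-irrefl (cong toℕ e) (↑ˡ<↑ʳ i j)

    extˡ≢⊤ : Fin n → ∀ {s} → extˡ {m} {n} s ≢ ⊤
    extˡ≢⊤ j {s} e = Subset.∉⊥ (from (∈-++ʳ s ⊥ j) (subst ((m ↑ʳ j) Subset.∈_) (sym e) Subset.∈⊤))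

    extʳ≢⊤ : Fin m → ∀ {r} → extʳ {m} {n} r ≢ ⊤
    extʳ≢⊤ i {r} e = Subset.∉⊥ (from (∈-++ˡ ⊥ r i) (subst ((i ↑ˡ n) Subset.∈_) (sym e) Subset.∈⊤))

    extˡ≢extʳ : ∀ {s r} → Nonempty s → extˡ {m} {n} s ≢ extʳ {m} {n} r
    extˡ≢extʳ {s} {r} (x , p) e =
      sides-disjoint {s} {r} (to (Segment.∈-ext left-segment s x) p)
        (subst ((x ↑ˡ n) Subset.∈_) e (to (Segment.∈-ext left-segment s x) p))

    data Side : Subset (m ℕ.+ n) → Set where
      whole : Side ⊤
      left  : ∀ s → Side (extˡ {m} {n} s)
      right : ∀ r → Side (extʳ {m} {n} r)

    in-left : ∀ I → (∀ j → ¬ (m ↑ʳ j) Subset.∈ I) → Side I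
    in-left I h with Vec.splitAt m I
    ... | s , r , refl = subst (λ r → Side (s Vec.++ r)) (sym (Subset.Empty-unique λ (j , p) → h j (to (∈-++ʳ s r j) p))) (left s)

    in-right : ∀ I → (∀ i → ¬ (i ↑ˡ n) Subset.∈ I) → Side I
    in-right I h with Vec.splitAt m I
    ... | s , r , refl = subst (λ s → Side (s Vec.++ r)) (sym (Subset.Empty-unique λ (i , p) → h i (to (∈-++ˡ s r i) p))) (right r)

    -- Weighted sets sorted into the whole of [m + n], at most once, and those
    -- to the left and to the right of the cut at m.
    data Split {a} {A : Set a} : List (Subset (m ℕ.+ n) × A) → Maybe A → List (Subset m × A) → List (Subset n × A) → Set a where
      []    : Split [] nothing [] []
      whole : ∀ {L L₁ L₂ y} → Split L nothing L₁ L₂ → Split ((⊤ , y) ∷ L) (just y) L₁ L₂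
      left  : ∀ {L w L₁ L₂} s {y} → Split L w L₁ L₂ → Split ((extˡ {m} {n} s , y) ∷ L) w ((s , y) ∷ L₁) L₂
      right : ∀ {L w L₁ L₂} r {y} → Split L w L₁ L₂ → Split ((extʳ {m} {n} r , y) ∷ L) w L₁ ((r , y) ∷ L₂)

    module _ {a} {A : Set a} where

      split-whole : ∀ {L y L₁ L₂} → Split {A = A} L (just y) L₁ L₂ → ⊤ ∈ sets L
      split-whole (whole S)   = here refl
      split-whole (left s S)  = there (split-whole S)
      split-whole (right r S) = there (split-whole S)

      split : ∀ {L : List (Subset (m ℕ.+ n) × A)} → All Side (sets L) → Unique (sets L) →
              ∃[ w ] ∃[ L₁ ] ∃[ L₂ ] Split {A = A} L w L₁ L₂
      split {[]}    []       []       = nothing , [] , [] , []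
      split {_ ∷ L} (σ ∷ σs) (u ∷ us) with split {L} σs us
      split {_ ∷ L} (left s ∷ σs)  (u ∷ us) | _ , _ , _ , S = _ , _ , _ , left s S
      split {_ ∷ L} (right r ∷ σs) (u ∷ us) | _ , _ , _ , S = _ , _ , _ , right r S
      split {_ ∷ L} (whole ∷ σs)   (u ∷ us) | nothing , _ , _ , S = _ , _ , _ , whole S
      split {_ ∷ L} (whole ∷ σs)   (u ∷ us) | just y , _ , _ , S = contradiction refl (All.lookup u (split-whole S))

      split-∈ˡ : ∀ {L w L₁ L₂} → Split {A = A} L w L₁ L₂ → ∀ {s} → s ∈ sets L₁ → extˡ {m} {n} s ∈ sets L
      split-∈ˡ (whole S)   s∈          = there (split-∈ˡ S s∈)
      split-∈ˡ (left s S)  (here refl) = here refl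
      split-∈ˡ (left s S)  (there s∈)  = there (split-∈ˡ S s∈)
      split-∈ˡ (right r S) s∈          = there (split-∈ˡ S s∈)

      split-∈ʳ : ∀ {L w L₁ L₂} → Split {A = A} L w L₁ L₂ → ∀ {s} → s ∈ sets L₂ → extʳ {m} {n} s ∈ sets L
      split-∈ʳ (whole S)   s∈          = there (split-∈ʳ S s∈)
      split-∈ʳ (left s S)  s∈          = there (split-∈ʳ S s∈)
      split-∈ʳ (right r S) (here refl) = here refl
      split-∈ʳ (right r S) (there s∈)  = there (split-∈ʳ S s∈)

      -- The empty set extends to the same set from either side and might be filed on the other one,
      -- so `s` has to be nonempty. The point of `Fin n` keeps the extension apart from the whole
      -- set.
      split-∈ˡ⁻¹ : Fin n → ∀ {L w L₁ L₂} → Split {A = A} L w L₁ L₂ → ∀ {s} → Nonempty s → extˡ {m} {n} s ∈ sets L → s ∈ sets L₁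
      split-∈ˡ⁻¹ j (whole S)   ne (here e)   = contradiction e (extˡ≢⊤ j)
      split-∈ˡ⁻¹ j (whole S)   ne (there s∈) = split-∈ˡ⁻¹ j S ne s∈
      split-∈ˡ⁻¹ j (left s S)  ne (here e)   = here (Segment.ext-injective left-segment e)
      split-∈ˡ⁻¹ j (left s S)  ne (there s∈) = there (split-∈ˡ⁻¹ j S ne s∈)
      split-∈ˡ⁻¹ j (right r S) ne (here e)   = contradiction e (extˡ≢extʳ ne)
      split-∈ˡ⁻¹ j (right r S) ne (there s∈) = split-∈ˡ⁻¹ j S ne s∈

      extʳ≢extˡ : ∀ {s : Subset m} {r : Subset n} → Nonempty r → extʳ {m} r ≢ extˡ {m} {n} s
      extʳ≢extˡ {s} {r} (x , p) e = sides-disjoint {s} {r}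
        (subst ((m ↑ʳ x) Subset.∈_) e (to (Segment.∈-ext right-segment r x) p))
        (to (Segment.∈-ext right-segment r x) p)

      split-∈ʳ⁻¹ : Fin m → ∀ {L w L₁ L₂} → Split {A = A} L w L₁ L₂ → ∀ {s} → Nonempty s → extʳ {m} {n} s ∈ sets L → s ∈ sets L₂
      split-∈ʳ⁻¹ j (whole S)   ne (here e)   = contradiction e (extʳ≢⊤ j)
      split-∈ʳ⁻¹ j (whole S)   ne (there s∈) = split-∈ʳ⁻¹ j S ne s∈
      split-∈ʳ⁻¹ j (left s S)  ne (here e)   = contradiction e (extʳ≢extˡ ne)
      split-∈ʳ⁻¹ j (left s S)  ne (there s∈) = split-∈ʳ⁻¹ j S ne s∈
      split-∈ʳ⁻¹ j (right r S) ne (here e)   = here (Segment.ext-injective right-segment e)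
      split-∈ʳ⁻¹ j (right r S) ne (there s∈) = there (split-∈ʳ⁻¹ j S ne s∈)

      split-unique : ∀ {L w L₁ L₂} → Split {A = A} L w L₁ L₂ → Unique (sets L) → Unique (sets L₁) × Unique (sets L₂)
      split-unique []          []       = [] , []
      split-unique (whole S)   (_ ∷ us) = split-unique S us
      split-unique (left s S)  (u ∷ us) with split-unique S us
      ... | u₁ , u₂ = All.tabulate (λ { x∈ refl → All.lookup u (split-∈ˡ S x∈) refl }) ∷ u₁ , u₂
      split-unique (right r S) (u ∷ us) with split-unique S us
      ... | u₁ , u₂ = u₁ , All.tabulate (λ { x∈ refl → All.lookup u (split-∈ʳ S x∈) refl }) ∷ u₂

      split-all : ∀ {p} {P : Pred A p} {L w L₁ L₂} → Split {A = A} L w L₁ L₂ → All (P ∘ proj₂) L →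
                  (∀ {y} → w ≡ just y → P y) × All (P ∘ proj₂) L₁ × All (P ∘ proj₂) L₂
      split-all []          []       = (λ ()) , [] , []
      split-all (whole S)   (p ∷ ps) with split-all S ps
      ... | _ , p₁ , p₂ = (λ { refl → p }) , p₁ , p₂
      split-all (left s S)  (p ∷ ps) with split-all S ps
      ... | pw , p₁ , p₂ = pw , p ∷ p₁ , p₂
      split-all (right r S) (p ∷ ps) with split-all S ps
      ... | pw , p₁ , p₂ = pw , p₁ , p ∷ p₂

      split-building : Fin m → Fin n → ∀ {L w L₁ L₂} → Split {A = A} L w L₁ L₂ → IsBinaryBuildingSet (sets L) →
                       IsBinaryBuildingSet (sets L₁) × IsBinaryBuildingSet (sets L₂)
      split-building i j S b = building-restrict left-segment (split-∈ˡ S) (split-∈ˡ⁻¹ j S) b ,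
                               building-restrict right-segment (split-∈ʳ S) (split-∈ʳ⁻¹ i S) b

    module _ {a} {A : Set a} where

      split-cases : ∀ {L w L₁ L₂} → Split {A = A} L w L₁ L₂ → ∀ {I} → I ∈ sets L →
                    I ≡ ⊤ ⊎ (∃[ s ] s ∈ sets L₁ × I ≡ extˡ {m} {n} s) ⊎ (∃[ r ] r ∈ sets L₂ × I ≡ extʳ {m} {n} r)
      split-cases (whole S)   (here e) = inj₁ e
      split-cases (left s S)  (here e) = inj₂ (inj₁ (s , here refl , e))
      split-cases (right r S) (here e) = inj₂ (inj₂ (r , here refl , e))
      split-cases (whole S)   (there I∈) = split-cases S I∈
      split-cases (left _ S)  (there I∈) with split-cases S I∈
      ... | inj₁ e                     = inj₁ e
      ... | inj₂ (inj₁ (s , s∈ , e))   = inj₂ (inj₁ (s , there s∈ , e))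
      ... | inj₂ (inj₂ x)              = inj₂ (inj₂ x)
      split-cases (right _ S) (there I∈) with split-cases S I∈
      ... | inj₁ e                     = inj₁ e
      ... | inj₂ (inj₁ x)              = inj₂ (inj₁ x)
      ... | inj₂ (inj₂ (r , r∈ , e))   = inj₂ (inj₂ (r , there r∈ , e))

      split-nothing : ∀ {L L₁ L₂} → Fin m → Fin n → Split {A = A} L nothing L₁ L₂ → ⊤ ∉ sets L
      split-nothing i j (left s S)  (here e)   = extˡ≢⊤ j (sym e)
      split-nothing i j (left s S)  (there ⊤∈) = split-nothing i j S ⊤∈
      split-nothing i j (right r S) (here e)   = extʳ≢⊤ i (sym e)
      split-nothing i j (right r S) (there ⊤∈) = split-nothing i j S ⊤∈

      split-unique⁻¹ : Fin m → Fin n → ∀ {L w L₁ L₂} → Split {A = A} L w L₁ L₂ →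
        All Nonempty (sets L₁) → All Nonempty (sets L₂) → Unique (sets L₁) → Unique (sets L₂) → Unique (sets L)
      split-unique⁻¹ i j []          _ _ _ _ = []
      split-unique⁻¹ i j (whole S)   p q u v =
        All.tabulate (λ { I∈ refl → split-nothing i j S I∈ }) ∷ split-unique⁻¹ i j S p q u v
      split-unique⁻¹ i j (left s S)  (ne ∷ p) q (x ∷ u) v =
        All.tabulate (λ { I∈ refl → All.lookup x (split-∈ˡ⁻¹ j S ne I∈) refl }) ∷ split-unique⁻¹ i j S p q u v
      split-unique⁻¹ i j (right r S) p (ne ∷ q) u (x ∷ v) =
        All.tabulate (λ { I∈ refl → All.lookup x (split-∈ʳ⁻¹ i S ne I∈) refl }) ∷ split-unique⁻¹ i j S p q u v

      split-building⁻¹ : Fin m → Fin n → ∀ {L w L₁ L₂} → Split {A = A} L w L₁ L₂ →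
        IsBinaryBuildingSet (sets L₁) → IsBinaryBuildingSet (sets L₂) → IsBinaryBuildingSet (sets L)
      split-building⁻¹ i j {L} {w} {L₁} {L₂} S b₁ b₂ = record
        { nonempty = full ; interval = int ; singletons = single ; laminar = lam }
        where
        module B₁ = IsBinaryBuildingSet b₁
        module B₂ = IsBinaryBuildingSet b₂
        full : ∀ {I} → I ∈ sets L → Nonempty I
        full I∈ with split-cases S I∈
        ... | inj₁ refl                   = i ↑ˡ n , Subset.∈⊤
        ... | inj₂ (inj₁ (s , s∈ , refl)) = to (Segment.ext-nonempty left-segment) (B₁.nonempty s∈)
        ... | inj₂ (inj₂ (r , r∈ , refl)) = to (Segment.ext-nonempty right-segment) (B₂.nonempty r∈)
        int : ∀ {I} → I ∈ sets L → Interval I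
        int I∈ with split-cases S I∈
        ... | inj₁ refl                   = interval-⊤ (i ↑ˡ n)
        ... | inj₂ (inj₁ (s , s∈ , refl)) = ext-interval left-segment (B₁.interval s∈)
        ... | inj₂ (inj₂ (r , r∈ , refl)) = ext-interval right-segment (B₂.interval r∈)
        single : ∀ k → ⁅ k ⁆ ∈ sets L
        single = by-sides (λ k → ⁅ k ⁆ ∈ sets L)
          (λ i → subst (_∈ sets L) (Segment.ext-⁅⁆ left-segment i) (split-∈ˡ S (B₁.singletons i)))
          (λ j → subst (_∈ sets L) (Segment.ext-⁅⁆ right-segment j) (split-∈ʳ S (B₂.singletons j)))
        lam : ∀ {I J} → I ∈ sets L → J ∈ sets L → Nonempty (I ∩ J) → I Subset.⊆ J ⊎ J Subset.⊆ I
        lam I∈ J∈ meet with split-cases S I∈ | split-cases S J∈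
        ... | inj₁ refl | _ = inj₂ Subset.⊆⊤
        ... | inj₂ _ | inj₁ refl = inj₁ Subset.⊆⊤
        ... | inj₂ (inj₁ (s , s∈ , refl)) | inj₂ (inj₁ (s′ , s′∈ , refl)) =
          to (Segment.ext-comparable left-segment) (B₁.laminar s∈ s′∈ (from (Segment.ext-∩ left-segment) meet))
        ... | inj₂ (inj₂ (r , r∈ , refl)) | inj₂ (inj₂ (r′ , r′∈ , refl)) =
          to (Segment.ext-comparable right-segment) (B₂.laminar r∈ r′∈ (from (Segment.ext-∩ right-segment) meet))
        ... | inj₂ (inj₁ (s , _ , refl)) | inj₂ (inj₂ (r , _ , refl)) =
          contradiction (Subset.x∈p∩q⁻ (extˡ {m} {n} s) (extʳ {m} {n} r) (proj₂ meet)) (λ (p , q) → sides-disjoint {s = s} {r} p q)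
        ... | inj₂ (inj₂ (r , _ , refl)) | inj₂ (inj₁ (s , _ , refl)) =
          contradiction (Subset.x∈p∩q⁻ (extʳ {m} {n} r) (extˡ {m} {n} s) (proj₂ meet)) (λ (p , q) → sides-disjoint {s = s} {r} q p)

  -- A last point where `Q` holds before it fails. The size is an index so that matching turns it
  -- into a sum of two positive numbers, ready to be cut.
  data Boundary : ∀ {d} → Pred (Fin d) 0ℓ → Set₁ where
    boundary : ∀ m n {Q : Pred (Fin (suc m ℕ.+ suc n)) 0ℓ} →
               Q (Fin.fromℕ m ↑ˡ suc n) → ¬ Q (suc m ↑ʳ zero) → Boundary Q

  find-boundary : ∀ d (Q : Pred (Fin (suc d)) 0ℓ) → Decidable Q → Q zero → ¬ Q (Fin.fromℕ d) → Boundary Q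
  find-boundary zero    Q Q? q₀ ¬q = contradiction q₀ ¬q
  find-boundary (suc d) Q Q? q₀ ¬q with Q? (suc zero)
  ... | no ¬q₁ = boundary 0 d q₀ ¬q₁
  ... | yes q₁ with find-boundary d (Q ∘ suc) (Q? ∘ suc) q₁ ¬q
  ... | boundary m n p ¬p = boundary (suc m) n p ¬p

  private
    interval-between : ∀ {d} {I : Subset d} → Interval I → ∀ {x y z} → x Subset.∈ I → z Subset.∈ I →
                       x Fin.≤ y → y Fin.≤ z → y Subset.∈ I
    interval-between (i , j , _ , e) x∈ z∈ x≤y y≤z =
      from (e _) (ℕ.≤-trans (proj₁ (to (e _) x∈)) x≤y , ℕ.≤-trans y≤z (proj₂ (to (e _) z∈)))

  data Cut : ∀ {d} → List (Subset d) → Set where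
    cut : ∀ m n {B : List (Subset (suc m ℕ.+ suc n))} → All (Side {suc m} {suc n}) B → Cut B

  module _ {d} (first last : Fin d) (B : List (Subset d)) where

    -- The members of a building set that contain `first` but not `last` form a chain by laminarity,
    -- so this union is the largest of them. As a union it can be decided point by point without
    -- choosing that member.
    Reached : Pred (Fin d) 0ℓ
    Reached i = Any.Any (λ J → first Subset.∈ J × i Subset.∈ J × ¬ last Subset.∈ J) B

    reached? : Decidable Reached
    reached? i = Any.any? (λ J → (first Subset.∈? J) ×-dec (i Subset.∈? J) ×-dec ¬? (last Subset.∈? J)) B

  -- The cut falls right after the largest member that contains the first point
  -- but not the last.
  boundary-cut : ∀ {d} {first last : Fin d} {B} → IsBinaryBuildingSet B →
    (∀ (x : Fin d) → first Fin.≤ x) → (∀ (x : Fin d) → x Fin.≤ last) → Boundary (Reached first last B) → Cut B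
  boundary-cut {first = first} {last} {B} b first≤ ≤last (boundary m n reached unreached) =
    cut m n (All.tabulate side)
    where
    open IsBinaryBuildingSet b
    i₀ = Fin.fromℕ m ↑ˡ suc n
    i₁ = suc m ↑ʳ zero {n = n}
    ≤i₀ : ∀ i → (i ↑ˡ suc n) Fin.≤ i₀
    ≤i₀ i = subst₂ ℕ._≤_ (sym (Fin.toℕ-↑ˡ i (suc n))) (sym (trans (Fin.toℕ-↑ˡ (Fin.fromℕ m) (suc n)) (Fin.toℕ-fromℕ m))) (ℕ.s≤s⁻¹ (Fin.toℕ<n i))
    i₁≤ : ∀ j → i₁ Fin.≤ (suc m ↑ʳ j)
    i₁≤ j = subst₂ ℕ._≤_ (sym (Fin.toℕ-↑ʳ (suc m) zero)) (sym (Fin.toℕ-↑ʳ (suc m) j)) (ℕ.+-monoʳ-≤ (suc m) z≤n)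
    not-past : ∀ {I} → I ∈ B → first Subset.∈ I → ¬ last Subset.∈ I → ∀ j → ¬ (suc m ↑ʳ j) Subset.∈ I
    not-past I∈ f∈ l∉ j j∈ = unreached (lose I∈ (f∈ , interval-between (interval I∈) f∈ j∈ (first≤ _) (i₁≤ j) , l∉))
    side : ∀ {I} → I ∈ B → Side {suc m} {suc n} I
    side {I} I∈ with first Subset.∈? I | last Subset.∈? I
    ... | yes f∈ | yes l∈ = subst Side
      (Subset.⊆-antisym (λ _ → interval-between (interval I∈) f∈ l∈ (first≤ _) (≤last _)) Subset.⊆⊤) whole
    ... | yes f∈ | no l∉ = in-left I (not-past I∈ f∈ l∉)
    -- `J` contains every point left of the cut and none to the right of it. A member without the
    -- first point is either inside `J`, hence on the left, or disjoint from `J`, hence on the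
    -- right.
    side {I} I∈ | no f∉ | _ with find reached
    ... | J , J∈ , fJ , iJ , lJ with Subset.nonempty? (I ∩ J)
    ... | yes ne = case laminar I∈ J∈ ne of λ
      { (inj₁ I⊆J) → in-left I (λ j j∈ → not-past J∈ fJ lJ j (I⊆J j∈))
      ; (inj₂ J⊆I) → contradiction (J⊆I fJ) f∉ }
    ... | no ¬ne = in-right I λ i i∈ → ¬ne (_ , Subset.x∈p∩q⁺
        (i∈ , interval-between (interval J∈) fJ iJ (first≤ _) (≤i₀ i)))

  building-cut : ∀ {d} {B : List (Subset (suc (suc d)))} → IsBinaryBuildingSet B → Cut B
  building-cut {d} {B} b = boundary-cut b (λ _ → z≤n) Fin.≤fromℕ
    (find-boundary (suc d) (Reached first last B) (reached? first last B)
      -- With at least two points, the singleton of the first one misses the last.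
      (lose (singletons zero) (Subset.x∈⁅x⁆ zero , Subset.x∈⁅x⁆ zero , λ p → case Subset.x∈⁅y⁆⇒x≡y zero p of λ ()))
      (λ q → case find q of λ { (_ , _ , _ , p , ¬p) → ¬p p }))
    where
    open IsBinaryBuildingSet b
    first last : Fin (suc (suc d))
    first = zero
    last  = Fin.fromℕ (suc d)

  -- A witness that trees have leaves, hence that both sides of the cut at a node are nonempty.
  tree-point : ∀ {a} {A : Set a} {d} → Tree A d → Fin d
  tree-point (leaf _)              = zero
  tree-point (node {n = n} l r _) = tree-point l ↑ˡ n

  split-sides : ∀ {a} {A : Set a} {m n} (L : List (Subset m × A)) (R : List (Subset n × A)) →
    Split (map (λ (s , w) → extˡ {m} {n} s , w) L ++ map (λ (s , w) → extʳ {m} {n} s , w) R) nothing L R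
  split-sides []            []            = []
  split-sides []            ((r , _) ∷ R) = right r (split-sides [] R)
  split-sides ((s , _) ∷ L) R             = left s (split-sides L R)

  module _ {a z} {A : Set a} {Z : Pred A z} (Z? : Decidable Z) where

    -- `Z` will be the vanishing of a weight. Coefficients of a nestohedron are positive, so a node
    -- of weight 0 contributes no block, whereas a leaf always contributes its singleton.
    wholeBlock : ∀ {d} → A → List (Subset d × A)
    wholeBlock y with Z? y
    ... | yes _ = []
    ... | no _  = [ ⊤ , y ]

    blocks : ∀ {d} → Tree A d → List (Subset d × A)
    blocks (leaf y)     = [ ⊤ , y ]
    blocks (node {m} {n} l r y) = wholeBlock y ++
      (map (λ (s , w) → extˡ {m} {n} s , w) (blocks l) ++ map (λ (s , w) → extʳ {m} {n} s , w) (blocks r))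

    wholeWeight : A → Maybe A
    wholeWeight y with Z? y
    ... | yes _ = nothing
    ... | no _  = just y

    blocks-split : ∀ {m n} (l : Tree A m) (r : Tree A n) y →
                   Split (blocks (node l r y)) (wholeWeight y) (blocks l) (blocks r)
    blocks-split l r y with Z? y
    ... | yes _ = split-sides (blocks l) (blocks r)
    ... | no _  = whole (split-sides (blocks l) (blocks r))

    blocks-building : ∀ {d} (t : Tree A d) → IsBinaryBuildingSet (sets (blocks t)) × Unique (sets (blocks t))
    blocks-building (leaf y) = record
      { nonempty   = λ { (here refl) → zero , Subset.∈⊤ }
      ; interval   = λ { (here refl) → interval-⊤ zero }
      ; singletons = λ { zero → here refl }
      ; laminar    = λ { (here refl) (here refl) _ → inj₁ Subset.⊆⊤ } } , [] ∷ []
    blocks-building (node l r y) with blocks-building l | blocks-building r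
    ... | b₁ , u₁ | b₂ , u₂ = split-building⁻¹ (tree-point l) (tree-point r) (blocks-split l r y) b₁ b₂ ,
      split-unique⁻¹ (tree-point l) (tree-point r) (blocks-split l r y)
        (All.tabulate (IsBinaryBuildingSet.nonempty b₁)) (All.tabulate (IsBinaryBuildingSet.nonempty b₂)) u₁ u₂

-- Binary nestohedra as polytopes of trees with real weights

module BinaryNestohedra where

  open import Data.Vec.Functional using (_++_)
  open Words using (Tree; leaf; node; Leaves)
  open Polytopes
  open BuildingSets

  module Nestohedra {c ℓ₁ ℓ₂} (R : RealNumbers c ℓ₁ ℓ₂) where

    open Real R

    e-≡ : ∀ {d} (i : Fin d) → e i i ≡ 1#
    e-≡ i rewrite dec-true (i Fin.≟ i) ≡.refl = ≡.refl

    e-≢ : ∀ {d} {i j : Fin d} → i ≢ j → e i j ≡ 0#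
    e-≢ {i = i} {j} i≢j rewrite dec-false (i Fin.≟ j) i≢j = ≡.refl

    0≤e : ∀ {d} (i j : Fin d) → 0# ≤ e i j
    0≤e i j with does (i Fin.≟ j)
    ... | true  = 0≤1
    ... | false = ≤.refl

    sum-e : ∀ {d} (i : Fin d) → sum (e i) ≈ 1#
    sum-e i = trans (sum-single (e i) i λ j j≢i → reflexive (e-≢ (j≢i ∘ ≡.sym))) (reflexive (e-≡ i))

    -- Membership in the simplex y Δ_I, in coordinates.
    Flow : ∀ {d} → Subset d → Carrier → Pred (ℝ^ d) (ℓ₁ ⊔ ℓ₂)
    Flow I y u = (∀ i → 0# ≤ u i) × (∀ i → ¬ i Subset.∈ I → u i ≈ 0#) × sum u ≈ y

    flow-resp : ∀ {d} {I : Subset d} {y y′ u u′} → y ≈ y′ → u ≋ u′ → Flow I y u → Flow I y′ u′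
    flow-resp e f (p , q , s) = (λ i → ≤.≤-respʳ-≈ (f i) (p i)) , (λ i i∉ → trans (sym (f i)) (q i i∉)) ,
      trans (sum-cong-≋ (≋-sym f)) (trans s e)

    flow-⊕ : ∀ {d} {I : Subset d} {y y′ u u′} → Flow I y u → Flow I y′ u′ → Flow I (y + y′) (u ⊕ u′)
    flow-⊕ {u = u} {u′} (p , q , s) (p′ , q′ , s′) = (λ i → 0≤+ (p i) (p′ i)) ,
      (λ i i∉ → trans (+-cong (q i i∉) (q′ i i∉)) (+-identityˡ 0#)) , trans (∑-distrib-+ u u′) (+-cong s s′)

    flow-· : ∀ {d} {I : Subset d} {w y u} → 0# ≤ w → Flow I y u → Flow I (w * y) (w ·ᵛ u)
    flow-· {w = w} {u = u} 0≤w (p , q , s) = (λ i → *-nonneg w (u i) 0≤w (p i)) ,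
      (λ i i∉ → trans (*-congˡ (q i i∉)) (zeroʳ w)) , trans (sym (*-distribˡ-sum w u)) (*-congˡ s)

    hull⇒flow : ∀ {d} {I : Subset d} {σ x} → Hull (λ x → ∃[ i ] i Subset.∈ I × x ≋ e i) σ x → Flow I σ x
    hull⇒flow {d} (nil s f) = flow-resp (sym s) (≋-sym f)
      ((λ _ → ≤.refl) , (λ _ _ → refl) , sum-zero {d} {𝟎} λ _ → refl)
    hull⇒flow {I = I} (cons {w} {p} 0≤w (i , i∈ , p≋) h s f) = flow-resp (sym s) (≋-sym f)
      (flow-⊕ (flow-resp (*-identityʳ w) ≋-refl (flow-· 0≤w unit)) (hull⇒flow h))
      where
      unit : Flow I 1# p
      unit = flow-resp refl (≋-sym p≋) (0≤e i ,
        (λ j j∉ → reflexive (e-≢ {i = i} {j} λ { ≡.refl → j∉ i∈ })) , sum-e i)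

    simplex⇒flow : ∀ {d} {I : Subset d} {y u} → 0# < y → (y ⊙ Δ I) u → Flow I y u
    simplex⇒flow {y = y} (0≤y , _) (a , aΔ , f) =
      flow-resp (*-identityʳ y) (≋-sym f) (flow-· 0≤y (hull⇒flow (conv⇒hull aΔ)))

    flow⇒simplex : ∀ {d} {I : Subset d} {y u} → Nonempty I → 0# < y → Flow I y u → (y ⊙ Δ I) u
    flow⇒simplex {d} {I} {y} {u} (i₀ , i₀∈) (0≤y , 0≉y) (0≤u , u∉ , s) with inverse y (0≉y ∘ sym)
    ... | v , yv≈1 = v ·ᵛ u , (d , v ·ᵛ u , p , 0≤vu , total , p∈ , coordinates) ,
      λ i → sym (trans (sym (*-assoc y v (u i))) (trans (*-congʳ yv≈1) (*-identityˡ (u i))))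
      where
      vertex : ∀ {j} → Dec (j Subset.∈ I) → ℝ^ d
      vertex {j} (yes _) = e j
      -- Outside `I` the weight is 0, so any vertex of the simplex may stand in.
      vertex     (no _)  = e i₀
      p : Fin d → ℝ^ d
      p j = vertex (j Subset.∈? I)
      p∈ : ∀ j → ∃[ i ] i Subset.∈ I × p j ≋ e i
      p∈ j with j Subset.∈? I
      ... | yes j∈ = j , j∈ , ≋-refl
      ... | no _   = i₀ , i₀∈ , ≋-refl
      0≤vu : ∀ j → 0# ≤ (v ·ᵛ u) j
      0≤vu j = *-nonneg v (u j) (inverse-nonneg 0≤y yv≈1) (0≤u j)
      total : sum (v ·ᵛ u) ≈ 1#
      total = trans (sym (*-distribˡ-sum v u)) (trans (*-congˡ s) (trans (*-comm v y) yv≈1))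
      term : ∀ j i → (v ·ᵛ u) j * p j i ≈ (v ·ᵛ u) j * e j i
      term j i with j Subset.∈? I
      ... | yes _ = refl
      ... | no j∉ = trans (vanish _) (sym (vanish _))
        where
        vanish : ∀ z → (v ·ᵛ u) j * z ≈ 0#
        vanish z = trans (*-congʳ (trans (*-congˡ (u∉ j j∉)) (zeroʳ v))) (zeroˡ z)
      coordinates : ∀ i → (v ·ᵛ u) i ≈ sum λ j → (v ·ᵛ u) j * p j i
      coordinates i = sym (trans (sum-cong-≋ (λ j → term j i)) (trans
        (sum-single (λ j → (v ·ᵛ u) j * e j i) i (λ j j≢i → trans (*-congˡ (reflexive (e-≢ j≢i))) (zeroʳ _)))
        (trans (*-congˡ (reflexive (e-≡ i))) (*-identityʳ _))))

    -- The Minkowski sum taken one block at a time, so that it can be followed along a `Split`.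
    Mink : ∀ {d} → List (Subset d × Carrier) → Pred (ℝ^ d) (c ⊔ ℓ₁ ⊔ ℓ₂)
    Mink []            x = Lift (c ⊔ ℓ₂) (x ≋ 𝟎)
    Mink ((I , y) ∷ L) x = ∃[ u ] ∃[ x′ ] Flow I y u × Mink L x′ × x ≋ u ⊕ x′

    attach : ∀ {d} (B : List (Subset d)) → Vector Carrier (length B) → List (Subset d × Carrier)
    attach []      y = []
    attach (I ∷ B) y = (I , y zero) ∷ attach B (y ∘ suc)

    sets-attach : ∀ {d} (B : List (Subset d)) y → sets (attach B y) ≡ B
    sets-attach []      y = ≡.refl
    sets-attach (I ∷ B) y = ≡.cong (I ∷_) (sets-attach B (y ∘ suc))

    attach-all : ∀ {d p} {P : Pred Carrier p} (B : List (Subset d)) y → (∀ j → P (y j)) → All (P ∘ proj₂) (attach B y)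
    attach-all []      y p = []
    attach-all (I ∷ B) y p = p zero ∷ attach-all B (y ∘ suc) (p ∘ suc)

    weights : ∀ {d} (L : List (Subset d × Carrier)) → Vector Carrier (length (sets L))
    weights ((_ , y) ∷ L) zero    = y
    weights (_ ∷ L)       (suc j) = weights L j

    weights-all : ∀ {d p} {P : Pred Carrier p} {L : List (Subset d × Carrier)} → All (P ∘ proj₂) L → ∀ j → P (weights L j)
    weights-all (p ∷ ps) zero    = p
    weights-all (p ∷ ps) (suc j) = weights-all ps j

    minkowski⇔ : ∀ {d} (B : List (Subset d)) y → All Nonempty B → (∀ j → 0# < y j) → ∀ {x} →
      minkowskiSum (λ j → y j ⊙ Δ (lookup B j)) x ⇔ Mink (attach B y) x
    minkowski⇔ [] y _ _ = mk⇔ (λ (_ , _ , f) → lift f) (λ (lift f) → (λ ()) , (λ ()) , f)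
    minkowski⇔ (I ∷ B) y (ne ∷ nes) 0<y = mk⇔
      (λ (a , a∈ , f) → a zero , (λ i → sum λ j → a (suc j) i) , simplex⇒flow (0<y zero) (a∈ zero) ,
        to (minkowski⇔ B (y ∘ suc) nes (0<y ∘ suc)) (a ∘ suc , a∈ ∘ suc , ≋-refl) , f)
      (λ (u , x′ , fl , m , f) → case from (minkowski⇔ B (y ∘ suc) nes (0<y ∘ suc)) m of λ
        { (a , a∈ , g) → (λ { zero → u ; (suc j) → a j }) ,
          (λ { zero → flow⇒simplex ne (0<y zero) fl ; (suc j) → a∈ j }) ,
          λ i → trans (f i) (+-congˡ (g i)) })

    minkowski-weights : ∀ {d} (L : List (Subset d × Carrier)) → All Nonempty (sets L) → All ((0# <_) ∘ proj₂) L → ∀ {x} →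
      minkowskiSum (λ j → weights L j ⊙ Δ (lookup (sets L) j)) x ⇔ Mink L x
    minkowski-weights L ne 0<L {x} = ≡.subst (λ L′ → minkowskiSum (λ j → weights L j ⊙ Δ (lookup (sets L) j)) x ⇔ Mink L′ x)
      (attach-weights L) (minkowski⇔ (sets L) (weights L) ne (weights-all 0<L))
      where
      attach-weights : ∀ {d} (L : List (Subset d × Carrier)) → attach (sets L) (weights L) ≡ L
      attach-weights []      = ≡.refl
      attach-weights (p ∷ L) = ≡.cong (p ∷_) (attach-weights L)

    module _ {m n : ℕ} where

      ++-↑ˡ : ∀ (x : ℝ^ m) (y : ℝ^ n) i → (x ++ y) (i ↑ˡ n) ≡ x i
      ++-↑ˡ x y i rewrite Fin.splitAt-↑ˡ m i n = ≡.refl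

      ++-↑ʳ : ∀ (x : ℝ^ m) (y : ℝ^ n) j → (x ++ y) (m ↑ʳ j) ≡ y j
      ++-↑ʳ x y j rewrite Fin.splitAt-↑ʳ m n j = ≡.refl

      ++-unique : ∀ {x : ℝ^ m} {y : ℝ^ n} {z : ℝ^ (m ℕ.+ n)} →
                  (∀ i → z (i ↑ˡ n) ≈ x i) → (∀ j → z (m ↑ʳ j) ≈ y j) → z ≋ (x ++ y)
      ++-unique {x} {y} {z} p q = by-sides (λ k → z k ≈ (x ++ y) k)
        (λ i → trans (p i) (sym (reflexive (++-↑ˡ x y i)))) (λ j → trans (q j) (sym (reflexive (++-↑ʳ x y j))))

      flow-left : ∀ {s y u} → Flow (extˡ {m} {n} s) y u ⇔ (∃[ u₁ ] Flow s y u₁ × u ≋ (u₁ ++ 𝟎))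
      flow-left {s} {y} {u} = mk⇔ f g
        where
        f : Flow (extˡ {m} {n} s) y u → ∃[ u₁ ] Flow s y u₁ × u ≋ (u₁ ++ 𝟎)
        f (0≤u , u∉ , t) = u ∘ (_↑ˡ n) ,
          ((λ i → 0≤u (i ↑ˡ n)) , (λ i i∉ → u∉ _ (i∉ ∘ from (∈-++ˡ s ⊥ i))) ,
            trans (sym (trans (sum-++ (u ∘ (_↑ˡ n)) (𝟎 {n})) (trans (+-congˡ (sum-zero {n} {𝟎} λ _ → refl)) (+-identityʳ _))))
                  (trans (sum-cong-≋ (≋-sym eq)) t)) , eq
          where
          eq : u ≋ (u ∘ (_↑ˡ n) ++ 𝟎)
          eq = ++-unique (λ _ → refl) (λ j → u∉ _ (λ p → Subset.∉⊥ (from (∈-++ʳ s ⊥ j) p)))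
        g : ∃[ u₁ ] Flow s y u₁ × u ≋ (u₁ ++ 𝟎) → Flow (extˡ {m} {n} s) y u
        g (u₁ , (0≤u , u∉ , t) , eq) = flow-resp refl (≋-sym eq)
          ( by-sides (λ k → 0# ≤ (u₁ ++ 𝟎 {n}) k)
              (λ i → ≤.≤-respʳ-≈ (sym (reflexive (++-↑ˡ u₁ 𝟎 i))) (0≤u i)) (λ j → ≤.reflexive (sym (reflexive (++-↑ʳ u₁ 𝟎 j))))
          , by-sides (λ k → ¬ k Subset.∈ extˡ s → (u₁ ++ 𝟎 {n}) k ≈ 0#)
              (λ i i∉ → trans (reflexive (++-↑ˡ u₁ 𝟎 i)) (u∉ i (i∉ ∘ to (∈-++ˡ s ⊥ i)))) (λ j _ → reflexive (++-↑ʳ u₁ 𝟎 j))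
          , trans (sum-++ u₁ 𝟎) (trans (+-congˡ (sum-zero {n} {𝟎} λ _ → refl)) (trans (+-identityʳ _) t)))

      flow-right : ∀ {s y u} → Flow (extʳ {m} {n} s) y u ⇔ (∃[ u₂ ] Flow s y u₂ × u ≋ (𝟎 ++ u₂))
      flow-right {s} {y} {u} = mk⇔ f g
        where
        f : Flow (extʳ {m} {n} s) y u → ∃[ u₂ ] Flow s y u₂ × u ≋ (𝟎 ++ u₂)
        f (0≤u , u∉ , t) = u ∘ (m ↑ʳ_) ,
          ((λ i → 0≤u (m ↑ʳ i)) , (λ i i∉ → u∉ _ (i∉ ∘ from (∈-++ʳ ⊥ s i))) ,
            trans (sym (trans (sum-++ (𝟎 {m}) (u ∘ (m ↑ʳ_))) (trans (+-congʳ (sum-zero {m} {𝟎} λ _ → refl)) (+-identityˡ _))))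
                  (trans (sum-cong-≋ (≋-sym eq)) t)) , eq
          where
          eq : u ≋ (𝟎 ++ u ∘ (m ↑ʳ_))
          eq = ++-unique (λ i → u∉ _ (λ p → Subset.∉⊥ (from (∈-++ˡ ⊥ s i) p))) (λ _ → refl)
        g : ∃[ u₂ ] Flow s y u₂ × u ≋ (𝟎 ++ u₂) → Flow (extʳ {m} {n} s) y u
        g (u₂ , (0≤u , u∉ , t) , eq) = flow-resp refl (≋-sym eq)
          ( by-sides (λ k → 0# ≤ (𝟎 {m} ++ u₂) k)
              (λ i → ≤.reflexive (sym (reflexive (++-↑ˡ 𝟎 u₂ i)))) (λ j → ≤.≤-respʳ-≈ (sym (reflexive (++-↑ʳ 𝟎 u₂ j))) (0≤u j))
          , by-sides (λ k → ¬ k Subset.∈ extʳ s → (𝟎 {m} ++ u₂) k ≈ 0#)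
              (λ i _ → reflexive (++-↑ˡ 𝟎 u₂ i)) (λ j j∉ → trans (reflexive (++-↑ʳ 𝟎 u₂ j)) (u∉ j (j∉ ∘ to (∈-++ʳ ⊥ s j))))
          , trans (sum-++ (𝟎 {m}) u₂) (trans (+-congʳ (sum-zero {m} {𝟎} λ _ → refl)) (trans (+-identityˡ _) t)))

      weight : Maybe Carrier → Carrier
      weight nothing  = 0#
      weight (just y) = y

      Node : Maybe Carrier → List (Subset m × Carrier) → List (Subset n × Carrier) → Pred (ℝ^ (m ℕ.+ n)) (c ⊔ ℓ₁ ⊔ ℓ₂)
      Node w L₁ L₂ x = ∃[ x₁ ] ∃[ x₂ ] ∃[ z ] Mink L₁ x₁ × Mink L₂ x₂ ×
        (∀ i → 0# ≤ z i) × sum z ≈ weight w × x ≋ (x₁ ++ x₂) ⊕ z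

      private
        shuffle : ∀ a b c → a + (b + c) ≈ (a + b) + c
        shuffle a b c = sym (+-assoc a b c)
        zeros : ((𝟎 {m} ++ 𝟎 {n})) ≋ 𝟎
        zeros = ≋-sym (++-unique {𝟎} {𝟎} (λ _ → refl) (λ _ → refl))

      -- The blocks may be summed in any order. Those left of the cut move only the first
      -- coordinates, those right of it only the last ones, and the whole block remains as `z`,
      -- which vanishes when that block is absent.
      mink-split : ∀ {L w L₁ L₂} → Split L w L₁ L₂ → ∀ {x} → Mink L x ⇔ Node w L₁ L₂ x
      mink-split [] {x} = mk⇔
        (λ (lift f) → 𝟎 , 𝟎 , 𝟎 , lift ≋-refl , lift ≋-refl , (λ _ → ≤.refl) , sum-zero {m ℕ.+ n} {𝟎} (λ _ → refl) ,
          λ i → trans (f i) (sym (trans (+-identityʳ _) (zeros i))))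
        (λ (x₁ , x₂ , z , lift f₁ , lift f₂ , 0≤z , s , f) → lift λ i →
          trans (f i) (trans (+-cong (trans (++-cong f₁ f₂ i) (zeros i)) (sum≈0⇒≋𝟎 0≤z s i)) (+-identityˡ 0#)))
      mink-split {L₁ = L₁} {L₂} (whole {y = y} S) {x} = mk⇔ f g
        where
        f : Mink _ x → Node (just y) L₁ L₂ x
        f (u , x′ , (0≤u , _ , s) , m , e) with to (mink-split S) m
        ... | x₁ , x₂ , z , m₁ , m₂ , 0≤z , s′ , e′ = x₁ , x₂ , u , m₁ , m₂ , 0≤u , s , λ i →
          trans (e i) (trans (+-congˡ (trans (e′ i) (trans (+-congˡ (sum≈0⇒≋𝟎 0≤z s′ i)) (+-identityʳ _)))) (+-comm (u i) _))
        g : Node (just y) L₁ L₂ x → Mink _ x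
        g (x₁ , x₂ , z , m₁ , m₂ , 0≤z , s , e) = z , (x₁ ++ x₂) , (0≤z , (λ i i∉ → contradiction Subset.∈⊤ i∉) , s) ,
          from (mink-split S) (x₁ , x₂ , 𝟎 , m₁ , m₂ , (λ _ → ≤.refl) , sum-zero {m ℕ.+ n} {𝟎} (λ _ → refl) , λ i → sym (+-identityʳ _)) ,
          λ i → trans (e i) (+-comm _ (z i))
      mink-split {w = w} {(_ ∷ L₁)} {L₂} (left s {y} S) {x} = mk⇔ f g
        where
        f : Mink _ x → Node w ((s , y) ∷ L₁) L₂ x
        f (u , x′ , fl , m , e) with to flow-left fl | to (mink-split S) m
        ... | u₁ , fl₁ , e₁ | x₁ , x₂ , z , m₁ , m₂ , 0≤z , s′ , e′ =
          u₁ ⊕ x₁ , x₂ , z , (u₁ , x₁ , fl₁ , m₁ , ≋-refl) , m₂ , 0≤z , s′ , λ i →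
            trans (e i) (trans (+-cong (e₁ i) (e′ i)) (trans (shuffle _ _ (z i)) (+-congʳ
              (trans (sym (++-⊕ u₁ x₁ 𝟎 x₂ i)) (++-cong {x = u₁ ⊕ x₁} ≋-refl (λ j → +-identityˡ (x₂ j)) i)))))
        g : Node w ((s , y) ∷ L₁) L₂ x → Mink _ x
        g (x₁′ , x₂ , z , (u₁ , x₁ , fl₁ , m₁ , e₁) , m₂ , 0≤z , s′ , e) =
          (u₁ ++ 𝟎) , (x₁ ++ x₂) ⊕ z , from flow-left (u₁ , fl₁ , ≋-refl) ,
          from (mink-split S) (x₁ , x₂ , z , m₁ , m₂ , 0≤z , s′ , ≋-refl) , λ i →
            trans (e i) (trans (+-congʳ (trans (++-cong e₁ (λ j → sym (+-identityˡ (x₂ j))) i) (++-⊕ u₁ x₁ 𝟎 x₂ i))) (+-assoc _ _ _))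
      mink-split {w = w} {L₁} {(_ ∷ L₂)} (right s {y} S) {x} = mk⇔ f g
        where
        f : Mink _ x → Node w L₁ ((s , y) ∷ L₂) x
        f (u , x′ , fl , m , e) with to flow-right fl | to (mink-split S) m
        ... | u₂ , fl₂ , e₂ | x₁ , x₂ , z , m₁ , m₂ , 0≤z , s′ , e′ =
          x₁ , u₂ ⊕ x₂ , z , m₁ , (u₂ , x₂ , fl₂ , m₂ , ≋-refl) , 0≤z , s′ , λ i →
            trans (e i) (trans (+-cong (e₂ i) (e′ i)) (trans (shuffle _ _ (z i)) (+-congʳ
              (trans (sym (++-⊕ 𝟎 x₁ u₂ x₂ i)) (++-cong {y = u₂ ⊕ x₂} (λ j → +-identityˡ (x₁ j)) ≋-refl i)))))
        g : Node w L₁ ((s , y) ∷ L₂) x → Mink _ x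
        g (x₁ , x₂′ , z , m₁ , (u₂ , x₂ , fl₂ , m₂ , e₂) , 0≤z , s′ , e) =
          (𝟎 ++ u₂) , (x₁ ++ x₂) ⊕ z , from flow-right (u₂ , fl₂ , ≋-refl) ,
          from (mink-split S) (x₁ , x₂ , z , m₁ , m₂ , 0≤z , s′ , ≋-refl) , λ i →
            trans (e i) (trans (+-congʳ (trans (++-cong (λ j → sym (+-identityˡ (x₁ j))) e₂ i) (++-⊕ 𝟎 x₁ u₂ x₂ i))) (+-assoc _ _ _))

    data Admissible : ∀ {d} → Tree Carrier d → Set (c ⊔ ℓ₁ ⊔ ℓ₂) where
      leaf : ∀ {y} → 0# < y → Admissible (leaf y)
      node : ∀ {m n} {l : Tree Carrier m} {r : Tree Carrier n} {y} →
             Admissible l → Admissible r → 0# ≤ y → Admissible (node l r y)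

    mink-leaf : ∀ {y} → 0# < y → Mink [ ⊤ , y ] ≐ ⟦ leaf y ⟧ 1#
    mink-leaf {y} (0≤y , _) =
      (λ { (u , x′ , (_ , _ , s) , lift f , e) → lift (trans (e zero) (trans (+-congˡ (f zero)) (trans s (sym (*-identityˡ y))))) }) ,
      (λ { {x} (lift e) → x , 𝟎 ,
        ( (λ { zero → ≤.≤-respʳ-≈ (sym (trans e (*-identityˡ y))) 0≤y })
        , (λ i i∉ → contradiction Subset.∈⊤ i∉) , trans (+-identityʳ _) (trans e (*-identityˡ y))) ,
        lift ≋-refl , λ i → sym (+-identityʳ _) })

    mink-node : ∀ {m n L w L₁ L₂ y} {l : Tree Carrier m} {r : Tree Carrier n} → Split L w L₁ L₂ → weight {m} {n} w ≈ y →
                Mink L₁ ≐ ⟦ l ⟧ 1# → Mink L₂ ≐ ⟦ r ⟧ 1# → Mink L ≐ ⟦ node l r y ⟧ 1#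
    mink-node {y = y} S w≈y (⊆₁ , ⊇₁) (⊆₂ , ⊇₂) =
      (λ m → case to (mink-split S) m of λ { (x₁ , x₂ , z , m₁ , m₂ , 0≤z , s , e) →
        x₁ , x₂ , z , ⊆₁ m₁ , ⊆₂ m₂ , 0≤z , trans s (trans w≈y (sym (*-identityˡ y))) , e }) ,
      (λ { (x₁ , x₂ , z , t₁ , t₂ , 0≤z , s , e) → from (mink-split S)
        (x₁ , x₂ , z , ⊇₁ t₁ , ⊇₂ t₂ , 0≤z , trans s (trans (*-identityˡ y) (sym w≈y)) , e) })

    zero? : Decidable (0# ≈_)
    zero? y = 0# ≤.≟ y

    mink-blocks : ∀ {d} {t : Tree Carrier d} → Admissible t → Mink (blocks zero? t) ≐ ⟦ t ⟧ 1#
    mink-blocks (leaf 0<y) = mink-leaf 0<y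
    mink-blocks (node {m} {n} {l} {r} {y} p q 0≤y) = mink-node (blocks-split zero? l r y) w≈ (mink-blocks p) (mink-blocks q)
      where
      w≈ : weight {m} {n} (wholeWeight zero? y) ≈ y
      w≈ with zero? y
      ... | yes 0≈y = 0≈y
      ... | no _    = refl

    blocks-positive : ∀ {d} {t : Tree Carrier d} → Admissible t → All ((0# <_) ∘ proj₂) (blocks zero? t)
    blocks-positive (leaf 0<y) = 0<y ∷ []
    blocks-positive (node {m} {n} {l} {r} {y} p q 0≤y) with zero? y
    ... | yes _  = sides
      where
      sides = All.++⁺ (All.map⁺ (blocks-positive p)) (All.map⁺ (blocks-positive q))
    ... | no 0≉y = (0≤y , 0≉y) ∷ sides
      where
      sides = All.++⁺ (All.map⁺ (blocks-positive p)) (All.map⁺ (blocks-positive q))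

    tree⇒nestohedron : ∀ {k s} {P : Pred (ℝ^ suc k) s} {t : Tree Carrier (suc k)} → Admissible t →
                       P ≐ ⟦ t ⟧ 1# → IsBinaryNestohedron P
    tree⇒nestohedron {t = t} adm P≐t = sets L , proj₂ (blocks-building zero? t) , b ,
      weights L , weights-all (blocks-positive adm) ,
      ≐-trans P≐t (≐-trans (≐-sym (mink-blocks adm)) ((λ {x} → from (eqv {x})) , (λ {x} → to (eqv {x}))))
      where
      L = blocks zero? t
      b = proj₁ (blocks-building zero? t)
      eqv : ∀ {x} → minkowskiSum (λ j → weights L j ⊙ Δ (lookup (sets L) j)) x ⇔ Mink L x
      eqv = minkowski-weights L (All.tabulate (IsBinaryBuildingSet.nonempty b)) (blocks-positive adm)

    Positive : ∀ {d} → List (Subset d × Carrier) → Set (c ⊔ ℓ₁ ⊔ ℓ₂)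
    Positive = All ((0# <_) ∘ proj₂)

    TreeOf : ∀ {d} → List (Subset d × Carrier) → Set _
    TreeOf {d} L = Σ[ t ∈ Tree Carrier d ] Admissible t × Mink L ≐ ⟦ t ⟧ 1#

    building⇒tree : ∀ f {d} (L : List (Subset (suc d) × Carrier)) → d ℕ.< f → IsBinaryBuildingSet (sets L) →
                    Unique (sets L) → Positive L → TreeOf L
    building⇒tree (suc f) {zero} [] _ b _ _ with IsBinaryBuildingSet.singletons b zero
    ... | ()
    building⇒tree (suc f) {zero} ((I , y) ∷ L) _ b u (0<y ∷ _) = single I L u b
      where
      full : ∀ {I : Subset 1} → Nonempty I → I ≡ ⊤
      full {inside Vec.∷ Vec.[]} _                    = ≡.refl
      full {outside Vec.∷ Vec.[]} (zero , ())
      single : ∀ I L → Unique (I ∷ sets L) → IsBinaryBuildingSet (I ∷ sets L) → TreeOf ((I , y) ∷ L)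
      single I [] u b with full (IsBinaryBuildingSet.nonempty b (here ≡.refl))
      ... | ≡.refl = leaf y , leaf 0<y , mink-leaf 0<y
      single I ((J , z) ∷ L) ((I≢J ∷ _) ∷ _) b = contradiction
        (≡.trans (full (nonempty (here ≡.refl))) (≡.sym (full (nonempty (there (here ≡.refl)))))) I≢J
        where open IsBinaryBuildingSet b
    building⇒tree (suc f) {suc d} L (s≤s d<f) b u pos = go L ≡.refl (s≤s d<f) b u pos (building-cut b)
      where
      -- The size is generalised so that matching on `cut` can replace it by the sum of the sizes of
      -- the two sides.
      go : ∀ {d} (L : List (Subset d × Carrier)) {B} → B ≡ sets L → d ℕ.≤ suc f → IsBinaryBuildingSet (sets L) →
           Unique (sets L) → Positive L → Cut B → TreeOf L
      go L e (s≤s d≤f) b u pos (cut m n sides) with split {L = L} (≡.subst (All Side) e sides) u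
      ... | w , L₁ , L₂ , S with split-building zero zero S b | split-unique S u | split-all S pos
      ... | b₁ , b₂ | u₁ , u₂ | posʷ , pos₁ , pos₂
        with building⇒tree f L₁ (ℕ.≤-trans (ℕ.≤-trans (s≤s (ℕ.m≤m+n m n)) (ℕ.≤-reflexive (≡.sym (ℕ.+-suc m n)))) d≤f) b₁ u₁ pos₁
           | building⇒tree f L₂ (ℕ.≤-trans (ℕ.m≤n+m (suc n) m) d≤f) b₂ u₂ pos₂
      ... | l , adm₁ , rep₁ | r , adm₂ , rep₂ =
        node l r (weight {suc m} {suc n} w) , node adm₁ adm₂ (0≤w w posʷ) , mink-node S refl rep₁ rep₂
        where
        0≤w : ∀ w → (∀ {y} → w ≡ just y → 0# < y) → 0# ≤ weight {suc m} {suc n} w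
        0≤w nothing  _ = ≤.refl
        0≤w (just y) p = proj₁ (p ≡.refl)

    nestohedron⇒tree : ∀ {k s} {P : Pred (ℝ^ suc k) s} → IsBinaryNestohedron P →
                       Σ[ t ∈ Tree Carrier (suc k) ] Admissible t × P ≐ ⟦ t ⟧ 1#
    nestohedron⇒tree {k} (B , u , b , y , 0<y , P≐) with building⇒tree (suc k) (attach B y) ℕ.≤-refl
        (≡.subst IsBinaryBuildingSet (≡.sym (sets-attach B y)) b) (≡.subst Unique (≡.sym (sets-attach B y)) u) (attach-all B y 0<y)
    ... | t , adm , M≐ = t , adm , ≐-trans P≐ (≐-trans ((λ {x} → to (eqv {x})) , (λ {x} → from (eqv {x}))) M≐)
      where
      eqv : ∀ {x} → minkowskiSum (λ j → y j ⊙ Δ (lookup B j)) x ⇔ Mink (attach B y) x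
      eqv = minkowski⇔ B y (All.tabulate (IsBinaryBuildingSet.nonempty b)) 0<y

-- Integral vertices and integral weights

module Integrality where

  open import Data.Vec.Functional using (_++_)
  open Words using (Tree; leaf; node; Leaves)
  open Polytopes
  open Fertilitopes
  open BuildingSets
  open BinaryNestohedra

  module Vertices {c ℓ₁ ℓ₂} (R : RealNumbers c ℓ₁ ℓ₂) where

    open Real R
    open Nestohedra R
    open Fertility R

    ⟨⟩-cong : ∀ {d} {a b x y : ℝ^ d} → a ≋ b → x ≋ y → ⟨ a , x ⟩ ≈ ⟨ b , y ⟩
    ⟨⟩-cong e f = sum-cong-≋ λ i → *-cong (e i) (f i)

    ⟨⟩-⊕ : ∀ {d} (a x y : ℝ^ d) → ⟨ a , x ⊕ y ⟩ ≈ ⟨ a , x ⟩ + ⟨ a , y ⟩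
    ⟨⟩-⊕ a x y = trans (sum-cong-≋ λ i → distribˡ (a i) (x i) (y i)) (∑-distrib-+ (λ i → a i * x i) (λ i → a i * y i))

    ⟨⟩-· : ∀ {d} (a : ℝ^ d) w x → ⟨ a , w ·ᵛ x ⟩ ≈ w * ⟨ a , x ⟩
    ⟨⟩-· a w x = trans (sum-cong-≋ λ i → solve 3 (λ a w x → a :* (w :* x) := w :* (a :* x)) refl (a i) w (x i))
      (sym (*-distribˡ-sum w (λ i → a i * x i)))

    ⟨⟩-++ : ∀ {m n} (a : ℝ^ m) (b : ℝ^ n) x y → ⟨ a ++ b , x ++ y ⟩ ≈ ⟨ a , x ⟩ + ⟨ b , y ⟩
    ⟨⟩-++ {m} a b x y = trans (sum-cong-≋ pointwise) (sum-++ (λ i → a i * x i) (λ j → b j * y j))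
      where
      pointwise : ∀ i → (a ++ b) i * (x ++ y) i ≈ ((λ i → a i * x i) ++ (λ j → b j * y j)) i
      pointwise i with splitAt m i
      ... | inj₁ _ = refl
      ... | inj₂ _ = refl

    ⟨⟩-shift : ∀ {d} (a : ℝ^ d) s x → ⟨ (λ i → a i + s) , x ⟩ ≈ ⟨ a , x ⟩ + s * sum x
    ⟨⟩-shift a s x = trans (sum-cong-≋ λ i → distribʳ (x i) (a i) s)
      (trans (∑-distrib-+ (λ i → a i * x i) (λ i → s * x i)) (+-congˡ (sym (*-distribˡ-sum s x))))

    +-tightˡ : ∀ {x y z w} → x ≤ y → z ≤ w → x + z ≈ y + w → x ≈ y
    +-tightˡ {x} {y} {z} {w} x≤y z≤w e = ≤.antisym x≤y (+-cancelʳ-≤ w (≤.≤-respˡ-≈ e (+-monoʳ-≤ x z≤w)))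

    +-tightʳ : ∀ {x y z w} → x ≤ y → z ≤ w → x + z ≈ y + w → z ≈ w
    +-tightʳ x≤y z≤w e = +-tightˡ z≤w x≤y (trans (+-comm _ _) (trans e (+-comm _ _)))

    *-cancelˡ : ∀ {w x y} → ¬ w ≈ 0# → w * x ≈ w * y → x ≈ y
    *-cancelˡ {w} {x} {y} w≉0 e with inverse w w≉0
    ... | v , wv≈1 = trans (sym (undo x)) (trans (*-congˡ e) (undo y))
      where
      undo : ∀ x → v * (w * x) ≈ x
      undo x = trans (sym (*-assoc v w x)) (trans (*-congʳ (trans (*-comm v w) wv≈1)) (*-identityˡ x))

    sum-mono : ∀ {d} {f g : Vector Carrier d} → (∀ i → f i ≤ g i) → sum f ≤ sum g
    sum-mono {zero}  p = ≤.refl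
    sum-mono {suc d} p = +-mono-≤ (p zero) (sum-mono (p ∘ suc))

    sum-tight : ∀ {d} {f g : Vector Carrier d} → (∀ i → f i ≤ g i) → sum f ≈ sum g → ∀ i → f i ≈ g i
    sum-tight p e zero    = +-tightˡ (p zero) (sum-mono (p ∘ suc)) e
    sum-tight p e (suc i) = sum-tight (p ∘ suc) (+-tightʳ (p zero) (sum-mono (p ∘ suc)) e) i

    MaxAt : ∀ {d s} → Pred (ℝ^ d) s → ℝ^ d → ℝ^ d → Set (c ⊔ ℓ₁ ⊔ ℓ₂ ⊔ s)
    MaxAt P a v = P v × (∀ x → P x → ⟨ a , x ⟩ ≤ ⟨ a , v ⟩ × (⟨ a , x ⟩ ≈ ⟨ a , v ⟩ → x ≋ v))

    module _ {d s} {S : Pred (ℝ^ d) s} (a : ℝ^ d) {M : Carrier} (S≤ : ∀ {x} → S x → ⟨ a , x ⟩ ≤ M) where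

      hull-≤ : ∀ {σ x} → Hull S σ x → ⟨ a , x ⟩ ≤ σ * M
      hull-≤ (nil e f) = ≤.reflexive (trans (⟨⟩-cong {a = a} ≋-refl f)
        (trans (sum-zero λ i → zeroʳ (a i)) (sym (trans (*-congʳ e) (zeroˡ M)))))
      hull-≤ (cons {w} {p} {σ′} {x′} 0≤w q h e f) = ≤-cong
        (sym (trans (⟨⟩-cong {a = a} ≋-refl f) (trans (⟨⟩-⊕ a _ _) (+-congʳ (⟨⟩-· a w p)))))
        (sym (trans (*-congʳ e) (distribʳ M w σ′)))
        (+-mono-≤ (*-monoˡ-≤ 0≤w (S≤ q)) (hull-≤ h))

      hull-attained : ∀ {σ x} → Hull S σ x → ¬ σ ≈ 0# → ⟨ a , x ⟩ ≈ σ * M → ∃[ p ] S p × ⟨ a , p ⟩ ≈ M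
      hull-attained (nil e f) σ≉0 _ = contradiction e σ≉0
      hull-attained {σ} {x} (cons {w} {p} {σ′} {x′} 0≤w q h e f) σ≉0 tight with ⟨ a , p ⟩ ≤.≟ M | w ≤.≟ 0#
      ... | yes eq | _      = p , q , eq
      ... | no ¬eq | no w≉0 = contradiction (*-cancelˡ w≉0 (+-tightˡ (*-monoˡ-≤ 0≤w (S≤ q)) (hull-≤ h) sums)) ¬eq
        where
        sums : w * ⟨ a , p ⟩ + ⟨ a , x′ ⟩ ≈ w * M + σ′ * M
        sums = trans (sym (trans (⟨⟩-cong {a = a} ≋-refl f) (trans (⟨⟩-⊕ a _ _) (+-congʳ (⟨⟩-· a w p)))))
          (trans tight (trans (*-congʳ e) (distribʳ M w σ′)))
      ... | no _   | yes w≈0 = hull-attained h (σ≉0 ∘ trans σ≈σ′) (trans (sym x≈x′) (trans tight (*-congʳ σ≈σ′)))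
        where
        σ≈σ′ : σ ≈ σ′
        σ≈σ′ = trans e (trans (+-congʳ w≈0) (+-identityˡ σ′))
        x≈x′ : ⟨ a , x ⟩ ≈ ⟨ a , x′ ⟩
        x≈x′ = ⟨⟩-cong {a = a} ≋-refl λ i → trans (f i)
          (trans (+-congʳ (trans (*-congʳ w≈0) (zeroˡ (p i)))) (+-identityˡ (x′ i)))

    -- Some generator attains the maximum of the functional, and uniqueness of the maximiser
    -- identifies it with the vertex.
    vertex-of-hull : ∀ {d s t} {P : Pred (ℝ^ d) s} {S : Pred (ℝ^ d) t} → P ≐ conv S → ∀ {v} → IsVertex P v →
                     ∃[ p ] S p × p ≋ v
    vertex-of-hull {P = P} {S} (P⊆ , ⊆P) {v} (Pv , a , max) =
      case hull-attained a (λ Sx → proj₁ (max _ (S⊆P Sx))) (conv⇒hull {S = S} (P⊆ Pv)) (0≉1 ∘ sym) (sym (*-identityˡ _)) of λ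
        { (p , Sp , e) → p , Sp , proj₂ (max p (S⊆P Sp)) e }
      where
      S⊆P : ∀ {x} → S x → P x
      S⊆P Sx = ⊆P (hull⇒conv {S = S} (hull-point Sx))

    lattice-integral : ∀ {d s} {P : Pred (ℝ^ d) s} (t : Tree ℕ d) → P ≐ ⟦ mapTree fromℕ t ⟧ 1# → IsIntegral P
    lattice-integral t P≐t v vert i with vertex-of-hull {S = LatticePoints t} (≐-trans P≐t (≐-sym (conv-lattice t))) vert
    ... | p , (q , _ , p≋) , p≋v = + (q i) , trans (sym (p≋v i)) (p≋ i)

    total : ∀ {d} → Tree Carrier d → Carrier
    total (leaf y)     = y
    total (node l r y) = (total l + total r) + y

    sum≈total : ∀ {d} (t : Tree Carrier d) {x} → ⟦ t ⟧ 1# x → sum x ≈ total t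
    sum≈total (leaf y) (lift e) = trans (+-identityʳ _) (trans e (*-identityˡ y))
    sum≈total (node l r y) (x₁ , x₂ , z , g₁ , g₂ , 0≤z , s , e) = trans (sum-cong-≋ e)
      (trans (∑-distrib-+ (x₁ ++ x₂) z) (+-cong (trans (sum-++ x₁ x₂) (+-cong (sum≈total l g₁) (sum≈total r g₂)))
        (trans s (*-identityˡ y))))

    -- The coordinate sum is constant on the polytope of a tree, so the shift adds the same amount
    -- to all values of the functional.
    maxAt-shift : ∀ {d} (t : Tree Carrier d) {a v} s → MaxAt (⟦ t ⟧ 1#) a v → MaxAt (⟦ t ⟧ 1#) (λ i → a i + s) v
    maxAt-shift t {a} {v} s (tv , max) = tv , λ x tx → let same = trans (sum≈total t tv) (sym (sum≈total t tx)) in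
      ≤-cong (trans (+-congˡ (*-congˡ same)) (sym (⟨⟩-shift a s x))) (sym (⟨⟩-shift a s v))
        (+-monoˡ-≤ _ _ _ (proj₁ (max x tx))) ,
      λ e → proj₂ (max x tx) (+-cancelʳ (s * sum v) _ _ (trans (+-congˡ (*-congˡ same))
        (trans (sym (⟨⟩-shift a s x)) (trans e (⟨⟩-shift a s v)))))

    StrictMax : ∀ {d} → ℝ^ d → Fin d → Set (ℓ₁ ⊔ ℓ₂)
    StrictMax a i = ∀ k → k ≢ i → a k < a i

    strictMax-≤ : ∀ {d} {a : ℝ^ d} {i} → StrictMax a i → ∀ k → a k ≤ a i
    strictMax-≤ {i = i} m k with k Fin.≟ i
    ... | yes ≡.refl = ≤.refl
    ... | no k≢i     = proj₁ (m k k≢i)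

    ⟨⟩-e : ∀ {d} (a : ℝ^ d) y i → ⟨ a , y ·ᵛ e i ⟩ ≈ a i * y
    ⟨⟩-e a y i = trans
      (sum-single _ i λ k k≢i → trans (*-congˡ (trans (*-congˡ (reflexive (e-≢ (k≢i ∘ ≡.sym)))) (zeroʳ y))) (zeroʳ (a k)))
      (*-congˡ (trans (*-congˡ (reflexive (e-≡ i))) (*-identityʳ y)))

    -- Replacing each `a k` by the largest coefficient can only increase the value. Equality forces
    -- `z k` to vanish wherever `a k` is strictly smaller.
    simplex-max : ∀ {d} {a : ℝ^ d} {i y z} → StrictMax a i → (∀ k → 0# ≤ z k) → sum z ≈ y →
                  ⟨ a , z ⟩ ≤ ⟨ a , y ·ᵛ e i ⟩ × (⟨ a , z ⟩ ≈ ⟨ a , y ·ᵛ e i ⟩ → z ≋ y ·ᵛ e i)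
    simplex-max {d} {a} {i} {y} {z} m 0≤z s =
      ≤.≤-respʳ-≈ peak (sum-mono termwise) , λ eq → supported (sum-tight termwise (trans eq (sym peak)))
      where
      termwise : ∀ k → a k * z k ≤ a i * z k
      termwise k = ≤-cong (*-comm (z k) (a k)) (*-comm (z k) (a i)) (*-monoˡ-≤ (0≤z k) (strictMax-≤ m k))
      peak : sum (λ k → a i * z k) ≈ ⟨ a , y ·ᵛ e i ⟩
      peak = trans (sym (*-distribˡ-sum (a i) z)) (trans (*-congˡ s) (sym (⟨⟩-e a y i)))
      supported : (∀ k → a k * z k ≈ a i * z k) → z ≋ y ·ᵛ e i
      supported tight k with k Fin.≟ i
      ... | yes ≡.refl = trans (sym (sum-single z i off)) (trans s (sym (trans (*-congˡ (reflexive (e-≡ i))) (*-identityʳ y))))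
        where
        off : ∀ k → k ≢ i → z k ≈ 0#
        off k k≢i with z k ≤.≟ 0#
        ... | yes z≈0 = z≈0
        ... | no z≉0  = contradiction (*-cancelˡ z≉0 (trans (*-comm _ _) (trans (tight k) (*-comm _ _)))) (proj₂ (m k k≢i))
      ... | no k≢i with z k ≤.≟ 0#
      ... | yes z≈0 = trans z≈0 (sym (trans (*-congˡ (reflexive (e-≢ (k≢i ∘ ≡.sym)))) (zeroʳ y)))
      ... | no z≉0  = contradiction (*-cancelˡ z≉0 (trans (*-comm _ _) (trans (tight k) (*-comm _ _)))) (proj₂ (m k k≢i))

    -- The maximum over a Minkowski sum is the sum of the maxima, and equality in the sum forces
    -- equality in each summand, so uniqueness is inherited.
    maxAt-node : ∀ {m n} {l : Tree Carrier m} {r : Tree Carrier n} {y a b v w k} → 0# ≤ y →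
      MaxAt (⟦ l ⟧ 1#) a v → MaxAt (⟦ r ⟧ 1#) b w → StrictMax (a ++ b) k →
      MaxAt (⟦ node l r y ⟧ 1#) (a ++ b) ((v ++ w) ⊕ y ·ᵛ e k)
    maxAt-node {l = l} {r} {y} {a} {b} {v} {w} {k} 0≤y (lv , maxˡ) (rw , maxʳ) strict =
      (v , w , y ·ᵛ e k , lv , rw , (λ i → *-nonneg y _ 0≤y (0≤e k i)) ,
        trans (sym (*-distribˡ-sum y (e k))) (trans (*-congˡ (sum-e k)) (*-comm y 1#)) , ≋-refl) ,
      λ x (x₁ , x₂ , z , l₁ , r₂ , 0≤z , s , eq) → let
        maxᶻ = simplex-max strict 0≤z (trans s (*-identityˡ y))
        value : ⟨ a ++ b , x ⟩ ≈ (⟨ a , x₁ ⟩ + ⟨ b , x₂ ⟩) + ⟨ a ++ b , z ⟩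
        value = trans (⟨⟩-cong {a = a ++ b} ≋-refl eq) (expand x₁ x₂ z)
        outer = +-mono-≤ (proj₁ (maxˡ x₁ l₁)) (proj₁ (maxʳ x₂ r₂))
        in
        ≤-cong (sym value) (sym (expand v w _)) (+-mono-≤ outer (proj₁ maxᶻ)) ,
        λ tight → let
          sums   = trans (sym value) (trans tight (expand v w _))
          outer≈ = +-tightˡ outer (proj₁ maxᶻ) sums
          in λ i → trans (eq i) (+-cong
            (++-cong (proj₂ (maxˡ x₁ l₁) (+-tightˡ (proj₁ (maxˡ x₁ l₁)) (proj₁ (maxʳ x₂ r₂)) outer≈))
                     (proj₂ (maxʳ x₂ r₂) (+-tightʳ (proj₁ (maxˡ x₁ l₁)) (proj₁ (maxʳ x₂ r₂)) outer≈)) i)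
            (proj₂ maxᶻ (+-tightʳ outer (proj₁ maxᶻ) sums) i))
      where
      expand : ∀ x₁ x₂ z → ⟨ a ++ b , (x₁ ++ x₂) ⊕ z ⟩ ≈ (⟨ a , x₁ ⟩ + ⟨ b , x₂ ⟩) + ⟨ a ++ b , z ⟩
      expand x₁ x₂ z = trans (⟨⟩-⊕ (a ++ b) _ z) (+-congʳ (⟨⟩-++ a b x₁ x₂))

    -- The vertices obtained by letting, at each node, one side dominate the other.
    data Corner : ∀ {d} → Tree Carrier d → ℝ^ d → ℝ^ d → Fin d → Set (c ⊔ ℓ₁ ⊔ ℓ₂) where
      leaf  : ∀ {y} → Corner (leaf y) (λ _ → y) 𝟎 zero
      left  : ∀ {m n} {l : Tree Carrier m} {r : Tree Carrier n} {y v w a b i j} →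
              Corner l v a i → Corner r w b j → ∀ s → b j + s < a i →
              Corner (node l r y) ((v ++ w) ⊕ y ·ᵛ e (i ↑ˡ n)) (a ++ (λ k → b k + s)) (i ↑ˡ n)
      right : ∀ {m n} {l : Tree Carrier m} {r : Tree Carrier n} {y v w a b i j} →
              Corner l v a i → Corner r w b j → ∀ s → a i + s < b j →
              Corner (node l r y) ((v ++ w) ⊕ y ·ᵛ e (m ↑ʳ j)) ((λ k → a k + s) ++ b) (m ↑ʳ j)

    <-resp : ∀ {x x′ y y′} → x ≈ x′ → y ≈ y′ → x < y → x′ < y′
    <-resp e f (p , q) = ≤-cong e f p , λ g → q (trans e (trans g (sym f)))

    ≤-<-trans : ∀ {x y z} → x ≤ y → y < z → x < z
    ≤-<-trans x≤y (y≤z , y≉z) = ≤.trans x≤y y≤z , λ x≈z → y≉z (≤.antisym y≤z (≤.≤-respˡ-≈ x≈z x≤y))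

    strict-++ : ∀ {m n} (a : ℝ^ m) (b : ℝ^ n) k {M} → (a ++ b) k ≈ M →
      (∀ i → (i ↑ˡ n) ≢ k → a i < M) → (∀ j → (m ↑ʳ j) ≢ k → b j < M) → StrictMax (a ++ b) k
    strict-++ {m} {n} a b k e l r = by-sides (λ i → i ≢ k → (a ++ b) i < (a ++ b) k)
      (λ i i≢k → <-resp (sym (reflexive (++-↑ˡ a b i))) (sym e) (l i i≢k))
      (λ j j≢k → <-resp (sym (reflexive (++-↑ʳ a b j))) (sym e) (r j j≢k))

    corner-strict : ∀ {d} {t : Tree Carrier d} {v a i} → Corner t v a i → StrictMax a i
    corner-strict leaf zero 0≢0 = contradiction ≡.refl 0≢0
    corner-strict (left {m} {n} {a = a} {b} {i} {j} p q s lt) = strict-++ a (λ k → b k + s) (i ↑ˡ n) (reflexive (++-↑ˡ a _ i))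
      (λ k k≢i → corner-strict p k (k≢i ∘ ≡.cong (_↑ˡ n)))
      (λ k _ → ≤-<-trans (+-monoˡ-≤ _ _ s (strictMax-≤ (corner-strict q) k)) lt)
    corner-strict (right {m} {n} {a = a} {b} {i} {j} p q s lt) = strict-++ (λ k → a k + s) b (m ↑ʳ j) (reflexive (++-↑ʳ (λ k → a k + s) b j))
      (λ k _ → ≤-<-trans (+-monoˡ-≤ _ _ s (strictMax-≤ (corner-strict p) k)) lt)
      (λ k k≢j → corner-strict q k (k≢j ∘ ≡.cong (m ↑ʳ_)))

    corner-max : ∀ {d} {t : Tree Carrier d} {v a i} → Admissible t → Corner t v a i → MaxAt (⟦ t ⟧ 1#) a v
    corner-max (leaf {y} _) leaf = lift (sym (*-identityˡ y)) , λ x (lift e) →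
      ≤.reflexive (trans (zeros x) (sym (zeros (λ _ → y)))) , λ _ → λ { zero → trans e (*-identityˡ y) }
      where
      zeros : ∀ (x : ℝ^ 1) → ⟨ 𝟎 , x ⟩ ≈ 0#
      zeros x = sum-zero {1} λ i → zeroˡ (x i)
    corner-max (node {r = r} al ar 0≤y) c@(left p q s lt) =
      maxAt-node 0≤y (corner-max al p) (maxAt-shift r s (corner-max ar q)) (corner-strict c)
    corner-max (node {l = l} al ar 0≤y) c@(right p q s lt) =
      maxAt-node 0≤y (maxAt-shift l s (corner-max al p)) (corner-max ar q) (corner-strict c)

    room-below : ∀ x y → ∃[ s ] y + s < x
    -- Chosen so that `y + s` equals `x` minus one.
    room-below x y = (x + - 1#) + - y ,
      <-resp (sym (trans (+-comm y _) (-+ y _))) refl (x-1≤x , λ e → 0≉1 (sym (1≈0 e)))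
      where
      x-1≤x : x + - 1# ≤ x
      x-1≤x = +-cancelʳ-≤ 1# (≤.≤-respˡ-≈ (trans (+-identityʳ x) (sym (-+ 1# x))) (+-monoʳ-≤ x 0≤1))
      1≈0 : x + - 1# ≈ x → 1# ≈ 0#
      1≈0 e = +-cancelˡ x 1# 0# (trans (+-congʳ (sym e)) (trans (-+ 1# x) (sym (+-identityʳ x))))

    corner-exists : ∀ {d} (t : Tree Carrier d) → ∃[ v ] ∃[ a ] ∃[ i ] Corner t v a i
    corner-exists (leaf y) = _ , _ , _ , leaf
    corner-exists (node l r y) with corner-exists l | corner-exists r
    ... | v , a , i , p | w , b , j , q with room-below (a i) (b j)
    ... | s , lt = _ , _ , _ , left p q s lt

    tree-nonneg : ∀ {d} {t : Tree Carrier d} → Admissible t → ∀ {x} → ⟦ t ⟧ 1# x → ∀ k → 0# ≤ x k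
    tree-nonneg (leaf {y} (0≤y , _)) (lift e) zero = ≤.≤-respʳ-≈ (sym (trans e (*-identityˡ y))) 0≤y
    tree-nonneg (node p q _) (x₁ , x₂ , z , g₁ , g₂ , 0≤z , _ , e) k = ≤.≤-respʳ-≈ (sym (e k)) (0≤+
      (by-sides (λ k → 0# ≤ (x₁ ++ x₂) k)
        (λ i → ≤.≤-respʳ-≈ (sym (reflexive (++-↑ˡ x₁ x₂ i))) (tree-nonneg p g₁ i))
        (λ j → ≤.≤-respʳ-≈ (sym (reflexive (++-↑ʳ x₁ x₂ j))) (tree-nonneg q g₂ j)) k) (0≤z k))

    IsNatural : Carrier → Set ℓ₁
    IsNatural x = ∃[ n ] x ≈ fromℕ n

    natural : ∀ {x} → 0# ≤ x → ∃[ z ] x ≈ fromℤ z → IsNatural x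
    natural 0≤x (+ n , e)      = n , e
    natural {x} 0≤x (-[1+ n ] , e) = contradiction
      (≤-cong (+-identityˡ _) (trans (+-congʳ e) (-‿inverseˡ (fromℕ (suc n)))) (+-monoˡ-≤ _ _ (fromℕ (suc n)) 0≤x))
      (fromℕ-suc-≰ n)

    natural-difference : ∀ {x y} → 0# ≤ y → IsNatural x → IsNatural (x + y) → IsNatural y
    natural-difference {x} {y} 0≤y (m , e) (n , f) with ℕ.m≤n⇒∃[o]m+o≡n m≤n
      where
      m≤n : m ℕ.≤ n
      m≤n = fromℕ-cancel-≤ (≤-cong (trans (+-identityʳ x) e) f (+-monoʳ-≤ x 0≤y))
    ... | o , ≡.refl = o , +-cancelˡ (fromℕ m) y (fromℕ o) (trans (+-congʳ (sym e)) (trans f (fromℕ-+ m o)))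

    -- Weights are known only up to the equality `≈` of real numbers, so propositional equality of
    -- trees would be too fine.
    data _≈ᵗ_ : ∀ {d} → Tree Carrier d → Tree Carrier d → Set (c ⊔ ℓ₁) where
      leaf : ∀ {x y} → x ≈ y → leaf x ≈ᵗ leaf y
      node : ∀ {m n} {l l′ : Tree Carrier m} {r r′ : Tree Carrier n} {y y′} → l ≈ᵗ l′ → r ≈ᵗ r′ → y ≈ y′ →
             node l r y ≈ᵗ node l′ r′ y′

    ≈ᵗ-sym : ∀ {d} {t t′ : Tree Carrier d} → t ≈ᵗ t′ → t′ ≈ᵗ t
    ≈ᵗ-sym (leaf e)     = leaf (sym e)
    ≈ᵗ-sym (node p q e) = node (≈ᵗ-sym p) (≈ᵗ-sym q) (sym e)

    tree-cong : ∀ {d} {t t′ : Tree Carrier d} → t ≈ᵗ t′ → ∀ {σ x} → ⟦ t ⟧ σ x → ⟦ t′ ⟧ σ x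
    tree-cong (leaf e) (lift f) = lift (trans f (*-congˡ e))
    tree-cong (node p q e) (x₁ , x₂ , z , g₁ , g₂ , 0≤z , s , f) =
      x₁ , x₂ , z , tree-cong p g₁ , tree-cong q g₂ , 0≤z , trans s (*-congˡ e) , f

    module _ {m n} (v : ℝ^ m) (w : ℝ^ n) (y : Carrier) where

      corner-far-left : ∀ j i → ((v ++ w) ⊕ y ·ᵛ e (m ↑ʳ j)) (i ↑ˡ n) ≈ v i
      corner-far-left j i = trans (+-cong (reflexive (++-↑ˡ v w i))
        (trans (*-congˡ (reflexive (e-≢ λ q → ℕ.<-irrefl (≡.cong toℕ (≡.sym q)) (↑ˡ<↑ʳ i j)))) (zeroʳ y))) (+-identityʳ _)

      corner-far-right : ∀ i j → ((v ++ w) ⊕ y ·ᵛ e (i ↑ˡ n)) (m ↑ʳ j) ≈ w j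
      corner-far-right i j = trans (+-cong (reflexive (++-↑ʳ v w j))
        (trans (*-congˡ (reflexive (e-≢ λ q → ℕ.<-irrefl (≡.cong toℕ q) (↑ˡ<↑ʳ i j)))) (zeroʳ y))) (+-identityʳ _)

      corner-peak : ∀ i → ((v ++ w) ⊕ y ·ᵛ e (i ↑ˡ n)) (i ↑ˡ n) ≈ v i + y
      corner-peak i = +-cong (reflexive (++-↑ˡ v w i)) (trans (*-congˡ (reflexive (e-≡ (i ↑ˡ n)))) (*-identityʳ y))

    -- A corner of a subtree extends to a corner of the tree on which the other
    -- side dominates, and switching sides shifts one coordinate by the weight.
    natural-tree : ∀ {d} {t : Tree Carrier d} → Admissible t → (∀ {v a i} → Corner t v a i → ∀ k → IsNatural (v k)) →
                   Σ[ t′ ∈ Tree ℕ d ] Leaves (0 ℕ.<_) t′ × t ≈ᵗ mapTree fromℕ t′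
    natural-tree (leaf (_ , 0≉y)) nat with nat leaf zero
    ... | zero  , e = contradiction (sym e) 0≉y
    ... | suc n , e = leaf (suc n) , leaf (s≤s z≤n) , leaf e
    natural-tree (node {l = l} {r} {y} p q 0≤y) nat
      with corner-exists l | corner-exists r
    ... | v , a , i , cˡ | w , b , j , cʳ = combine (natural-tree p natˡ) (natural-tree q natʳ) natʸ
      where
      natˡ : ∀ {v a i} → Corner l v a i → ∀ k → IsNatural (v k)
      natˡ {v} {a} {i} cv k with room-below (b j) (a i)
      ... | s , lt with nat (right cv cʳ s lt) (k ↑ˡ _)
      ... | n , e = n , trans (sym (corner-far-left v w y j k)) e
      natʳ : ∀ {w b j} → Corner r w b j → ∀ k → IsNatural (w k)
      natʳ {w} {b} {j} cw k with room-below (a i) (b j)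
      ... | s , lt with nat (left cˡ cw s lt) (_ ↑ʳ k)
      ... | n , e = n , trans (sym (corner-far-right v w y i k)) e
      natʸ : IsNatural y
      natʸ with room-below (a i) (b j)
      ... | s , lt with nat (left cˡ cʳ s lt) (i ↑ˡ _)
      -- The coordinate in question is `v i + y`, and `v i` is already known to be natural.
      ... | n , e = natural-difference 0≤y (natˡ cˡ i) (n , trans (sym (corner-peak v w y i)) e)
      combine : _ → _ → IsNatural y → _
      combine (l′ , pl , el) (r′ , pr , er) (n , e) = node l′ r′ n , node pl pr , node el er e

    admissible-fromℕ : ∀ {d} {t : Tree ℕ d} → Leaves (0 ℕ.<_) t → Admissible (mapTree fromℕ t)
    admissible-fromℕ {t = leaf (suc n)} (leaf _) = leaf (0≤fromℕ (suc n) , λ e → fromℕ-suc-≰ n (≤.reflexive (sym e)))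
    admissible-fromℕ {t = node l r y} (node p q) = node (admissible-fromℕ p) (admissible-fromℕ q) (0≤fromℕ y)

    -- A corner is the unique maximiser of its functional, hence a vertex. Its coordinates are
    -- integers by hypothesis and nonnegative, hence natural numbers.
    integral-tree : ∀ {d s} {P : Pred (ℝ^ d) s} {t : Tree Carrier d} → Admissible t → P ≐ ⟦ t ⟧ 1# → IsIntegral P →
                    Σ[ t′ ∈ Tree ℕ d ] Leaves (0 ℕ.<_) t′ × P ≐ ⟦ mapTree fromℕ t′ ⟧ 1#
    integral-tree {P = P} {t} adm P≐t int with natural-tree adm nat
      where
      nat : ∀ {v a i} → Corner t v a i → ∀ k → IsNatural (v k)
      nat {v} {a} cv k with corner-max adm cv
      ... | tv , max = natural (tree-nonneg adm tv k)
        (int v (proj₂ P≐t tv , a , λ x Px → max x (proj₁ P≐t Px)) k)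
    ... | t′ , pos , t≈t′ = t′ , pos , ≐-trans P≐t (tree-cong t≈t′ , tree-cong (≈ᵗ-sym t≈t′))

theorem3p2 : ∀ {c ℓ₁ ℓ₂ s} (R : RealNumbers c ℓ₁ ℓ₂) → let open Geometry R in
    ∀ {d : ℕ} (P : Pred (ℝ^ d) s) → IsPolytope P → ∃ P →
    IsFertilitope P ⇔ (IsIntegral P × IsBinaryNestohedron P)
theorem3p2 R {zero}  P _ _ = mk⇔ (λ ()) (λ ())
theorem3p2 R {suc k} P _ inhabited = mk⇔ f g
  where
  open Geometry R
  f : IsFertilitope P → IsIntegral P × IsBinaryNestohedron P
  f fer with to (Fertilitopes.Fertility.fertilitope⇔tree R inhabited) fer
  ... | t , pos , P≐t = Integrality.Vertices.lattice-integral R t P≐t ,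
    BinaryNestohedra.Nestohedra.tree⇒nestohedron R (Integrality.Vertices.admissible-fromℕ R pos) P≐t
  g : IsIntegral P × IsBinaryNestohedron P → IsFertilitope P
  g (int , nest) with BinaryNestohedra.Nestohedra.nestohedron⇒tree R nest
  ... | t , adm , P≐t = from (Fertilitopes.Fertility.fertilitope⇔tree R inhabited) (Integrality.Vertices.integral-tree R adm P≐t int)
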